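{- Let $n$ be a sufficiently large prime and let $k, d \in \mathbb{N}$. For every $0 < \gamma < 1/2$, there exists $C = C(\gamma) > 0$ such that the following holds for all $m \ge (d + 1)k/2$ and all $\varepsilon$ with $C/k < \varepsilon < \gamma$. For each $d$-dimensional generalised arithmetic progression $P \subseteq \mathbb{Z}_n$, there exists a collection $\mathcal{F}$ of subsets of $P$ satisfying: (a) for every $F \in \mathcal{F}$, we have $|F| \le C \varepsilon^{ -1} \sqrt{m \log m}$ and $|F \hat{+} F| \ge \frac{(1 - \gamma)(d + 1)k}{2}$; (b) for every $X \subseteq P$ with $|X| = k$, $|X \hat{+} X| \le m$ and $\varepsilon$-robust Freiman dimension $d$, there exists $F \in \mathcal{F}$ such that $F \subseteq X$.
   Context: For $X \subseteq \mathbb{Z}_n$, $X \hat{+} X = \{x_1 + x_2 : x_1, x_2 \in X, x_1 \ne x_2\}$. A $d$-dimensional generalised arithmetic progression in $\mathbb{Z}_n$ is a set of the form $\{a_0 + \sum_{i=1}^d w_i a_i : w_i \in \mathbb{Z}, 0 \le w_i < \ell_i\}$ with $a_0, \dots, a_d \in \mathbb{Z}_n$ and $\ell_1, \dots, \ell_d \in \mathbb{N}$. A Freiman homomorphism is a map $\phi : X \to Y$ between subsets of abelian groups such that $a_1 + b_1 = a_2 + b_2$ implies $\phi(a_1) + \phi(b_1) = \phi(a_2) + \phi(b_2)$ for all $a_1, a_2, b_1, b_2 \in X$; a Freiman isomorphism is a bijection $\phi$ such that $\phi$ and $\phi^{ -1}$ are Freiman homomorphisms. A set $S \subseteq \mathbb{R}^d$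 has full rank if it is not contained in any affine subspace of dimension less than $d$. The Freiman dimension $\dim_{\mathrm{F}}(X)$ is the largest $d$ for which there is a full rank subset of $\mathbb{Z}^d$ Freiman isomorphic to $X$. $X$ has $\varepsilon$-robust Freiman dimension $d$ if $\dim_{\mathrm{F}}(X) \ge d$ and there is no $X' \subseteq X$ with $|X'| \ge (1 - \varepsilon)|X|$ and $\dim_{\mathrm{F}}(X') < d$. Floors and ceilings are omitted where not essential.
   Formalization: The parameters γ and ε (and the constant C) are rational numbers instead of real numbers. -}

module Defs where

open import Data.Nat as ℕ using (ℕ; zero; suc; _<_; _≤_)
open import Data.Nat.DivMod using (_%_; m%n<n)
open import Data.Integer as ℤ using (ℤ)
open import Data.Rational as ℚ using (ℚ; 0ℚ; 1ℚ)
open import Data.Fin as Fin using (Fin; toℕ; fromℕ<)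
open import Data.Fin.Subset using (Subset; _∈_; _⊆_; ∣_∣)
open import Data.Vec using (Vec; tabulate; lookup)
open import Data.List using (List; allFin)
open import Data.Bool.ListAction using (any)
open import Data.Bool using (Bool; _∧_; not)
open import Data.Product using (Σ; ∃; _×_)
open import Data.Sum using (_⊎_)
open import Function using (_∘_)
open import Relation.Nullary using (¬_)
open import Relation.Nullary.Decidable using (⌊_⌋)
open import Relation.Binary.PropositionalEquality using (_≡_)

infixl 6 _⊕_
_⊕_ : ∀ {n} → Fin n → Fin n → Fin n
_⊕_ {suc n} i j = fromℕ< (m%n<n (toℕ i ℕ.+ toℕ j) (suc n))

scal : ∀ {n} → ℕ → Fin n → Fin n
scal {suc n} zero    a = Fin.zero
scal {suc n} (suc w) a = a ⊕ scal w a

restrictedSumset : ∀ {n} → Subset n → Subset n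
restrictedSumset {n} X = tabulate λ z →
  any (λ i → any (λ j →
      lookup X i ∧ lookup X j ∧ not ⌊ i Fin.≟ j ⌋ ∧ ⌊ (i ⊕ j) Fin.≟ z ⌋)
    (allFin n)) (allFin n)

gapElem : ∀ {n d} → Fin n → (Fin d → Fin n) → Fin n
gapElem {d = zero}  a₀ f = a₀
gapElem {d = suc d} a₀ f = f Fin.zero ⊕ gapElem a₀ (f ∘ Fin.suc)

IsGAP : ∀ {n} → ℕ → Subset n → Set
IsGAP {n} d P =
  Σ (Fin n) λ a₀ → Σ (Fin d → Fin n) λ a → Σ (Fin d → ℕ) λ ℓ →
    ∀ x → (x ∈ P → Σ ((i : Fin d) → Fin (ℓ i)) λ w →
                     x ≡ gapElem a₀ (λ i → scal (toℕ (w i)) (a i)))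
        × ((w : (i : Fin d) → Fin (ℓ i)) →
                     gapElem a₀ (λ i → scal (toℕ (w i)) (a i)) ∈ P)

-- Full rank (affine subspaces with rational coefficients; the sets are
-- integral, so this agrees with the real notion).

sumℚ : ∀ {e} → (Fin e → ℚ) → ℚ
sumℚ {zero}  f = 0ℚ
sumℚ {suc e} f = f Fin.zero ℚ.+ sumℚ (f ∘ Fin.suc)

ContainedInAffine : ∀ {D} → ((Fin D → ℚ) → Set) → ℕ → Set
ContainedInAffine {D} S e =
  Σ (Fin D → ℚ) λ p → Σ (Fin e → Fin D → ℚ) λ v →
    ∀ s → S s → Σ (Fin e → ℚ) λ t →
      ∀ c → s c ≡ p c ℚ.+ sumℚ (λ j → t j ℚ.* v j c)

FullRank : ∀ {D} → ((Fin D → ℚ) → Set) → Set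
FullRank {D} S = ∀ e → e < D → ¬ ContainedInAffine S e

-- Freiman isomorphisms X → S with X ⊆ ℤ_n and S ⊆ ℤ^D.
-- S is represented as the image φ(X) of the map φ.

_≗ᵥ_ : ∀ {D} → (Fin D → ℤ) → (Fin D → ℤ) → Set
u ≗ᵥ v = ∀ c → u c ≡ v c

_+ᵥ_ : ∀ {D} → (Fin D → ℤ) → (Fin D → ℤ) → (Fin D → ℤ)
(u +ᵥ v) c = u c ℤ.+ v c

IsFreimanIso : ∀ {n D} → Subset n → (Fin n → (Fin D → ℤ)) → Set
IsFreimanIso X φ =
    (∀ {x y} → x ∈ X → y ∈ X → φ x ≗ᵥ φ y → x ≡ y)
  × (∀ {a₁ a₂ b₁ b₂} → a₁ ∈ X → a₂ ∈ X → b₁ ∈ X → b₂ ∈ X →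
       a₁ ⊕ b₁ ≡ a₂ ⊕ b₂ → (φ a₁ +ᵥ φ b₁) ≗ᵥ (φ a₂ +ᵥ φ b₂))
  × (∀ {a₁ a₂ b₁ b₂} → a₁ ∈ X → a₂ ∈ X → b₁ ∈ X → b₂ ∈ X →
       (φ a₁ +ᵥ φ b₁) ≗ᵥ (φ a₂ +ᵥ φ b₂) → a₁ ⊕ b₁ ≡ a₂ ⊕ b₂)

toℚᵥ : ∀ {D} → (Fin D → ℤ) → (Fin D → ℚ)
toℚᵥ u c = u c ℚ./ 1

Image : ∀ {n D} → Subset n → (Fin n → (Fin D → ℤ)) → (Fin D → ℚ) → Set
Image X φ s = Σ _ λ x → x ∈ X × (∀ c → s c ≡ toℚᵥ (φ x) c)

-- dim_F(X) ≥ d : there is D ≥ d and a full rank S ⊆ ℤ^D Freiman isomorphic to X.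
-- (dim_F(X) is the largest such D, so dim_F(X) ≥ d iff such a D ≥ d exists.)
DimF≥ : ∀ {n} → Subset n → ℕ → Set
DimF≥ X d = Σ ℕ λ D → d ≤ D × Σ (_ → (Fin D → ℤ)) λ φ →
  IsFreimanIso X φ × FullRank (Image X φ)

RobustFreimanDim : ∀ {n} → ℚ → Subset n → ℕ → Set
RobustFreimanDim ε X d =
  DimF≥ X d ×
  ¬ (Σ _ λ X' → X' ⊆ X × ((1ℚ ℚ.- ε) ℚ.* (ℤ.+ ∣ X ∣ ℚ./ 1) ℚ.≤ (ℤ.+ ∣ X' ∣ ℚ./ 1))
                × ¬ DimF≥ X' d)

expTerm : ℚ → ℕ → ℚ
expTerm x zero    = 1ℚ
expTerm x (suc i) = expTerm x i ℚ.* x ℚ.* (ℤ.+ 1 ℚ./ suc i)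

expPartial : ℚ → ℕ → ℚ
expPartial x zero    = 0ℚ
expPartial x (suc N) = expPartial x N ℚ.+ expTerm x N

-- x ≤ ln m   (intended for m ≥ 1, where ln m ≥ 0):
-- either x ≤ 0, or e^x = sup_N expPartial x N ≤ m.
_≤ln_ : ℚ → ℕ → Set
x ≤ln m = x ℚ.≤ 0ℚ ⊎ (∀ N → expPartial x N ℚ.≤ (ℤ.+ m ℚ./ 1))

-- s ≤ C ε⁻¹ √(m ln m)   (for C, ε > 0, m ≥ 1), i.e. s² ε² ≤ C² m ln m:
-- every rational x with x · C² m ≤ s² ε² satisfies x ≤ ln m.
BoundedBy : ℕ → ℚ → ℚ → ℕ → Set
BoundedBy s C ε m =
  ∀ x → x ℚ.* (C ℚ.* C ℚ.* (ℤ.+ m ℚ./ 1)) ℚ.≤ (ℤ.+ s ℚ./ 1) ℚ.* (ℤ.+ s ℚ./ 1) ℚ.* ε ℚ.* ε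
      → x ≤ln m

{-# OPTIONS --safe #-}

-- Since the size of 𝓕 is not restricted, 𝓕 consists of all the subsets of P that are small and have a
-- large restricted sumset, and the task is to find one inside every X.
--
-- Call a sum of two distinct elements of X popular if it has at least r ≈ ε² k² / m representations. All
-- but ε k elements of X form only few unpopular sums, and by robustness these good elements still have
-- Freiman dimension at least d. The core is that a set of k elements of full rank in ℤᴰ, D ≥ d, contains
-- O_γ(d) elements T such that T + X has almost (d + 1) k / 2 elements. Applied to the good elements this
-- gives almost (d + 1) k / 2 popular sums, and a greedy choice of O(k / √r) elements of X covers most of
-- them. If ε k is so small that X itself is an admissible F, one takes F = X.
--
-- To find T, let H be the span of the elements chosen so far and e its codimension. If v ∈ X is maximal for
-- a linear order on the quotient by H, then v + x is new for every positive x, that is, for half of X \ H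
-- up to a choice of signs. Moreover v can be kept off the e - 1 heaviest lines through H, so that the number
-- of elements of X in H grows by at most k / e. Once H contains a proportion 1 / G of X, either X meets many
-- cosets of H, and one translate of X ∩ H from each of these suffices, or T may contain an element of every
-- coset; then the inequality 2 |B + Y| ≥ 2 |Y| + e (|B| - 1), for Y of rank e and ∅ ≠ B ⊆ Y, applied to the
-- sets B of cosets that contain more than s elements of X, provides the missing sums.

module Submission where

import Algebra.Properties.AbelianGroup
open import Defs
open import Data.Nat as ℕ using (ℕ; zero; suc; _+_; _*_; _∸_; _≤_; _<_; z≤n; s≤s)
open import Data.Nat.Properties as ℕₚ
  using (≤-refl; ≤-trans; ≤-reflexive; _≤?_; ≰⇒>; ≮⇒≥; +-mono-≤; *-mono-≤; *-monoʳ-≤; *-monoˡ-≤; m≤m+n; m≤n+m; <-≤-trans; ≤-<-trans; <-irrefl)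
open import Data.Nat.Primality using (Prime)
open import Data.Nat.DivMod using (m%n<n)
open import Data.Nat.Tactic.RingSolver using (solve-∀)
open import Data.Integer as ℤ using (ℤ)
import Data.Integer.Properties as ℤₚ
open import Data.Rational as ℚ using (ℚ; 0ℚ; 1ℚ; ½)
import Data.Rational.Properties as ℚₚ
import Data.Rational.Solver as ℚSolver
open import Data.Rational.Unnormalised as ℚᵘ using (ℚᵘ; mkℚᵘ)
import Data.Rational.Unnormalised.Properties as ℚᵘₚ
open import Data.Fin as Fin using (Fin; toℕ; fromℕ<)
import Data.Fin.Properties as Finₚ
open import Data.Fin.Subset as Sub using (Subset; _⊆_; ∣_∣; inside; outside)
import Data.Fin.Subset.Properties as Subₚ
open import Data.Vec as Vec using (Vec; []; _∷_)
import Data.Vec.Properties as Vecₚ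
open import Data.Bool using (Bool; true; false; _∧_; not)
open import Data.Bool.ListAction using (any)
import Data.Bool.Properties as Boolₚ
open import Data.List as List using (List; []; _∷_; _++_; length; filter; map; take; allFin)
import Data.List.Properties as Listₚ
open import Data.List.Relation.Unary.All as All using (All; []; _∷_)
import Data.List.Relation.Unary.All.Properties as Allₚ
open import Data.List.Relation.Unary.Any as Any using (Any; here; there)
import Data.List.Relation.Unary.Any.Properties as Anyₚ
open import Data.List.Relation.Unary.AllPairs as AllPairs using (AllPairs; []; _∷_)
open import Data.List.Relation.Unary.Unique.Propositional using (Unique)
import Data.List.Relation.Unary.Unique.Propositional.Properties as Uniqueₚ
open import Data.List.Membership.Propositional using (_∈_; _∉_; find; lose)
import Data.List.Membership.Propositional.Properties as ∈ₚ
import Data.List.Membership.DecPropositional as DecMembership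
open import Data.Product using (Σ; ∃; _×_; _,_; proj₁; proj₂)
open import Data.Sum using (_⊎_; inj₁; inj₂; [_,_]′)
open import Data.Empty using (⊥; ⊥-elim)
open import Data.Unit using (⊤; tt)
open import Function using (_∘_; id; case_of_; Equivalence)
open import Relation.Nullary using (¬_; Dec; yes; no)
open import Relation.Nullary.Decidable as Dec using (¬?; _×-dec_; _⊎-dec_; ⌊_⌋; toWitness; fromWitness; decidable-stable)
open import Relation.Unary using (Decidable)
import Relation.Binary
open import Relation.Binary.PropositionalEquality using (_≡_; _≢_; refl; sym; trans; cong; cong₂; subst; subst₂; module ≡-Reasoning)

-- The translate by 0 already contributes `k`, twice what a further translate brings. This spare
-- `k / 2` is what the Freiman-Ruzsa stage consumes: it does not see the elements of `X` in `H`,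
-- whose number may reach `k / G + k / (e + 1)`, and `e / 2` times the second term is almost
-- `k / 2`. An increment of order `k / e` per step is therefore affordable.
--
-- The number of translates is linear in `d`, so every loss is a proportion of `(d + 1) k`. This is
-- why all thresholds, and with them `C`, depend on γ alone.
--
-- Robustness is a negative statement, so the dimension of the good elements is known only up to a
-- double negation. The conditions on members of 𝓕 are therefore inequalities between natural
-- numbers, which are decidable, and a search through the finitely many subsets recovers an actual
-- `F`. To this end γ is replaced by `1 / (g + 1) ≤ γ`, and `ε k` by its integer part `B`, with
-- `B ≤ ε k ≤ 2 B`. The size bound is free of logarithms; these enter only through `1 / 2 ≤ ln m`.

-- Linear inequalities are proved by adding up the hypotheses; s is the slack of the result.
lin≤ : ∀ {a b} l r s → a ≤ b → l + b + s ≡ r + a → l ≤ r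
lin≤ {a} {b} l r s a≤b eq = ℕₚ.+-cancelʳ-≤ a l r
  (≤-trans (ℕₚ.+-monoʳ-≤ l a≤b) (≤-trans (m≤m+n (l + b) s) (≤-reflexive eq)))

-- Counting in lists by sums of indicators

[_]? : {P : Set} → Dec P → ℕ
[ yes _ ]? = 1
[ no _ ]? = 0

[]?-mono : {P Q : Set} (p : Dec P) (q : Dec Q) → (P → Q) → [ p ]? ≤ [ q ]?
[]?-mono (yes p) (yes q) _ = ≤-refl
[]?-mono (yes p) (no ¬q) f = ⊥-elim (¬q (f p))
[]?-mono (no ¬p) _ _ = z≤n

[]?-yes : {P : Set} (p : Dec P) → P → [ p ]? ≡ 1
[]?-yes (yes _) _ = refl
[]?-yes (no ¬p) p = ⊥-elim (¬p p)

[]?-no : {P : Set} (p : Dec P) → ¬ P → [ p ]? ≡ 0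
[]?-no (yes p) ¬p = ⊥-elim (¬p p)
[]?-no (no _) _ = refl

variable
  A B C : Set

∑ : List A → (A → ℕ) → ℕ
∑ [] f = 0
∑ (x ∷ xs) f = f x + ∑ xs f

syntax ∑ xs (λ x → e) = ∑[ x ∈ xs ] e

# : {P : A → Set} → Decidable P → List A → ℕ
# P? xs = ∑[ x ∈ xs ] [ P? x ]?

∑-mono : (xs : List A) {f g : A → ℕ} → (∀ {x} → x ∈ xs → f x ≤ g x) → ∑ xs f ≤ ∑ xs g
∑-mono [] h = z≤n
∑-mono (x ∷ xs) h = +-mono-≤ (h (here refl)) (∑-mono xs (h ∘ there))

∑-cong : (xs : List A) {f g : A → ℕ} → (∀ {x} → x ∈ xs → f x ≡ g x) → ∑ xs f ≡ ∑ xs g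
∑-cong [] h = refl
∑-cong (x ∷ xs) h = cong₂ _+_ (h (here refl)) (∑-cong xs (h ∘ there))

∑-+ : (xs : List A) (f g : A → ℕ) → ∑[ x ∈ xs ] (f x + g x) ≡ ∑ xs f + ∑ xs g
∑-+ [] f g = refl
∑-+ (x ∷ xs) f g = trans (cong (f x + g x +_) (∑-+ xs f g)) (lemma (f x) (g x) (∑ xs f) (∑ xs g))
  where
  lemma : ∀ a b c d → a + b + (c + d) ≡ a + c + (b + d)
  lemma = solve-∀

∑-const : (xs : List A) (c : ℕ) → ∑[ x ∈ xs ] c ≡ length xs * c
∑-const [] c = refl
∑-const (x ∷ xs) c = cong (c +_) (∑-const xs c)

∑-*ˡ : (xs : List A) (c : ℕ) (f : A → ℕ) → ∑[ x ∈ xs ] (c * f x) ≡ c * ∑ xs f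
∑-*ˡ [] c f = sym (ℕₚ.*-zeroʳ c)
∑-*ˡ (x ∷ xs) c f = trans (cong (c * f x +_) (∑-*ˡ xs c f)) (sym (ℕₚ.*-distribˡ-+ c (f x) (∑ xs f)))

∑-swap : (xs : List A) (ys : List B) (f : A → B → ℕ) →
         ∑[ x ∈ xs ] ∑[ y ∈ ys ] f x y ≡ ∑[ y ∈ ys ] ∑[ x ∈ xs ] f x y
∑-swap [] ys f = sym (trans (∑-const ys 0) (ℕₚ.*-zeroʳ (length ys)))
∑-swap (x ∷ xs) ys f =
  trans (cong (∑ ys (f x) +_) (∑-swap xs ys f)) (sym (∑-+ ys (f x) (λ y → ∑ xs (λ x → f x y))))

module _ {P : A → Set} (P? : Decidable P) where

  length-filter≡# : (xs : List A) → length (filter P? xs) ≡ # P? xs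
  length-filter≡# [] = refl
  length-filter≡# (x ∷ xs) with P? x
  ... | yes _ = cong suc (length-filter≡# xs)
  ... | no _ = length-filter≡# xs

  length-filter-split : (xs : List A) → length xs ≡ length (filter P? xs) + length (filter (¬? ∘ P?) xs)
  length-filter-split [] = refl
  length-filter-split (x ∷ xs) with P? x
  ... | yes _ = cong suc (length-filter-split xs)
  ... | no _ = trans (cong suc (length-filter-split xs)) (sym (ℕₚ.+-suc _ _))

  #≤length : (xs : List A) → # P? xs ≤ length xs
  #≤length xs = ≤-trans (≤-reflexive (sym (length-filter≡# xs))) (Listₚ.length-filter P? xs)

  0<#⇒∃ : (xs : List A) → 0 < # P? xs → ∃ λ x → x ∈ xs × P x
  0<#⇒∃ (x ∷ xs) 0<# with P? x
  ... | yes p = x , here refl , p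
  ... | no _ = let y , y∈ , p = 0<#⇒∃ xs 0<# in y , there y∈ , p

  ∃⇒0<# : {xs : List A} {x : A} → x ∈ xs → P x → 0 < # P? xs
  ∃⇒0<# {x ∷ xs} (here refl) p = ≤-trans (≤-reflexive (sym ([]?-yes (P? x) p))) (m≤m+n _ _)
  ∃⇒0<# (there x∈) p = ≤-trans (∃⇒0<# x∈ p) (m≤n+m _ _)

#-mono : {P Q : A → Set} (P? : Decidable P) (Q? : Decidable Q) (xs : List A) →
         (∀ {x} → x ∈ xs → P x → Q x) → # P? xs ≤ # Q? xs
#-mono P? Q? xs h = ∑-mono xs λ {x} x∈ → []?-mono (P? x) (Q? x) (h x∈)

#-disjoint-≤ : {P Q R : A → Set} (P? : Decidable P) (Q? : Decidable Q) (R? : Decidable R) (xs : List A) →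
               (∀ {x} → x ∈ xs → P x → R x) → (∀ {x} → x ∈ xs → Q x → R x) →
               (∀ {x} → x ∈ xs → P x → Q x → ⊥) → # P? xs + # Q? xs ≤ # R? xs
#-disjoint-≤ P? Q? R? xs p q pq =
  ≤-trans (≤-reflexive (sym (∑-+ xs _ _))) (∑-mono xs λ {x} x∈ → pointwise x x∈ (P? x) (Q? x))
  where
  pointwise : ∀ x → x ∈ xs → (dp : Dec _) (dq : Dec _) → [ dp ]? + [ dq ]? ≤ [ R? x ]?
  pointwise x x∈ (yes a) (yes b) = ⊥-elim (pq x∈ a b)
  pointwise x x∈ (yes a) (no _) = ≤-reflexive (sym ([]?-yes (R? x) (p x∈ a)))
  pointwise x x∈ (no _) (yes b) = ≤-reflexive (sym ([]?-yes (R? x) (q x∈ b)))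
  pointwise x x∈ (no _) (no _) = z≤n

#-cover-≤ : {P Q R : A → Set} (P? : Decidable P) (Q? : Decidable Q) (R? : Decidable R) (xs : List A) →
            (∀ {x} → x ∈ xs → R x → P x ⊎ Q x) → # R? xs ≤ # P? xs + # Q? xs
#-cover-≤ P? Q? R? xs h =
  ≤-trans (∑-mono xs λ {x} x∈ → pointwise x x∈ (R? x) (P? x) (Q? x)) (≤-reflexive (∑-+ xs _ _))
  where
  pointwise : ∀ x → x ∈ xs → (dr : Dec _) (dp : Dec _) (dq : Dec _) → [ dr ]? ≤ [ dp ]? + [ dq ]?
  pointwise x x∈ (yes r) (yes _) dq = s≤s z≤n
  pointwise x x∈ (yes r) (no _) (yes _) = s≤s z≤n
  pointwise x x∈ (yes r) (no ¬p) (no ¬q) = ⊥-elim ([ ¬p , ¬q ]′ (h x∈ r))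
  pointwise x x∈ (no _) dp dq = z≤n

-- The partner of the first element is removed from `ys`; since `R` is injective, no later element
-- loses its partner. A relation in place of a function allows partners that are merely known to
-- exist.
unique-rel-length : {xs : List A} {ys : List B} (R : A → B → Set) → Unique xs →
                    (∀ {x x′ y} → x ∈ xs → x′ ∈ xs → R x y → R x′ y → x ≡ x′) →
                    (∀ {x} → x ∈ xs → ∃ λ y → y ∈ ys × R x y) → length xs ≤ length ys
unique-rel-length {xs = []} R _ _ _ = z≤n
unique-rel-length {xs = x ∷ xs} {ys} R (x∉ ∷ u) inj h
  with y , y∈ , Rxy ← h (here refl)
  with as , bs , refl ← ∈ₚ.∈-∃++ y∈ =
  ≤-trans (s≤s (unique-rel-length R u (λ a b → inj (there a) (there b)) h′))
    (≤-reflexive (trans (cong suc (Listₚ.length-++ as)) (trans (sym (ℕₚ.+-suc _ _)) (sym (Listₚ.length-++ as)))))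
  where
  h′ : ∀ {x′} → x′ ∈ xs → ∃ λ y′ → y′ ∈ as ++ bs × R x′ y′
  h′ x′∈ with y′ , y′∈ , Rx′y′ ← h (there x′∈) with ∈ₚ.∈-++⁻ as y′∈
  ... | inj₁ i = y′ , ∈ₚ.∈-++⁺ˡ i , Rx′y′
  ... | inj₂ (here refl) = ⊥-elim (All.lookup x∉ x′∈ (inj (here refl) (there x′∈) Rxy Rx′y′))
  ... | inj₂ (there i) = y′ , ∈ₚ.∈-++⁺ʳ as i , Rx′y′

unique-inj-length : {xs : List A} {ys : List B} (f : A → B) → Unique xs →
                    (∀ {x y} → x ∈ xs → y ∈ xs → f x ≡ f y → x ≡ y) →
                    (∀ {x} → x ∈ xs → f x ∈ ys) → length xs ≤ length ys
unique-inj-length f u inj sub = unique-rel-length (λ x y → f x ≡ y) u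
  (λ a b eq eq′ → inj a b (trans eq (sym eq′))) λ x∈ → f _ , sub x∈ , refl

unique-⊆-length : {xs ys : List A} → Unique xs → (∀ {x} → x ∈ xs → x ∈ ys) → length xs ≤ length ys
unique-⊆-length u = unique-inj-length id u (λ _ _ → id)

#-inj-length : {P : A → Set} (P? : Decidable P) {xs : List A} {ys : List B} (f : A → B) → Unique xs →
               (∀ {x y} → f x ≡ f y → x ≡ y) → (∀ {x} → x ∈ xs → P x → f x ∈ ys) → # P? xs ≤ length ys
#-inj-length P? {xs} f u inj sub =
  ≤-trans (≤-reflexive (sym (length-filter≡# P? xs)))
    (unique-inj-length f (Uniqueₚ.filter⁺ P? u) (λ _ _ → inj)
      (λ x∈ → let x∈xs , p = ∈ₚ.∈-filter⁻ P? x∈ in sub x∈xs p))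

maximal : (_≼_ : A → A → Set) → (∀ {x} → x ≼ x) → (∀ {x y z} → x ≼ y → y ≼ z → x ≼ z) →
          (∀ x y → x ≼ y ⊎ y ≼ x) → ∀ {x xs} → x ∈ xs → ∃ λ m → m ∈ xs × (∀ {y} → y ∈ xs → y ≼ m)
maximal {A} _≼_ rfl trs tot {xs = x ∷ xs} _ = go x xs
  where
  go : ∀ x xs → ∃ λ m → m ∈ x ∷ xs × (∀ {y} → y ∈ x ∷ xs → y ≼ m)
  go x [] = x , here refl , λ { (here refl) → rfl }
  go x (y ∷ ys) with go y ys
  ... | m , m∈ , max with tot x m
  ...   | inj₁ x≼m = m , there m∈ , λ { (here refl) → x≼m ; (there i) → max i }
  ...   | inj₂ m≼x = x , here refl , λ { (here refl) → rfl ; (there i) → trs (max i) m≼x }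

module QS = ℚSolver.+-*-Solver

variable
  m n : ℕ

-- Vectors over ℚ

infixl 6 _⊞_ _⊟_
infixl 7 _⊡_

_⊞_ _⊟_ : Vec ℚ n → Vec ℚ n → Vec ℚ n
_⊞_ = Vec.zipWith ℚ._+_
_⊟_ = Vec.zipWith ℚ._-_

_⊡_ : ℚ → Vec ℚ n → Vec ℚ n
q ⊡ u = Vec.map (q ℚ.*_) u

0ᵛ : Vec ℚ n
0ᵛ = Vec.replicate _ 0ℚ

_≟ᵛ_ : (u v : Vec ℚ n) → Dec (u ≡ v)
_≟ᵛ_ = Vecₚ.≡-dec ℚₚ._≟_

⊞-comm : (u v : Vec ℚ n) → u ⊞ v ≡ v ⊞ u
⊞-comm = Vecₚ.zipWith-comm ℚₚ.+-comm

⊞-identityʳ : (u : Vec ℚ n) → u ⊞ 0ᵛ ≡ u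
⊞-identityʳ = Vecₚ.zipWith-identityʳ ℚₚ.+-identityʳ

⊞-identityˡ : (u : Vec ℚ n) → 0ᵛ ⊞ u ≡ u
⊞-identityˡ = Vecₚ.zipWith-identityˡ ℚₚ.+-identityˡ

⊟-self : (u : Vec ℚ n) → u ⊟ u ≡ 0ᵛ
⊟-self [] = refl
⊟-self (a ∷ u) = cong₂ _∷_ (ℚₚ.+-inverseʳ a) (⊟-self u)

⊟-0 : (u : Vec ℚ n) → u ⊟ 0ᵛ ≡ u
⊟-0 [] = refl
⊟-0 (a ∷ u) = cong₂ _∷_ (ℚₚ.+-identityʳ a) (⊟-0 u)

⊟-⊞ : (u v : Vec ℚ n) → u ⊟ v ⊞ v ≡ u
⊟-⊞ [] [] = refl
⊟-⊞ (a ∷ u) (b ∷ v) = cong₂ _∷_ (solve 2 (λ a b → a :- b :+ b := a) refl a b) (⊟-⊞ u v) where open QS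

⊞-⊟ : (u v : Vec ℚ n) → u ⊞ v ⊟ u ≡ v
⊞-⊟ [] [] = refl
⊞-⊟ (a ∷ u) (b ∷ v) = cong₂ _∷_ (solve 2 (λ a b → a :+ b :- a := b) refl a b) (⊞-⊟ u v) where open QS

⊟-flip : (u v w : Vec ℚ n) → u ⊟ w ⊟ (v ⊟ w) ≡ u ⊟ v
⊟-flip [] [] [] = refl
⊟-flip (a ∷ u) (b ∷ v) (c ∷ w) =
  cong₂ _∷_ (solve 3 (λ a b c → (a :- c) :- (b :- c) := a :- b) refl a b c) (⊟-flip u v w) where open QS

⊟-trans : (u v w : Vec ℚ n) → (u ⊟ v) ⊞ (v ⊟ w) ≡ u ⊟ w
⊟-trans [] [] [] = refl
⊟-trans (a ∷ u) (b ∷ v) (c ∷ w) =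
  cong₂ _∷_ (solve 3 (λ a b c → (a :- b) :+ (b :- c) := a :- c) refl a b c) (⊟-trans u v w) where open QS

⊞-⊟-⊞ : (a b c d : Vec ℚ n) → (a ⊞ b) ⊟ (c ⊞ d) ≡ (a ⊟ c) ⊟ (d ⊟ b)
⊞-⊟-⊞ [] [] [] [] = refl
⊞-⊟-⊞ (a ∷ u) (b ∷ v) (c ∷ w) (d ∷ x) =
  cong₂ _∷_ (solve 4 (λ a b c d → (a :+ b) :- (c :+ d) := (a :- c) :- (d :- b)) refl a b c d) (⊞-⊟-⊞ u v w x)
  where open QS

⊟≡0⇒≡ : (u v : Vec ℚ n) → u ⊟ v ≡ 0ᵛ → u ≡ v
⊟≡0⇒≡ u v eq = trans (sym (⊟-⊞ u v)) (trans (cong (_⊞ v) eq) (⊞-identityˡ v))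

⊞-cancelˡ : (u : Vec ℚ n) {v w : Vec ℚ n} → u ⊞ v ≡ u ⊞ w → v ≡ w
⊞-cancelˡ u {v} {w} eq = trans (sym (⊞-⊟ u v)) (trans (cong (_⊟ u) eq) (⊞-⊟ u w))

⊞-cancelʳ : (u : Vec ℚ n) {v w : Vec ℚ n} → v ⊞ u ≡ w ⊞ u → v ≡ w
⊞-cancelʳ u {v} {w} eq = ⊞-cancelˡ u (trans (⊞-comm u v) (trans eq (⊞-comm w u)))

⊞≡⊞⇒⊟≡⊟ : {a b c d : Vec ℚ n} → a ⊞ b ≡ c ⊞ d → a ⊟ c ≡ d ⊟ b
⊞≡⊞⇒⊟≡⊟ {a = a} {b} {c} {d} eq =
  ⊟≡0⇒≡ _ _ (trans (sym (⊞-⊟-⊞ a b c d)) (trans (cong (_⊟ (c ⊞ d)) eq) (⊟-self (c ⊞ d))))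

⊟-as-⊞ : (u v : Vec ℚ n) → u ⊟ v ≡ u ⊞ (ℚ.- 1ℚ) ⊡ v
⊟-as-⊞ [] [] = refl
⊟-as-⊞ (a ∷ u) (b ∷ v) =
  cong₂ _∷_ (solve 2 (λ a b → a :- b := a :+ (:- con 1ℚ) :* b) refl a b) (⊟-as-⊞ u v) where open QS

⊡-distribˡ : (q : ℚ) (u v : Vec ℚ n) → q ⊡ (u ⊞ v) ≡ q ⊡ u ⊞ q ⊡ v
⊡-distribˡ q [] [] = refl
⊡-distribˡ q (a ∷ u) (b ∷ v) = cong₂ _∷_ (ℚₚ.*-distribˡ-+ q a b) (⊡-distribˡ q u v)

⊡-assoc : (p q : ℚ) (u : Vec ℚ n) → (p ℚ.* q) ⊡ u ≡ p ⊡ (q ⊡ u)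
⊡-assoc p q [] = refl
⊡-assoc p q (a ∷ u) = cong₂ _∷_ (ℚₚ.*-assoc p q a) (⊡-assoc p q u)

⊡-comm : (p q : ℚ) (u : Vec ℚ n) → p ⊡ (q ⊡ u) ≡ q ⊡ (p ⊡ u)
⊡-comm p q u = trans (sym (⊡-assoc p q u)) (trans (cong (_⊡ u) (ℚₚ.*-comm p q)) (⊡-assoc q p u))

⊡-0 : (u : Vec ℚ n) → 0ℚ ⊡ u ≡ 0ᵛ
⊡-0 [] = refl
⊡-0 (a ∷ u) = cong₂ _∷_ (ℚₚ.*-zeroˡ a) (⊡-0 u)

⊡-1 : (u : Vec ℚ n) → 1ℚ ⊡ u ≡ u
⊡-1 [] = refl
⊡-1 (a ∷ u) = cong₂ _∷_ (ℚₚ.*-identityˡ a) (⊡-1 u)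

⊡-zeroʳ : (q : ℚ) → q ⊡ 0ᵛ {n} ≡ 0ᵛ
⊡-zeroʳ {zero} q = refl
⊡-zeroʳ {suc n} q = cong₂ _∷_ (ℚₚ.*-zeroʳ q) (⊡-zeroʳ {n} q)

-- The lexicographic order

Pos : Vec ℚ n → Set
Pos [] = ⊥
Pos (q ∷ u) = 0ℚ ℚ.< q ⊎ (q ≡ 0ℚ × Pos u)

Pos? : (u : Vec ℚ n) → Dec (Pos u)
Pos? [] = no λ ()
Pos? (q ∷ u) = (0ℚ ℚₚ.<? q) ⊎-dec ((q ℚₚ.≟ 0ℚ) ×-dec Pos? u)

-1ℚ : ℚ
-1ℚ = ℚ.- 1ℚ

Pos-irrefl : ¬ Pos (0ᵛ {n})
Pos-irrefl {suc n} (inj₁ 0<0) = ℚₚ.<-irrefl refl 0<0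
Pos-irrefl {suc n} (inj₂ (_ , p)) = Pos-irrefl {n} p

Pos-⊞ : {u v : Vec ℚ n} → Pos u → Pos v → Pos (u ⊞ v)
Pos-⊞ {u = a ∷ u} {b ∷ v} (inj₁ p) (inj₁ q) = inj₁ (ℚₚ.+-mono-< p q)
Pos-⊞ {u = a ∷ u} {b ∷ v} (inj₁ p) (inj₂ (refl , _)) = inj₁ (subst (0ℚ ℚ.<_) (sym (ℚₚ.+-identityʳ a)) p)
Pos-⊞ {u = a ∷ u} {b ∷ v} (inj₂ (refl , _)) (inj₁ q) = inj₁ (subst (0ℚ ℚ.<_) (sym (ℚₚ.+-identityˡ b)) q)
Pos-⊞ {u = a ∷ u} {b ∷ v} (inj₂ (refl , p)) (inj₂ (refl , q)) = inj₂ (refl , Pos-⊞ p q)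

Pos-tri : (u : Vec ℚ n) → u ≡ 0ᵛ ⊎ Pos u ⊎ Pos (-1ℚ ⊡ u)
Pos-tri [] = inj₁ refl
Pos-tri (q ∷ u) with ℚₚ.<-cmp 0ℚ q
... | Relation.Binary.tri< 0<q _ _ = inj₂ (inj₁ (inj₁ 0<q))
... | Relation.Binary.tri> _ _ q<0 = inj₂ (inj₂ (inj₁ (subst (0ℚ ℚ.<_)
        (solve 1 (λ a → :- a := (:- con 1ℚ) :* a) refl q) (ℚₚ.neg-antimono-< q<0)))) where open QS
... | Relation.Binary.tri≈ _ refl _ with Pos-tri u
...   | inj₁ eq = inj₁ (cong (0ℚ ∷_) eq)
...   | inj₂ (inj₁ p) = inj₂ (inj₁ (inj₂ (refl , p)))
...   | inj₂ (inj₂ p) = inj₂ (inj₂ (inj₂ (refl , p)))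

infix 4 _≺_ _≼_

_≺_ _≼_ : Vec ℚ n → Vec ℚ n → Set
u ≺ v = Pos (v ⊟ u)
u ≼ v = ¬ (v ≺ u)

neg-⊟ : (u v : Vec ℚ n) → -1ℚ ⊡ (u ⊟ v) ≡ v ⊟ u
neg-⊟ [] [] = refl
neg-⊟ (a ∷ u) (b ∷ v) =
  cong₂ _∷_ (solve 2 (λ a b → (:- con 1ℚ) :* (a :- b) := b :- a) refl a b) (neg-⊟ u v) where open QS

≺-irrefl : {u : Vec ℚ n} → ¬ u ≺ u
≺-irrefl {u = u} p = Pos-irrefl (subst Pos (⊟-self u) p)

≺-trans : {u v w : Vec ℚ n} → u ≺ v → v ≺ w → u ≺ w
≺-trans {u = u} {v} {w} p q = subst Pos (⊟-trans w v u) (Pos-⊞ q p)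

≺-tri : (u v : Vec ℚ n) → u ≡ v ⊎ u ≺ v ⊎ v ≺ u
≺-tri u v with Pos-tri (v ⊟ u)
... | inj₁ eq = inj₁ (sym (⊟≡0⇒≡ v u eq))
... | inj₂ (inj₁ p) = inj₂ (inj₁ p)
... | inj₂ (inj₂ p) = inj₂ (inj₂ (subst Pos (neg-⊟ v u) p))

≼-refl : {u : Vec ℚ n} → u ≼ u
≼-refl = ≺-irrefl

≼-trans : {u v w : Vec ℚ n} → u ≼ v → v ≼ w → u ≼ w
≼-trans {u = u} {v} {w} p q w≺u with ≺-tri u v
... | inj₁ refl = q w≺u
... | inj₂ (inj₁ u≺v) = q (≺-trans w≺u u≺v)
... | inj₂ (inj₂ v≺u) = p v≺u

≼-total : (u v : Vec ℚ n) → u ≼ v ⊎ v ≼ u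
≼-total u v with ≺-tri u v
... | inj₁ refl = inj₁ ≺-irrefl
... | inj₂ (inj₁ u≺v) = inj₁ (≺-irrefl ∘ ≺-trans u≺v)
... | inj₂ (inj₂ v≺u) = inj₂ (≺-irrefl ∘ ≺-trans v≺u)

-- Linear maps and spans

record Lin (m n : ℕ) : Set where
  field
    fun : Vec ℚ m → Vec ℚ n
    fun-⊞ : ∀ u v → fun (u ⊞ v) ≡ fun u ⊞ fun v
    fun-⊡ : ∀ q u → fun (q ⊡ u) ≡ q ⊡ fun u

  fun-⊟ : ∀ u v → fun (u ⊟ v) ≡ fun u ⊟ fun v
  fun-⊟ u v = trans (cong fun (⊟-as-⊞ u v)) (trans (fun-⊞ u _)
    (trans (cong (fun u ⊞_) (fun-⊡ -1ℚ v)) (sym (⊟-as-⊞ (fun u) (fun v)))))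

  fun-0 : fun 0ᵛ ≡ 0ᵛ
  fun-0 = trans (cong fun (sym (⊡-0 0ᵛ))) (trans (fun-⊡ 0ℚ 0ᵛ) (⊡-0 _))

-- The coefficients are split off one at a time, so that each closure property is an induction over
-- the list. `InSpan-coefficients` recovers the usual linear combination.
InSpan : List (Vec ℚ n) → Vec ℚ n → Set
InSpan [] x = x ≡ 0ᵛ
InSpan (t ∷ ts) x = ∃ λ q → InSpan ts (x ⊟ q ⊡ t)

InSpan-0 : (ts : List (Vec ℚ n)) → InSpan ts 0ᵛ
InSpan-0 [] = refl
InSpan-0 (t ∷ ts) = 0ℚ , subst (InSpan ts) (sym (trans (cong (0ᵛ ⊟_) (⊡-0 t)) (⊟-self 0ᵛ))) (InSpan-0 ts)

InSpan-⊞ : (ts : List (Vec ℚ n)) {x y : Vec ℚ n} → InSpan ts x → InSpan ts y → InSpan ts (x ⊞ y)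
InSpan-⊞ [] refl refl = ⊞-identityˡ 0ᵛ
InSpan-⊞ (t ∷ ts) {x} {y} (p , px) (q , qy) =
  p ℚ.+ q , subst (InSpan ts) (lemma p q x y t) (InSpan-⊞ ts px qy)
  where
  lemma : ∀ {n} p q (x y t : Vec ℚ n) → (x ⊟ p ⊡ t) ⊞ (y ⊟ q ⊡ t) ≡ (x ⊞ y) ⊟ (p ℚ.+ q) ⊡ t
  lemma p q [] [] [] = refl
  lemma p q (a ∷ x) (b ∷ y) (c ∷ t) = cong₂ _∷_
    (solve 5 (λ a b c p q → (a :- p :* c) :+ (b :- q :* c) := (a :+ b) :- (p :+ q) :* c) refl a b c p q)
    (lemma p q x y t) where open QS

InSpan-⊡ : (ts : List (Vec ℚ n)) (s : ℚ) {x : Vec ℚ n} → InSpan ts x → InSpan ts (s ⊡ x)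
InSpan-⊡ [] s refl = ⊡-zeroʳ s
InSpan-⊡ (t ∷ ts) s {x} (p , px) = s ℚ.* p , subst (InSpan ts) (lemma s p x t) (InSpan-⊡ ts s px)
  where
  lemma : ∀ {n} s p (x t : Vec ℚ n) → s ⊡ (x ⊟ p ⊡ t) ≡ s ⊡ x ⊟ (s ℚ.* p) ⊡ t
  lemma s p [] [] = refl
  lemma s p (a ∷ x) (c ∷ t) = cong₂ _∷_
    (solve 4 (λ a c s p → s :* (a :- p :* c) := s :* a :- (s :* p) :* c) refl a c s p) (lemma s p x t) where open QS

InSpan-⊟ : (ts : List (Vec ℚ n)) {x y : Vec ℚ n} → InSpan ts x → InSpan ts y → InSpan ts (x ⊟ y)
InSpan-⊟ ts {x} {y} px py =
  subst (InSpan ts) (sym (⊟-as-⊞ x y)) (InSpan-⊞ ts px (InSpan-⊡ ts -1ℚ py))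

InSpan-weaken : (t : Vec ℚ n) {ts : List (Vec ℚ n)} {x : Vec ℚ n} → InSpan ts x → InSpan (t ∷ ts) x
InSpan-weaken t {ts} {x} px =
  0ℚ , subst (InSpan ts) (sym (trans (cong (x ⊟_) (⊡-0 t)) (⊟-0 x))) px

InSpan-head : (t : Vec ℚ n) (ts : List (Vec ℚ n)) → InSpan (t ∷ ts) t
InSpan-head t ts =
  1ℚ , subst (InSpan ts) (sym (trans (cong (t ⊟_) (⊡-1 t)) (⊟-self t))) (InSpan-0 ts)

InSpan-∈ : {t : Vec ℚ n} {ts : List (Vec ℚ n)} → t ∈ ts → InSpan ts t
InSpan-∈ {t = t} {_ ∷ ts} (here refl) = InSpan-head t ts
InSpan-∈ {ts = s ∷ ts} (there i) = InSpan-weaken s (InSpan-∈ i)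

InSpan-++ : (ts hs : List (Vec ℚ n)) {x y : Vec ℚ n} → InSpan ts x → InSpan hs y → InSpan (ts ++ hs) (x ⊞ y)
InSpan-++ [] hs {y = y} refl py = subst (InSpan hs) (sym (⊞-identityˡ y)) py
InSpan-++ (t ∷ ts) hs {x} {y} (q , px) py =
  q , subst (InSpan (ts ++ hs)) (lemma q x y t) (InSpan-++ ts hs px py)
  where
  lemma : ∀ {n} q (x y t : Vec ℚ n) → (x ⊟ q ⊡ t) ⊞ y ≡ x ⊞ y ⊟ q ⊡ t
  lemma q [] [] [] = refl
  lemma q (a ∷ x) (b ∷ y) (c ∷ t) = cong₂ _∷_
    (solve 4 (λ a b c q → (a :- q :* c) :+ b := a :+ b :- q :* c) refl a b c q) (lemma q x y t) where open QS

-- This stands for the quotient map by the span of `hs`, realised inside the same space so that all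
-- quotients share one type. `residue` says that a vector and its image agree modulo the span.
record Projection (hs : List (Vec ℚ n)) : Set where
  field
    lin : Lin n n
  open Lin lin public
  field
    residue : ∀ x → InSpan hs (x ⊟ fun x)

  kernel⊆span : ∀ {x} → fun x ≡ 0ᵛ → InSpan hs x
  kernel⊆span {x} eq = subst (InSpan hs) (trans (cong (x ⊟_) eq) (⊟-0 x)) (residue x)

identity : Projection {n} []
identity = record
  { lin = record { fun = id ; fun-⊞ = λ _ _ → refl ; fun-⊡ = λ _ _ → refl }
  ; residue = ⊟-self }

pivot : (u : Vec ℚ n) → u ≢ 0ᵛ → ∃ λ c → Vec.lookup u c ≢ 0ℚ
pivot [] u≢0 = ⊥-elim (u≢0 refl)
pivot (q ∷ u) u≢0 with q ℚₚ.≟ 0ℚ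
... | no q≢0 = Fin.zero , q≢0
... | yes refl = let c , h = pivot u (u≢0 ∘ cong (0ℚ ∷_)) in Fin.suc c , h

module _ {hs : List (Vec ℚ n)} (π : Projection hs) where
  open Projection π

  record Extension (v : Vec ℚ n) : Set where
    field
      π⁺ : Projection (v ∷ hs)
      coefficient : Vec ℚ n → ℚ
      fun⁺ : ∀ x → Projection.fun π⁺ x ≡ fun x ⊟ coefficient x ⊡ fun v
      kills : Projection.fun π⁺ v ≡ 0ᵛ
      kernel⊆kernel⁺ : ∀ {x} → fun x ≡ 0ᵛ → Projection.fun π⁺ x ≡ 0ᵛ

  -- One step of Gaussian elimination: a multiple of `fun v` is subtracted so as to clear a pivot
  -- coordinate of `fun v`. The multiple depends only on `fun x`, hence the old kernel stays inside
  -- the new one.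
  extend : (v : Vec ℚ n) → fun v ≢ 0ᵛ → Extension v
  extend v fv≢0 = record
    { π⁺ = record
        { lin = record { fun = f ; fun-⊞ = f-⊞ ; fun-⊡ = f-⊡ }
        ; residue = λ x → coeff x , subst (InSpan hs) (residue⁺ (coeff x) x (fun x) v (fun v))
                     (InSpan-⊟ hs (residue x) (InSpan-⊡ hs (coeff x) (residue v))) }
    ; coefficient = coeff
    ; fun⁺ = λ _ → refl
    ; kills = trans (cong (λ q → fun v ⊟ q ⊡ fun v) coeff-v) (trans (cong (fun v ⊟_) (⊡-1 (fun v))) (⊟-self (fun v)))
    ; kernel⊆kernel⁺ = λ {x} eq → trans (cong₂ (λ u q → u ⊟ q ⊡ fun v) eq (coeff-0 x eq))
        (trans (cong (0ᵛ ⊟_) (⊡-0 (fun v))) (⊟-self 0ᵛ)) }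
    where
    c : Fin n
    c = proj₁ (pivot (fun v) fv≢0)
    instance
      nonZero : ℚ.NonZero (Vec.lookup (fun v) c)
      nonZero = ℚ.≢-nonZero (proj₂ (pivot (fun v) fv≢0))
    inv : ℚ
    inv = ℚ.1/ Vec.lookup (fun v) c
    coeff : Vec ℚ n → ℚ
    coeff x = Vec.lookup (fun x) c ℚ.* inv
    f : Vec ℚ n → Vec ℚ n
    f x = fun x ⊟ coeff x ⊡ fun v
    coeff-v : coeff v ≡ 1ℚ
    coeff-v = ℚₚ.*-inverseʳ (Vec.lookup (fun v) c)
    coeff-0 : ∀ x → fun x ≡ 0ᵛ → coeff x ≡ 0ℚ
    coeff-0 x eq = trans (cong (λ u → Vec.lookup u c ℚ.* inv) eq)
      (trans (cong (ℚ._* inv) (Vecₚ.lookup-replicate c 0ℚ)) (ℚₚ.*-zeroˡ inv))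
    coeff-⊞ : ∀ x y → coeff (x ⊞ y) ≡ coeff x ℚ.+ coeff y
    coeff-⊞ x y = trans (cong (λ u → Vec.lookup u c ℚ.* inv) (fun-⊞ x y))
      (trans (cong (ℚ._* inv) (Vecₚ.lookup-zipWith ℚ._+_ c (fun x) (fun y))) (ℚₚ.*-distribʳ-+ inv (Vec.lookup (fun x) c) (Vec.lookup (fun y) c)))
    coeff-⊡ : ∀ q x → coeff (q ⊡ x) ≡ q ℚ.* coeff x
    coeff-⊡ q x = trans (cong (λ u → Vec.lookup u c ℚ.* inv) (fun-⊡ q x))
      (trans (cong (ℚ._* inv) (Vecₚ.lookup-map c (q ℚ.*_) (fun x))) (ℚₚ.*-assoc q _ inv))
    lemma-⊞ : ∀ {n} p q (x y t : Vec ℚ n) → (x ⊞ y) ⊟ (p ℚ.+ q) ⊡ t ≡ (x ⊟ p ⊡ t) ⊞ (y ⊟ q ⊡ t)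
    lemma-⊞ p q [] [] [] = refl
    lemma-⊞ p q (a ∷ x) (b ∷ y) (c ∷ t) = cong₂ _∷_
      (solve 5 (λ a b c p q → (a :+ b) :- (p :+ q) :* c := (a :- p :* c) :+ (b :- q :* c)) refl a b c p q)
      (lemma-⊞ p q x y t) where open QS
    lemma-⊡ : ∀ {n} s p (x t : Vec ℚ n) → s ⊡ x ⊟ (s ℚ.* p) ⊡ t ≡ s ⊡ (x ⊟ p ⊡ t)
    lemma-⊡ s p [] [] = refl
    lemma-⊡ s p (a ∷ x) (c ∷ t) = cong₂ _∷_
      (solve 4 (λ a c s p → s :* a :- (s :* p) :* c := s :* (a :- p :* c)) refl a c s p) (lemma-⊡ s p x t) where open QS
    f-⊞ : ∀ x y → f (x ⊞ y) ≡ f x ⊞ f y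
    f-⊞ x y = trans (cong₂ (λ u q → u ⊟ q ⊡ fun v) (fun-⊞ x y) (coeff-⊞ x y)) (lemma-⊞ (coeff x) (coeff y) (fun x) (fun y) (fun v))
    f-⊡ : ∀ q x → f (q ⊡ x) ≡ q ⊡ f x
    f-⊡ q x = trans (cong₂ (λ u p → u ⊟ p ⊡ fun v) (fun-⊡ q x) (coeff-⊡ q x)) (lemma-⊡ q (coeff x) (fun x) (fun v))
    residue⁺ : ∀ {n} q (x fx v fv : Vec ℚ n) → (x ⊟ fx) ⊟ q ⊡ (v ⊟ fv) ≡ (x ⊟ (fx ⊟ q ⊡ fv)) ⊟ q ⊡ v
    residue⁺ q [] [] [] [] = refl
    residue⁺ q (a ∷ x) (b ∷ fx) (c ∷ v) (d ∷ fv) = cong₂ _∷_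
      (solve 5 (λ a b c d q → (a :- b) :- q :* (c :- d) := (a :- (b :- q :* d)) :- q :* c) refl a b c d q)
      (residue⁺ q x fx v fv) where open QS

eliminate : (ts : List (Vec ℚ n)) → Σ (Projection ts) λ π → ∀ {t} → t ∈ ts → Projection.fun π t ≡ 0ᵛ
eliminate [] = identity , λ ()
eliminate (t ∷ ts) with eliminate ts
... | π , kill with Projection.fun π t ≟ᵛ 0ᵛ
...   | yes eq = record { lin = Projection.lin π ; residue = λ x → InSpan-weaken t (Projection.residue π x) }
               , λ { (here refl) → eq ; (there i) → kill i }
...   | no neq = Extension.π⁺ E , λ { (here refl) → Extension.kills E ; (there i) → Extension.kernel⊆kernel⁺ E (kill i) }
  where E = extend π t neq

-- Lower bounds on the rank are refutations of small spanning lists. This is the form in which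
-- `FullRank` is given, and no basis has to be chosen.
AffineRank≥ : ℕ → List (Vec ℚ n) → Set
AffineRank≥ e Y = ∀ o ts → length ts < e → ¬ (∀ {y} → y ∈ Y → InSpan ts (y ⊟ o))

LinearRank≥ : ℕ → List (Vec ℚ n) → Set
LinearRank≥ e Y = ∀ ts → length ts < e → ¬ (∀ {y} → y ∈ Y → InSpan ts y)

-- A Freiman–Ruzsa inequality

InSpan-trans : (ts ss : List (Vec ℚ n)) {x : Vec ℚ n} → (∀ {t} → t ∈ ts → InSpan ss t) → InSpan ts x → InSpan ss x
InSpan-trans [] ss h refl = InSpan-0 ss
InSpan-trans (t ∷ ts) ss {x} h (q , px) =
  subst (InSpan ss) (⊟-⊞ x (q ⊡ t)) (InSpan-⊞ ss (InSpan-trans ts ss (h ∘ there) px) (InSpan-⊡ ss q (h (here refl))))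

sums : List (Vec ℚ n) → List (Vec ℚ n) → List (Vec ℚ n)
sums = List.cartesianProductWith _⊞_

_∈ᵛ?_ : (u : Vec ℚ n) (us : List (Vec ℚ n)) → Dec (u ∈ us)
_∈ᵛ?_ = DecMembership._∈?_ _≟ᵛ_

Descending : List (Vec ℚ n) → Set
Descending = AllPairs (λ u v → v ≺ u)

Descending⇒Unique : {Y : List (Vec ℚ n)} → Descending Y → Unique Y
Descending⇒Unique = AllPairs.map λ { p refl → ≺-irrefl p }

⊞-≺-swap : {b y b′ u : Vec ℚ n} → b ⊞ y ≡ b′ ⊞ u → u ≺ y → b ≺ b′
⊞-≺-swap eq u≺y = subst Pos (sym (⊞≡⊞⇒⊟≡⊟ (sym eq))) u≺y

⊟-⊞-⊟ : (a b c : Vec ℚ n) → (a ⊟ c) ⊞ (b ⊟ c) ≡ a ⊞ b ⊟ c ⊟ c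
⊟-⊞-⊟ [] [] [] = refl
⊟-⊞-⊟ (a ∷ u) (b ∷ v) (c ∷ w) = cong₂ _∷_
  (solve 3 (λ a b c → (a :- c) :+ (b :- c) := a :+ b :- c :- c) refl a b c) (⊟-⊞-⊟ u v w) where open QS

⊟-split : {y u u₁ u₂ : Vec ℚ n} → y ⊞ u ≡ u₁ ⊞ u₂ → (u₁ ⊟ y) ⊞ (u₂ ⊟ y) ≡ u ⊟ y
⊟-split {y = y} {u} {u₁} {u₂} eq =
  trans (⊟-⊞-⊟ u₁ u₂ y) (trans (cong (λ z → z ⊟ y ⊟ y) (sym eq)) (cong (_⊟ y) (⊞-⊟ y u)))

-- Modulo y, an element u whose sum with y is old is the sum of two larger elements of Y. Descending
-- through Y, everything lies in the span of the elements whose sum with y is new.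
new-sums : (y : Vec ℚ n) (Y : List (Vec ℚ n)) → Descending (y ∷ Y) → (e : ℕ) → AffineRank≥ e (y ∷ Y) →
           {Old : Vec ℚ n → Set} (Old? : Decidable Old) →
           (∀ {z} → Old z → ∃ λ u₁ → ∃ λ u₂ → u₁ ∈ Y × u₂ ∈ Y × z ≡ u₁ ⊞ u₂) →
           e ≤ # (λ u → ¬? (Old? (y ⊞ u))) Y
new-sums {n} y Y (y> ∷ desc) e rank {Old} Old? old-sum with e ≤? # (λ u → ¬? (Old? (y ⊞ u))) Y
... | yes p = p
... | no p = ⊥-elim (rank y ts
        (≤-<-trans (≤-reflexive (trans (Listₚ.length-map (_⊟ y) (filter new? Y)) (length-filter≡# new? Y))) (≰⇒> p))
        λ { (here refl) → subst (InSpan ts) (sym (⊟-self y)) (InSpan-0 ts)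
          ; (there u∈) → go Y desc id inj₁ u∈ })
  where
  new? = λ u → ¬? (Old? (y ⊞ u))
  ts = map (_⊟ y) (filter new? Y)
  -- `L` is the part of `Y` still to be treated. As `Y` descends, every element above the head of
  -- `L` is already known to lie in the span.
  go : ∀ L → Descending L → (∀ {u} → u ∈ L → u ∈ Y) → (∀ {u} → u ∈ Y → u ∈ L ⊎ InSpan ts (u ⊟ y)) →
       ∀ {u} → u ∈ Y → InSpan ts (u ⊟ y)
  go [] _ _ h u∈ = [ (λ ()) , id ]′ (h u∈)
  go (v ∷ L) (v> ∷ descL) sub h = go L descL (sub ∘ there) h′
    where
    larger : ∀ {u} → u ∈ Y → v ≺ u → InSpan ts (u ⊟ y)
    larger u∈ v≺u with h u∈
    ... | inj₁ (here refl) = ⊥-elim (≺-irrefl v≺u)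
    ... | inj₁ (there i) = ⊥-elim (≺-irrefl (≺-trans v≺u (All.lookup v> i)))
    ... | inj₂ s = s
    v-spanned : InSpan ts (v ⊟ y)
    v-spanned with Old? (y ⊞ v)
    ... | no new = InSpan-∈ (∈ₚ.∈-map⁺ (_⊟ y) (∈ₚ.∈-filter⁺ new? (sub (here refl)) new))
    ... | yes old with u₁ , u₂ , u₁∈ , u₂∈ , eq ← old-sum old = subst (InSpan ts) (⊟-split eq)
          (InSpan-⊞ ts (larger u₁∈ (⊞-≺-swap (trans (⊞-comm v y) eq) (All.lookup y> u₂∈)))
                       (larger u₂∈ (⊞-≺-swap (trans (⊞-comm v y) (trans eq (⊞-comm u₁ u₂))) (All.lookup y> u₁∈))))
    h′ : ∀ {u} → u ∈ Y → u ∈ L ⊎ InSpan ts (u ⊟ y)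
    h′ u∈ with h u∈
    ... | inj₁ (here refl) = inj₂ v-spanned
    ... | inj₁ (there i) = inj₁ i
    ... | inj₂ s = inj₂ s

-- Induction by removing the largest element `y`, as in the proof of Freiman's lemma. `S₁` holds the
-- sums obtained without `y`, and `S₂` has to pay for `y`. How much is due depends on whether `y`
-- satisfies `P` and whether it raises the affine rank.
freiman-ruzsa : (Y : List (Vec ℚ n)) → Descending Y → (e : ℕ) → AffineRank≥ e Y →
                {P : Vec ℚ n → Set} (P? : Decidable P) → 0 < # P? Y →
                (S : List (Vec ℚ n)) → (∀ {b y} → b ∈ Y → P b → y ∈ Y → b ⊞ y ∈ S) →
                e * # P? Y + 2 * length Y ≤ 2 * length S + e
freiman-ruzsa Y desc zero rank P? 0<#P S cover with b , b∈ , p ← 0<#⇒∃ P? Y 0<#P =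
  ≤-trans (*-monoʳ-≤ 2 (unique-inj-length (b ⊞_) (Descending⇒Unique desc) (λ _ _ → ⊞-cancelˡ b) (cover b∈ p)))
    (m≤m+n _ 0)
freiman-ruzsa (y ∷ []) desc (suc e) rank P? 0<#P S cover =
  ⊥-elim (rank y [] (s≤s z≤n) λ { (here refl) → ⊟-self y })
freiman-ruzsa {n} (y ∷ Y@(o ∷ _)) desc@(y> ∷ desc′) (suc e) rank {P} P? 0<#P S cover =
  ≤-trans (cases (P? y) (Projection.fun π (y ⊟ o) ≟ᵛ 0ᵛ) refl)
    (≤-reflexive (cong (λ s → 2 * s + suc e) (sym (length-filter-split old? S))))
  where
  N = length Y
  π = proj₁ (eliminate (map (_⊟ o) Y))
  olds = sums (filter P? Y) Y
  old? = λ z → z ∈ᵛ? olds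
  S₁ = filter old? S
  S₂ = filter (¬? ∘ old?) S
  s₁ = length S₁
  s₂ = length S₂

  old-sum : ∀ {z} → z ∈ olds → ∃ λ u₁ → ∃ λ u₂ → u₁ ∈ Y × u₂ ∈ Y × z ≡ u₁ ⊞ u₂
  old-sum z∈ with u₁ , u₂ , u₁∈ , u₂∈ , eq ← ∈ₚ.∈-cartesianProductWith⁻ _⊞_ (filter P? Y) Y z∈ =
    u₁ , u₂ , proj₁ (∈ₚ.∈-filter⁻ P? {xs = Y} u₁∈) , u₂∈ , eq

  cover₁ : ∀ {b u} → b ∈ Y → P b → u ∈ Y → b ⊞ u ∈ S₁
  cover₁ b∈ p u∈ = ∈ₚ.∈-filter⁺ old? (cover (there b∈) p (there u∈))
    (∈ₚ.∈-cartesianProductWith⁺ _⊞_ (∈ₚ.∈-filter⁺ P? b∈ p) u∈)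

  cover₂ : ∀ {b u} → b ∈ y ∷ Y → P b → u ∈ y ∷ Y → ¬ (b ⊞ u ∈ olds) → b ⊞ u ∈ S₂
  cover₂ b∈ p u∈ new = ∈ₚ.∈-filter⁺ (¬? ∘ old?) (cover b∈ p u∈) new

  new? = λ u → ¬? (old? (y ⊞ u))

  e<#new : suc e ≤ # new? Y
  e<#new = new-sums y Y desc (suc e) rank old? old-sum

  y+y-new : ¬ (y ⊞ y ∈ olds)
  y+y-new i with u₁ , u₂ , u₁∈ , u₂∈ , eq ← old-sum i =
    ≺-irrefl (≺-trans (⊞-≺-swap eq (All.lookup y> u₂∈)) (All.lookup y> u₁∈))

  -- If `y` alone satisfies `P`, the induction hypothesis has no nonempty set to act on, but the
  -- sums of `y` with all elements suffice.
  single : P y → # P? Y ≡ 0 → suc e * (1 + # P? Y) + 2 * suc N ≤ 2 * (s₁ + s₂) + suc e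
  single py eq rewrite eq = lin≤ _ _ 0
    (*-monoʳ-≤ 2 (≤-trans (unique-inj-length (y ⊞_) (Descending⇒Unique desc) (λ _ _ → ⊞-cancelˡ y) (cover (here refl) py))
      (≤-reflexive (length-filter-split old? S))))
    (identity′ e N (s₁ + s₂))
    where
    identity′ : ∀ e N s → suc e * 1 + 2 * suc N + 2 * s + 0 ≡ 2 * s + suc e + 2 * suc N
    identity′ = solve-∀

  cases : (d : Dec (P y)) → Dec (Projection.fun π (y ⊟ o) ≡ 0ᵛ) → P? y ≡ d →
          suc e * ([ d ]? + # P? Y) + 2 * suc N ≤ 2 * (s₁ + s₂) + suc e
  -- Here `y` lies in the affine span of `Y`, so the induction hypothesis holds with the same rank.
  cases dy (yes flat) eqd = rank-kept dy eqd
    where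
    y-o-spanned : InSpan (map (_⊟ o) Y) (y ⊟ o)
    y-o-spanned = Projection.kernel⊆span π flat

    rank′ : AffineRank≥ (suc e) Y
    rank′ o′ ts short h = rank o′ ts short λ
      { (there i) → h i
      ; (here refl) → subst (InSpan ts) (⊟-trans y o o′) (InSpan-⊞ ts (InSpan-trans _ ts spanned y-o-spanned) (h (here refl))) }
      where
      spanned : ∀ {t} → t ∈ map (_⊟ o) Y → InSpan ts t
      spanned t∈ with u , u∈ , refl ← ∈ₚ.∈-map⁻ (_⊟ o) t∈ =
        subst (InSpan ts) (⊟-flip u o o′) (InSpan-⊟ ts (h u∈) (h (here refl)))

    rank-kept : (d : Dec (P y)) → P? y ≡ d → suc e * ([ d ]? + # P? Y) + 2 * suc N ≤ 2 * (s₁ + s₂) + suc e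
    rank-kept (yes py) _ with 0 ℕₚ.<? # P? Y
    ... | no 0≮ = single py (ℕₚ.n≤0⇒n≡0 (≮⇒≥ 0≮))
    ... | yes 0< = lin≤ _ _ (suc e)
            (+-mono-≤ (freiman-ruzsa Y desc′ (suc e) rank′ P? 0< S₁ cover₁) (*-monoʳ-≤ 2 e+1<s₂))
            (identity′ e (# P? Y) N s₁ s₂)
      where
      e+1<s₂ : suc (suc e) ≤ s₂
      e+1<s₂ = ≤-trans (+-mono-≤ (≤-reflexive (sym ([]?-yes (new? y) y+y-new))) e<#new)
        (#-inj-length new? (y ⊞_) (Descending⇒Unique desc) (⊞-cancelˡ y) (λ u∈ new → cover₂ (here refl) py u∈ new))
      identity′ : ∀ e c N s₁ s₂ → suc e * (1 + c) + 2 * suc N + (2 * s₁ + suc e + 2 * s₂) + suc e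
                  ≡ 2 * (s₁ + s₂) + suc e + (suc e * c + 2 * N + 2 * suc (suc e))
      identity′ = solve-∀
    rank-kept (no ¬py) eqd = lin≤ _ _ 0
        (+-mono-≤ (freiman-ruzsa Y desc′ (suc e) rank′ P? 0< S₁ cover₁) (*-monoʳ-≤ 2 0<s₂))
        (identity′ e (# P? Y) N s₁ s₂)
      where
      0< : 0 < # P? Y
      0< = subst (λ d → 0 < [ d ]? + # P? Y) eqd 0<#P
      -- With `b` the largest element of `Y` satisfying `P`, the sum `b ⊞ y` is new: an equal old
      -- sum has a second summand below `y`, hence a first one above `b`.
      0<s₂ : 1 ≤ s₂
      0<s₂ with b₀ , b₀∈ , pb₀ ← 0<#⇒∃ P? Y 0<
           with b , b∈ , max ← maximal _≼_ ≼-refl ≼-trans ≼-total (∈ₚ.∈-filter⁺ P? b₀∈ pb₀)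
           with b∈Y , pb ← ∈ₚ.∈-filter⁻ P? {xs = Y} b∈ =
        ∈ₚ.∈-length (cover₂ (there b∈Y) pb (here refl) λ i → new (∈ₚ.∈-cartesianProductWith⁻ _⊞_ (filter P? Y) Y i))
        where
        new : ¬ (∃ λ b′ → ∃ λ u → b′ ∈ filter P? Y × u ∈ Y × b ⊞ y ≡ b′ ⊞ u)
        new (b′ , u , b′∈ , u∈ , eq) = max b′∈ (⊞-≺-swap eq (All.lookup y> u∈))
      identity′ : ∀ e c N s₁ s₂ → suc e * c + 2 * suc N + (2 * s₁ + suc e + 2 * s₂) + 0
                  ≡ 2 * (s₁ + s₂) + suc e + (suc e * c + 2 * N + 2 * 1)
      identity′ = solve-∀
  cases dy (no steep) eqd = rank-drops dy eqd
    where
    rank′ : AffineRank≥ e Y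
    rank′ o′ ts short h = rank o′ ((y ⊟ o′) ∷ ts) (s≤s short) λ
      { (here refl) → InSpan-head (y ⊟ o′) ts ; (there i) → InSpan-weaken (y ⊟ o′) (h i) }

    level : ∀ {u} → u ∈ Y → Projection.fun π u ≡ Projection.fun π o
    level {u} u∈ = ⊟≡0⇒≡ _ _ (trans (sym (Projection.fun-⊟ π u o))
      (proj₂ (eliminate (map (_⊟ o) Y)) (∈ₚ.∈-map⁺ (_⊟ o) u∈)))

    -- The projection is constant on `Y` and takes another value at `y`, so no sum involving `y` is
    -- a sum of two elements of `Y`.
    y+u-new : ∀ {u} → u ∈ y ∷ Y → ¬ (y ⊞ u ∈ olds)
    y+u-new (here refl) = y+y-new
    y+u-new {u} (there u∈) i with u₁ , u₂ , u₁∈ , u₂∈ , eq ← old-sum i =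
      steep (trans (Projection.fun-⊟ π y o) (trans (cong (_⊟ f o) fy≡fo) (⊟-self (f o))))
      where
      f = Projection.fun π
      fy≡fo : f y ≡ f o
      fy≡fo = ⊞-cancelʳ (f o) (begin
        f y ⊞ f o ≡⟨ cong (f y ⊞_) (sym (level u∈)) ⟩
        f y ⊞ f u ≡⟨ sym (Projection.fun-⊞ π y u) ⟩
        f (y ⊞ u) ≡⟨ cong f eq ⟩
        f (u₁ ⊞ u₂) ≡⟨ Projection.fun-⊞ π u₁ u₂ ⟩
        f u₁ ⊞ f u₂ ≡⟨ cong₂ _⊞_ (level u₁∈) (level u₂∈) ⟩
        f o ⊞ f o ∎)
        where open ≡-Reasoning

    rank-drops : (d : Dec (P y)) → P? y ≡ d → suc e * ([ d ]? + # P? Y) + 2 * suc N ≤ 2 * (s₁ + s₂) + suc e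
    rank-drops (yes py) _ with 0 ℕₚ.<? # P? Y
    ... | no 0≮ = single py (ℕₚ.n≤0⇒n≡0 (≮⇒≥ 0≮))
    -- Raising the rank by one costs the number of elements of `Y` with `P`, and `y` itself costs
    -- `suc e`. Both are at most `N`, and twice the `suc N` new sums cover them.
    ... | yes 0< = lin≤ _ _ 1
            (+-mono-≤ (freiman-ruzsa Y desc′ e rank′ P? 0< S₁ cover₁)
              (+-mono-≤ (*-monoʳ-≤ 2 N<s₂)
                (+-mono-≤ (#≤length P? Y) (≤-trans e<#new (#≤length new? Y)))))
            (identity′ e (# P? Y) N s₁ s₂)
      where
      N<s₂ : suc N ≤ s₂
      N<s₂ = unique-inj-length (y ⊞_) (Descending⇒Unique desc) (λ _ _ → ⊞-cancelˡ y)
        (λ u∈ → cover₂ (here refl) py u∈ (y+u-new u∈))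
      identity′ : ∀ e c N s₁ s₂ → suc e * (1 + c) + 2 * suc N + (2 * s₁ + e + (2 * s₂ + (N + N))) + 1
                  ≡ 2 * (s₁ + s₂) + suc e + (e * c + 2 * N + (2 * suc N + (c + suc e)))
      identity′ = solve-∀
    rank-drops (no ¬py) eqd = lin≤ _ _ 0
        (+-mono-≤ (freiman-ruzsa Y desc′ e rank′ P? 0< S₁ cover₁) (+-mono-≤ (*-monoʳ-≤ 2 #P≤s₂) 0<))
        (identity′ e (# P? Y) N s₁ s₂)
      where
      0< : 0 < # P? Y
      0< = subst (λ d → 0 < [ d ]? + # P? Y) eqd 0<#P
      #P≤s₂ : # P? Y ≤ s₂
      #P≤s₂ = #-inj-length P? (_⊞ y) (Descending⇒Unique desc′) (⊞-cancelʳ y)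
        (λ {b} b∈ pb → cover₂ (there b∈) pb (here refl)
          (λ i → y+u-new (there b∈) (subst (_∈ olds) (⊞-comm b y) i)))
      identity′ : ∀ e c N s₁ s₂ → suc e * c + 2 * suc N + (2 * s₁ + e + (2 * s₂ + c)) + 0
                  ≡ 2 * (s₁ + s₂) + suc e + (e * c + 2 * N + (2 * c + 1))
      identity′ = solve-∀

-- Lines through a subspace and the hyperplane of heavy lines

⊡≡0⇒ : (q : ℚ) {u : Vec ℚ n} → u ≢ 0ᵛ → q ⊡ u ≡ 0ᵛ → q ≡ 0ℚ
⊡≡0⇒ q {u} u≢0 qu≡0 with q ℚₚ.≟ 0ℚ
... | yes q≡0 = q≡0
... | no q≢0 = ⊥-elim (u≢0 (begin
    u ≡⟨ sym (⊡-1 u) ⟩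
    1ℚ ⊡ u ≡⟨ cong (_⊡ u) (sym (ℚₚ.*-inverseˡ q)) ⟩
    (ℚ.1/ q ℚ.* q) ⊡ u ≡⟨ ⊡-assoc (ℚ.1/ q) q u ⟩
    (ℚ.1/ q) ⊡ (q ⊡ u) ≡⟨ cong ((ℚ.1/ q) ⊡_) qu≡0 ⟩
    (ℚ.1/ q) ⊡ 0ᵛ ≡⟨ ⊡-zeroʳ (ℚ.1/ q) ⟩
    0ᵛ ∎))
  where
  open ≡-Reasoning
  instance
    nonZero : ℚ.NonZero q
    nonZero = ℚ.≢-nonZero q≢0

module _ {l : ℕ} (f : Lin m l) where
  open Lin f

  fun-multiple : ∀ q {x u} → fun x ≡ q ⊡ fun u → fun (x ⊟ q ⊡ u) ≡ 0ᵛ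
  fun-multiple q {x} {u} eq =
    trans (fun-⊟ x (q ⊡ u)) (trans (cong₂ _⊟_ eq (fun-⊡ q u)) (⊟-self (q ⊡ fun u)))

  fun-multiple⁻ : ∀ q {x u} → fun (x ⊟ q ⊡ u) ≡ 0ᵛ → fun x ≡ q ⊡ fun u
  fun-multiple⁻ q {x} {u} eq = trans (⊟≡0⇒≡ _ _ (trans (sym (fun-⊟ x (q ⊡ u))) eq)) (fun-⊡ q u)

outside-kernel : {ts : List (Vec ℚ n)} (ρ : Projection ts) (X : List (Vec ℚ n)) (d : ℕ) →
                 LinearRank≥ d X → length ts < d → ∃ λ v → v ∈ X × Projection.fun ρ v ≢ 0ᵛ
outside-kernel {ts = ts} ρ X d rank short with Any.any? (λ x → ¬? (Projection.fun ρ x ≟ᵛ 0ᵛ)) X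
... | yes found = find found
... | no none = ⊥-elim (rank ts short λ {x} x∈ → Projection.kernel⊆span ρ
        (decidable-stable (Projection.fun ρ x ≟ᵛ 0ᵛ) (All.lookup (Allₚ.¬Any⇒All¬ X none) x∈)))

module Lines {hs : List (Vec ℚ n)} (π : Projection hs) (X : List (Vec ℚ n)) where
  open Projection π

  -- This is collinearity in the quotient by the span of `hs`. The count `inc` leaves out the
  -- kernel, whose elements lie on every line.
  OnLine : Vec ℚ n → Vec ℚ n → Set
  OnLine u x = ∃ λ q → fun x ≡ q ⊡ fun u

  onLine? : ∀ u x → Dec (OnLine u x)
  onLine? u x with fun u ≟ᵛ 0ᵛ
  ... | yes fu≡0 = Dec.map′ (λ eq → 0ℚ , trans eq (sym (⊡-0 (fun u))))
          (λ (q , eq) → trans eq (trans (cong (q ⊡_) fu≡0) (⊡-zeroʳ q))) (fun x ≟ᵛ 0ᵛ)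
  -- Extending `π` by `u` collapses exactly the line through `u`, so that lying on it becomes a
  -- decidable equation.
  ... | no fu≢0 = Dec.map′ (λ eq → coefficient x , ⊟≡0⇒≡ _ _ (trans (sym (fun⁺ x)) eq)) kernel⁺ (Projection.fun π⁺ x ≟ᵛ 0ᵛ)
    where
    open Extension (extend π u fu≢0)
    kernel⁺ : OnLine u x → Projection.fun π⁺ x ≡ 0ᵛ
    kernel⁺ (q , eq) = trans (fun-multiple⁻ (Projection.lin π⁺) q (kernel⊆kernel⁺ (fun-multiple lin q eq)))
      (trans (cong (q ⊡_) kills) (⊡-zeroʳ q))

  inc? : ∀ u x → Dec (fun x ≢ 0ᵛ × OnLine u x)
  inc? u x = ¬? (fun x ≟ᵛ 0ᵛ) ×-dec onLine? u x

  inc : Vec ℚ n → ℕ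
  inc u = # (inc? u) X

  weight : {ts : List (Vec ℚ n)} → Projection ts → ℕ
  weight ρ = # (λ x → Projection.fun ρ x ≟ᵛ 0ᵛ) X

  module _ {ts : List (Vec ℚ n)} (ρ : Projection ts)
           (π⊆ρ : ∀ {x} → fun x ≡ 0ᵛ → Projection.fun ρ x ≡ 0ᵛ) where

    kernel-line-disjoint : ∀ {u x} → Projection.fun ρ u ≢ 0ᵛ → Projection.fun ρ x ≡ 0ᵛ → fun x ≢ 0ᵛ → ¬ OnLine u x
    kernel-line-disjoint {u} {x} ρu≢0 ρx≡0 fx≢0 (q , eq) =
      fx≢0 (trans eq (trans (cong (_⊡ fun u) q≡0) (⊡-0 (fun u))))
      where
      q≡0 : q ≡ 0ℚ
      q≡0 = ⊡≡0⇒ q ρu≢0 (trans (sym (fun-multiple⁻ (Projection.lin ρ) q (π⊆ρ (fun-multiple lin q eq)))) ρx≡0)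

    weight+inc≤length : ∀ {u} → Projection.fun ρ u ≢ 0ᵛ → weight ρ + inc u ≤ length X
    weight+inc≤length {u} ρu≢0 = ≤-trans
      (#-disjoint-≤ (λ x → Projection.fun ρ x ≟ᵛ 0ᵛ) (inc? u) (λ _ → yes tt) X (λ _ _ → tt) (λ _ _ → tt)
        (λ _ z (nz , on) → kernel-line-disjoint ρu≢0 z nz on))
      (#≤length (λ _ → yes tt) X)

    -- The new kernel swallows the whole line through `u`, and away from the kernel of `π` this line
    -- is disjoint from the old kernel of `ρ`.
    weight+inc≤weight⁺ : ∀ {u} (ρu≢0 : Projection.fun ρ u ≢ 0ᵛ) →
                         weight ρ + inc u ≤ weight (Extension.π⁺ (extend ρ u ρu≢0))
    weight+inc≤weight⁺ {u} ρu≢0 =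
      #-disjoint-≤ (λ x → Projection.fun ρ x ≟ᵛ 0ᵛ) (inc? u) (λ x → Projection.fun π⁺ x ≟ᵛ 0ᵛ) X
        (λ _ → kernel⊆kernel⁺) (λ _ (_ , q , eq) → on-line q eq)
        (λ _ z (nz , on) → kernel-line-disjoint ρu≢0 z nz on)
      where
      open Extension (extend ρ u ρu≢0)
      on-line : ∀ {x} q → fun x ≡ q ⊡ fun u → Projection.fun π⁺ x ≡ 0ᵛ
      on-line q eq = trans (fun-multiple⁻ (Projection.lin π⁺) q (kernel⊆kernel⁺ (π⊆ρ (fun-multiple lin q eq))))
        (trans (cong (q ⊡_) kills) (⊡-zeroʳ q))

  -- Repeatedly adding the heaviest line through the kernel of π: every line that is still missing is
  -- lighter than each of the j disjoint lines added so far.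
  record Hyperplane (j : ℕ) : Set where
    field
      ts : List (Vec ℚ n)
      length-ts : length ts ≡ j + length hs
      ρ : Projection ts
      π⊆ρ : ∀ {x} → fun x ≡ 0ᵛ → Projection.fun ρ x ≡ 0ᵛ
      light : ∀ {v} → v ∈ X → Projection.fun ρ v ≢ 0ᵛ → j * inc v + weight π ≤ weight ρ

  hyperplane : ∀ {d} → LinearRank≥ d X → ∀ j → j + length hs < suc d → Hyperplane j
  hyperplane rank zero _ = record { ts = hs ; length-ts = refl ; ρ = π ; π⊆ρ = id ; light = λ _ _ → ≤-refl }
  hyperplane {d} rank (suc j) (s≤s j<) = record
    { ts = u ∷ ts
    ; length-ts = cong suc length-ts
    ; ρ = Extension.π⁺ E
    ; π⊆ρ = Extension.kernel⊆kernel⁺ E ∘ π⊆ρ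
    ; light = light⁺ }
    where
    open Hyperplane (hyperplane rank j (ℕₚ.m≤n⇒m≤1+n j<))
    outer? = λ x → ¬? (Projection.fun ρ x ≟ᵛ 0ᵛ)
    found = outside-kernel ρ X d rank (subst (_< d) (sym length-ts) j<)
    heaviest = maximal (λ u v → inc u ≤ inc v) ≤-refl ≤-trans (λ u v → ℕₚ.≤-total (inc u) (inc v))
                 (∈ₚ.∈-filter⁺ outer? (proj₁ (proj₂ found)) (proj₂ (proj₂ found)))
    u = proj₁ heaviest
    ρu≢0 = proj₂ (∈ₚ.∈-filter⁻ outer? {xs = X} (proj₁ (proj₂ heaviest)))
    E = extend ρ u ρu≢0
    light⁺ : ∀ {v} → v ∈ X → Projection.fun (Extension.π⁺ E) v ≢ 0ᵛ →
             suc j * inc v + weight π ≤ weight (Extension.π⁺ E)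
    -- An element outside the new kernel was already a candidate when `u` was chosen, so its line is
    -- no heavier than the one just added.
    light⁺ {v} v∈ ρ⁺v≢0 = lin≤ _ _ 0
      (+-mono-≤ (light v∈ ρv≢0) (+-mono-≤ (proj₂ (proj₂ heaviest) (∈ₚ.∈-filter⁺ outer? v∈ ρv≢0))
        (weight+inc≤weight⁺ ρ π⊆ρ ρu≢0)))
      (identity′ j (inc v) (inc u) (weight π) (weight ρ) (weight (Extension.π⁺ E)))
      where
      ρv≢0 = ρ⁺v≢0 ∘ Extension.kernel⊆kernel⁺ E
      identity′ : ∀ j iv iu a r r⁺ → suc j * iv + a + (r + (iu + r⁺)) + 0 ≡ r⁺ + (j * iv + a + (iv + (r + iu)))
      identity′ = solve-∀

-- Linear orders adapted to two nested kernels

Pos-++ˡ : {u : Vec ℚ m} {v : Vec ℚ n} → Pos u → Pos (u Vec.++ v)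
Pos-++ˡ {u = _ ∷ _} (inj₁ p) = inj₁ p
Pos-++ˡ {u = _ ∷ _} (inj₂ (z , p)) = inj₂ (z , Pos-++ˡ p)

Pos-++ʳ : (u : Vec ℚ m) {v : Vec ℚ n} → u ≡ 0ᵛ → Pos v → Pos (u Vec.++ v)
Pos-++ʳ [] _ p = p
Pos-++ʳ (q ∷ u) eq p = inj₂ (Vecₚ.∷-injectiveˡ eq , Pos-++ʳ u (Vecₚ.∷-injectiveʳ eq) p)

scaled : ℚ → Lin m n → Lin m n
scaled s f = record
  { fun = λ x → s ⊡ fun x
  ; fun-⊞ = λ u v → trans (cong (s ⊡_) (fun-⊞ u v)) (⊡-distribˡ s (fun u) (fun v))
  ; fun-⊡ = λ q u → trans (cong (s ⊡_) (fun-⊡ q u)) (⊡-comm s q (fun u)) }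
  where open Lin f

paired : {k l : ℕ} → Lin m k → Lin m l → Lin m (k + l)
paired f g = record
  { fun = λ x → F.fun x Vec.++ G.fun x
  ; fun-⊞ = λ u v → trans (cong₂ Vec._++_ (F.fun-⊞ u v) (G.fun-⊞ u v))
      (sym (Vecₚ.zipWith-++ ℚ._+_ (F.fun u) (G.fun u) (F.fun v) (G.fun v)))
  ; fun-⊡ = λ q u → trans (cong₂ Vec._++_ (F.fun-⊡ q u) (G.fun-⊡ q u)) (sym (Vecₚ.map-++ (q ℚ.*_) (F.fun u) (G.fun u))) }
  where
  module F = Lin f
  module G = Lin g

0ᵛ-++ : ∀ k l → 0ᵛ {k} Vec.++ 0ᵛ {l} ≡ 0ᵛ {k + l}
0ᵛ-++ zero l = refl
0ᵛ-++ (suc k) l = cong (0ℚ ∷_) (0ᵛ-++ k l)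

better-sign : (w : ℚ → ℕ) → ∃ λ s → w 1ℚ + w -1ℚ ≤ 2 * w s
better-sign w with ℕₚ.≤-total (w 1ℚ) (w -1ℚ)
... | inj₁ ≤w = -1ℚ , lin≤ _ _ 0 ≤w (identity′ (w 1ℚ) (w -1ℚ))
  where
  identity′ : ∀ a b → a + b + b + 0 ≡ 2 * b + a
  identity′ = solve-∀
... | inj₂ ≤w = 1ℚ , lin≤ _ _ 0 ≤w (identity′ (w 1ℚ) (w -1ℚ))
  where
  identity′ : ∀ a b → a + b + a + 0 ≡ 2 * a + b
  identity′ = solve-∀

-- ρ decides first, so that the largest element lies outside its kernel; ties are broken by π. The two
-- signs are chosen so that at least half of the elements outside the kernel of π are positive.
record Direction {hs ts : List (Vec ℚ n)} (π : Projection hs) (ρ : Projection ts) (X : List (Vec ℚ n)) : Set where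
  field
    {l} : ℕ
    ψ : Lin n l
    ψ-kernel : ∀ {x} → Projection.fun π x ≡ 0ᵛ → Lin.fun ψ x ≡ 0ᵛ
    half : length X ≤ 2 * # (λ x → Pos? (Lin.fun ψ x)) X + # (λ x → Projection.fun π x ≟ᵛ 0ᵛ) X
    top : ∀ {v} → (∀ {x} → x ∈ X → Lin.fun ψ x ≼ Lin.fun ψ v) → Projection.fun ρ v ≢ 0ᵛ

direction : {hs ts : List (Vec ℚ n)} (π : Projection hs) (ρ : Projection ts) (X : List (Vec ℚ n)) →
            (∀ {x} → Projection.fun π x ≡ 0ᵛ → Projection.fun ρ x ≡ 0ᵛ) →
            (∃ λ v → v ∈ X × Projection.fun ρ v ≢ 0ᵛ) → Direction π ρ X
direction {n} π ρ X π⊆ρ (w , w∈ , ρw≢0) = record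
  { ψ = ψ
  ; ψ-kernel = λ {x} eq → trans (cong₂ (λ u v → s ⊡ u Vec.++ t ⊡ v) (π⊆ρ eq) eq)
      (trans (cong₂ Vec._++_ (⊡-zeroʳ {n} s) (⊡-zeroʳ {n} t)) (0ᵛ-++ n n))
  ; half = half
  ; top = top }
  where
  module π = Projection π
  module ρ = Projection ρ
  -- `second?` looks only inside the kernel of `ρ`, where the first component vanishes. The two
  -- signs can therefore be chosen independently.
  first? = λ s x → Pos? (s ⊡ ρ.fun x)
  second? = λ t x → (ρ.fun x ≟ᵛ 0ᵛ) ×-dec Pos? (t ⊡ π.fun x)
  zero? = λ x → π.fun x ≟ᵛ 0ᵛ
  s = proj₁ (better-sign λ s → # (first? s) X)
  t = proj₁ (better-sign λ t → # (second? t) X)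
  ψ = paired (scaled s ρ.lin) (scaled t π.lin)
  pos? = λ x → Pos? (Lin.fun ψ x)

  pos≥ : # (first? s) X + # (second? t) X ≤ # pos? X
  pos≥ = #-disjoint-≤ (first? s) (second? t) pos? X (λ _ → Pos-++ˡ)
    (λ {x} _ (z , p) → Pos-++ʳ (s ⊡ ρ.fun x) (trans (cong (s ⊡_) z) (⊡-zeroʳ s)) p)
    (λ {x} _ p (z , _) → Pos-irrefl (subst Pos (trans (cong (s ⊡_) z) (⊡-zeroʳ s)) p))

  both : {f : Vec ℚ n → Vec ℚ n} → ∀ x → f x ≢ 0ᵛ → Pos (1ℚ ⊡ f x) ⊎ Pos (-1ℚ ⊡ f x)
  both {f} x f≢0 with Pos-tri (f x)
  ... | inj₁ z = ⊥-elim (f≢0 z)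
  ... | inj₂ (inj₁ p) = inj₁ (subst Pos (sym (⊡-1 (f x))) p)
  ... | inj₂ (inj₂ p) = inj₂ p

  outer? = λ x → ¬? (ρ.fun x ≟ᵛ 0ᵛ)
  inner? = λ x → (ρ.fun x ≟ᵛ 0ᵛ) ×-dec ¬? (π.fun x ≟ᵛ 0ᵛ)

  outer≤ : # outer? X ≤ # (first? 1ℚ) X + # (first? -1ℚ) X
  outer≤ = #-cover-≤ (first? 1ℚ) (first? -1ℚ) outer? X λ {x} _ → both {ρ.fun} x

  inner≤ : # inner? X ≤ # (second? 1ℚ) X + # (second? -1ℚ) X
  inner≤ = #-cover-≤ (second? 1ℚ) (second? -1ℚ) inner? X λ {x} _ (z , nz) →
    [ (λ p → inj₁ (z , p)) , (λ p → inj₂ (z , p)) ]′ (both {π.fun} x nz)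

  length≤ : length X ≤ # outer? X + (# inner? X + # zero? X)
  length≤ = ≤-trans (≤-reflexive (sym (trans (∑-const X 1) (ℕₚ.*-identityʳ _))))
    (≤-trans (#-cover-≤ outer? (λ x → ρ.fun x ≟ᵛ 0ᵛ) (λ _ → yes tt) X
        λ {x} _ _ → case ρ.fun x ≟ᵛ 0ᵛ of λ { (yes z) → inj₂ z ; (no nz) → inj₁ nz })
      (ℕₚ.+-monoʳ-≤ _ (#-cover-≤ inner? zero? (λ x → ρ.fun x ≟ᵛ 0ᵛ) X
        λ {x} _ z → case π.fun x ≟ᵛ 0ᵛ of λ { (yes z′) → inj₂ z′ ; (no nz) → inj₁ (z , nz) })))

  half : length X ≤ 2 * # pos? X + # zero? X
  half = lin≤ _ _ 0
    (+-mono-≤ length≤ (+-mono-≤ outer≤ (+-mono-≤ inner≤ (+-mono-≤ (*-monoʳ-≤ 2 pos≥)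
      (+-mono-≤ (proj₂ (better-sign λ s → # (first? s) X)) (proj₂ (better-sign λ t → # (second? t) X)))))))
    (identity′ (length X) (# outer? X) (# inner? X) (# zero? X) (# pos? X) (# (first? s) X) (# (second? t) X)
      (# (first? 1ℚ) X + # (first? -1ℚ) X) (# (second? 1ℚ) X + # (second? -1ℚ) X))
    where
    identity′ : ∀ k o i z p f g f± g± →
      k + (o + (i + z) + (f± + (g± + (2 * p + (2 * f + 2 * g))))) + 0
      ≡ 2 * p + z + (k + (o + (i + (2 * (f + g) + (f± + g±)))))
    identity′ = solve-∀

  exists-first : ∃ λ x → x ∈ X × Pos (s ⊡ ρ.fun x)
  exists-first = 0<#⇒∃ (first? s) X (positive (# (first? s) X) (≤-trans (∃⇒0<# outer? w∈ ρw≢0)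
    (≤-trans outer≤ (proj₂ (better-sign λ s → # (first? s) X)))))
    where
    positive : ∀ c → 0 < 2 * c → 0 < c
    positive (suc c) _ = s≤s z≤n

  -- An element with positive first component exists, and it lies above everything in the kernel of
  -- `ρ`, where that component is zero.
  top : ∀ {v} → (∀ {x} → x ∈ X → Lin.fun ψ x ≼ Lin.fun ψ v) → ρ.fun v ≢ 0ᵛ
  top {v} max z with x , x∈ , p ← exists-first = max x∈ (subst Pos (Lin.fun-⊟ ψ x v)
    (Pos-++ˡ (subst (λ y → Pos (s ⊡ y)) (sym (trans (ρ.fun-⊟ x v) (trans (cong (ρ.fun x ⊟_) z) (⊟-0 (ρ.fun x))))) p)))

-- Sorting, transversals and initial segments of ℕ

insert : (y : Vec ℚ n) (Y : List (Vec ℚ n)) → Descending Y → y ∉ Y →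
         ∃ λ Z → Descending Z × (∀ {z} → z ∈ y ∷ Y → z ∈ Z) × (∀ {z} → z ∈ Z → z ∈ y ∷ Y)
insert y [] desc y∉ = y ∷ [] , [] ∷ [] , id , id
insert y (u ∷ Y) (u> ∷ desc) y∉ with ≺-tri y u
... | inj₁ refl = ⊥-elim (y∉ (here refl))
... | inj₂ (inj₂ u≺y) = y ∷ u ∷ Y , (u≺y ∷ All.map (λ p → ≺-trans p u≺y) u>) ∷ u> ∷ desc , id , id
... | inj₂ (inj₁ y≺u) with Z , descZ , to , from ← insert y Y desc (y∉ ∘ there) =
  u ∷ Z
  , All.tabulate (λ z∈ → case from z∈ of λ { (here refl) → y≺u ; (there i) → All.lookup u> i }) ∷ descZ
  , (λ { (here refl) → there (to (here refl)) ; (there (here refl)) → here refl ; (there (there i)) → there (to (there i)) })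
  , (λ { (here refl) → there (here refl) ; (there i) → case from i of λ { (here refl) → here refl ; (there j) → there (there j) } })

sort : (Y : List (Vec ℚ n)) → Unique Y →
       ∃ λ Z → Descending Z × (∀ {z} → z ∈ Y → z ∈ Z) × (∀ {z} → z ∈ Z → z ∈ Y)
sort [] _ = [] , [] , id , id
sort (y ∷ Y) (y∉ ∷ Y!)
  with Z , descZ , to , from ← sort Y Y!
  with Z′ , descZ′ , to′ , from′ ← insert y Z descZ (λ y∈ → All.lookup y∉ (from y∈) refl) =
  Z′ , descZ′
  , (λ { (here refl) → to′ (here refl) ; (there i) → to′ (there (to i)) })
  , (λ z∈ → case from′ z∈ of λ { (here refl) → here refl ; (there i) → there (from i) })

freiman-ruzsa-unique : (Y : List (Vec ℚ n)) → Unique Y → (e : ℕ) → AffineRank≥ e Y →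
                       {P : Vec ℚ n → Set} (P? : Decidable P) → 0 < # P? Y →
                       (S : List (Vec ℚ n)) → (∀ {b y} → b ∈ Y → P b → y ∈ Y → b ⊞ y ∈ S) →
                       e * # P? Y + 2 * length Y ≤ 2 * length S + e
freiman-ruzsa-unique Y Y! e rank P? 0<# S cover with Z , desc , to , from ← sort Y Y! =
  ≤-trans (+-mono-≤ (*-monoʳ-≤ e #≤) (*-monoʳ-≤ 2 (unique-⊆-length Y! to)))
    (freiman-ruzsa Z desc e (λ o ts short h → rank o ts short (h ∘ to)) P? (≤-trans 0<# #≤) S
      (λ b∈ p y∈ → cover (from b∈) p (from y∈)))
  where
  #≤ : # P? Y ≤ # P? Z
  #≤ = ≤-trans (#-inj-length P? id Y! id (λ i p → ∈ₚ.∈-filter⁺ P? (to i) p)) (≤-reflexive (length-filter≡# P? Z))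

module _ (_≟_ : (x y : B) → Dec (x ≡ y)) (f : A → B) where

  transversal : (xs : List A) → ∃ λ ts → Unique (map f ts) × (∀ {t} → t ∈ ts → t ∈ xs) ×
                                         (∀ {x} → x ∈ xs → f x ∈ map f ts)
  transversal [] = [] , [] , (λ ()) , λ ()
  transversal (x ∷ xs) with transversal xs
  ... | ts , ts! , sub , onto with DecMembership._∈?_ _≟_ (f x) (map f ts)
  ...   | yes fx∈ = ts , ts! , there ∘ sub , λ { (here refl) → fx∈ ; (there i) → onto i }
  ...   | no fx∉ = x ∷ ts , All.tabulate (λ { i refl → fx∉ i }) ∷ ts!
                 , (λ { (here refl) → here refl ; (there i) → there (sub i) })
                 , (λ { (here refl) → here refl ; (there i) → there (onto i) })

unique-map-injective : {f : A → B} {ts : List A} → Unique (map f ts) →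
                       ∀ {s t} → s ∈ ts → t ∈ ts → f s ≡ f t → s ≡ t
unique-map-injective (_ ∷ _) (here refl) (here refl) _ = refl
unique-map-injective {f = f} (f∉ ∷ _) (here refl) (there j) eq = ⊥-elim (All.lookup f∉ (∈ₚ.∈-map⁺ f j) eq)
unique-map-injective {f = f} (f∉ ∷ _) (there i) (here refl) eq = ⊥-elim (All.lookup f∉ (∈ₚ.∈-map⁺ f i) (sym eq))
unique-map-injective (_ ∷ u) (there i) (there j) eq = unique-map-injective u i j eq

unique-#≤1 : (_≟_ : (x y : A) → Dec (x ≡ y)) (x : A) {ys : List A} → Unique ys → # (x ≟_) ys ≤ 1
unique-#≤1 _≟_ x {ys} ys! = #-inj-length (x ≟_) {ys = x ∷ []} id ys! id (λ _ eq → here (sym eq))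

#-below : (M c : ℕ) → # (ℕₚ._<? c) (List.upTo M) ≤ c
#-below M c = ≤-trans (#-inj-length (ℕₚ._<? c) {ys = List.upTo c} id (Uniqueₚ.upTo⁺ M) id (λ _ → ∈ₚ.∈-upTo⁺))
  (≤-reflexive (Listₚ.length-upTo c))

#-below-≥ : (M c : ℕ) → c ≤ M → c ≤ # (ℕₚ._<? c) (List.upTo M)
#-below-≥ M c c≤M = ≤-trans (≤-reflexive (sym (Listₚ.length-upTo c)))
  (≤-trans (unique-⊆-length (Uniqueₚ.upTo⁺ c)
      (λ i → ∈ₚ.∈-filter⁺ (ℕₚ._<? c) (∈ₚ.∈-upTo⁺ (<-≤-trans (∈ₚ.∈-upTo⁻ i) c≤M)) (∈ₚ.∈-upTo⁻ i)))
    (≤-reflexive (length-filter≡# (ℕₚ._<? c) (List.upTo M))))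

-- Arithmetic of the chain of translates

chain-start-heavy : ∀ d G k a → a ≤ 1 → G ≤ k → suc d * a * G ≤ suc d * k + G * k
chain-start-heavy d G k a a≤1 G≤k = lin≤ _ _ (G * k) (+-mono-≤ (*-monoʳ-≤ (suc d * G) a≤1) (*-monoʳ-≤ (suc d) G≤k)) (eq d G k a)
  where
  eq : ∀ d G k z → suc d * z * G + (suc d * G * 1 + suc d * k) + G * k ≡ suc d * k + G * k + (suc d * G * z + suc d * G)
  eq = solve-∀

chain-start-gain : ∀ G k s → k ≤ s → 2 * (G * k) + 0 ≤ 2 * G * s
chain-start-gain G k s k≤s = lin≤ _ _ 0 (*-monoʳ-≤ (2 * G) k≤s) (eq G k s)
  where
  eq : ∀ G k s → 2 * (G * k) + 0 + 2 * G * s + 0 ≡ 2 * G * s + 2 * G * k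
  eq = solve-∀

-- The old kernel holds at most `k / G` elements and the added line at most `k / (e + 1)`; the claim
-- is the sum of both, cleared of denominators.
chain-step-heavy : ∀ e G k a i a⁺ → a⁺ ≤ a + i → G * a ≤ k → suc e * i + a ≤ k → suc e * a⁺ * G ≤ suc e * k + G * k
chain-step-heavy e G k a i a⁺ a⁺≤ Ga≤k inc≤ = lin≤ _ _ (G * a)
  (+-mono-≤ (*-monoʳ-≤ (suc e * G) a⁺≤) (+-mono-≤ (*-monoʳ-≤ (suc e) Ga≤k) (*-monoʳ-≤ G inc≤))) (eq e G k a i a⁺)
  where
  eq : ∀ e G k a i a⁺ → suc e * a⁺ * G + (suc e * G * (a + i) + (suc e * k + G * k)) + G * a
       ≡ suc e * k + G * k + (suc e * G * a⁺ + (suc e * (G * a) + G * (suc e * i + a)))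
  eq = solve-∀

-- At least half of the elements outside the kernel yield new sums, and the kernel holds at most
-- `k / G` elements. The gain is thus at least `(1 - 1 / G) k / 2`, here multiplied by `2 G`.
chain-step-gain : ∀ g h k p a s₁ s₂ → 2 * (suc g * k) + h * (g * k) ≤ 2 * suc g * s₁ → p ≤ s₂ → k ≤ 2 * p + a →
                  suc g * a ≤ k → 2 * (suc g * k) + suc h * (g * k) ≤ 2 * suc g * (s₁ + s₂)
chain-step-gain g h k p a s₁ s₂ old new half light = lin≤ _ _ 0
  (+-mono-≤ old (+-mono-≤ (*-monoʳ-≤ (2 * suc g) new) (+-mono-≤ (*-monoʳ-≤ (suc g) half) light))) (eq g h k p a s₁ s₂)
  where
  eq : ∀ g h k p a s₁ s₂ →
       2 * (suc g * k) + suc h * (g * k) + (2 * suc g * s₁ + (2 * suc g * s₂ + (suc g * (2 * p + a) + k))) + 0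
       ≡ 2 * suc g * (s₁ + s₂) + (2 * (suc g * k) + h * (g * k) + (2 * suc g * p + (suc g * k + suc g * a)))
  eq = solve-∀

-- Translates covering many sums

Covers : List (Vec ℚ n) → List (Vec ℚ n) → List (Vec ℚ n) → Set
Covers T X S = ∀ {t x} → t ∈ T → x ∈ X → t ⊞ x ∈ S

module Translates {n : ℕ} (X : List (Vec ℚ n)) (X! : Unique X) (0∈X : 0ᵛ ∈ X)
                  (d : ℕ) (rank : LinearRank≥ d X) (g : ℕ) (g<k : suc g ≤ length X) where

  k = length X
  G = suc g

  zeros : {hs : List (Vec ℚ n)} → Projection hs → ℕ
  zeros π = # (λ x → Projection.fun π x ≟ᵛ 0ᵛ) X

  -- As long as the kernel of π contains at most k / G elements of X, each new translate gains
  -- (1 - 1 / G) k / 2 sums; heavy says that it contains a proportion of at most 1 / G + 1 / (e + 1).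
  record Chain (h e : ℕ) : Set where
    field
      hs : List (Vec ℚ n)
      length-hs : length hs ≡ h
      π : Projection hs
      T : List (Vec ℚ n)
      T⊆X : ∀ {t} → t ∈ T → t ∈ X
      length-T : length T ≤ suc h
      T-kernel : ∀ {t} → t ∈ T → Projection.fun π t ≡ 0ᵛ
      gain : ∀ S → Covers T X S → 2 * (G * k) + h * (g * k) ≤ 2 * G * length S
      heavy : suc e * zeros π * G ≤ suc e * k + G * k

  start : Chain 0 d
  start = record
    { hs = []
    ; length-hs = refl
    ; π = identity
    ; T = 0ᵛ ∷ []
    ; T⊆X = λ { (here refl) → 0∈X }
    ; length-T = ≤-refl
    ; T-kernel = λ { (here refl) → refl }
    ; gain = λ S cover → chain-start-gain G k (length S)
        (unique-inj-length (0ᵛ ⊞_) X! (λ _ _ → ⊞-cancelˡ 0ᵛ) (cover (here refl)))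
    ; heavy = chain-start-heavy d G k (zeros identity) zeros≤1 g<k }
    where
    zeros≤1 : zeros identity ≤ 1
    zeros≤1 = #-inj-length (λ x → x ≟ᵛ 0ᵛ) {ys = 0ᵛ ∷ []} id X! id (λ _ eq → here eq)

  module Step {h e : ℕ} (C : Chain h (suc e)) (light-π : G * zeros (Chain.π C) ≤ k)
              (H : Lines.Hyperplane (Chain.π C) X e)
              (D : Direction (Chain.π C) (Lines.Hyperplane.ρ H) X)
              {v : Vec ℚ n} (v∈ : v ∈ X) (v-max : ∀ {x} → x ∈ X → Lin.fun (Direction.ψ D) x ≼ Lin.fun (Direction.ψ D) v)
              (E : Extension (Chain.π C) v) where
    open Chain C
    open Lines π X
    open Hyperplane H
    open Direction D
    open Extension E

    ψ-fun = Lin.fun ψ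
    ρv≢0 : Projection.fun ρ v ≢ 0ᵛ
    ρv≢0 = top v-max

    inc≤ : suc e * inc v + zeros π ≤ k
    inc≤ = lin≤ _ _ 0 (+-mono-≤ (light v∈ ρv≢0) (weight+inc≤length ρ π⊆ρ ρv≢0)) (identity′ e (inc v) (zeros π) (zeros ρ) k)
      where
      identity′ : ∀ e i a r k → suc e * i + a + (r + k) + 0 ≡ k + (e * i + a + (r + i))
      identity′ = solve-∀

    zeros⁺≤ : zeros π⁺ ≤ zeros π + inc v
    zeros⁺≤ = #-cover-≤ (λ x → Projection.fun π x ≟ᵛ 0ᵛ) (inc? v) (λ x → Projection.fun π⁺ x ≟ᵛ 0ᵛ) X λ {x} _ z →
      case Projection.fun π x ≟ᵛ 0ᵛ of λ
        { (yes z′) → inj₁ z′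
        ; (no nz) → inj₂ (nz , coefficient x , ⊟≡0⇒≡ _ _ (trans (sym (fun⁺ x)) z)) }

    gain⁺ : ∀ S → Covers (v ∷ T) X S → 2 * (G * k) + suc h * (g * k) ≤ 2 * G * length S
    gain⁺ S cover = subst (λ s → 2 * (G * k) + suc h * (g * k) ≤ 2 * G * s) (sym (length-filter-split old? S))
      (chain-step-gain g h k p (zeros π) (length S₁) (length S₂)
        (gain S₁ λ t∈ x∈ → ∈ₚ.∈-filter⁺ old? (cover (there t∈) x∈) (∈ₚ.∈-cartesianProductWith⁺ _⊞_ t∈ x∈))
        new half light-π)
      where
      old? = λ z → z ∈ᵛ? sums T X
      S₁ = filter old? S
      S₂ = filter (¬? ∘ old?) S
      p = # (λ x → Pos? (ψ-fun x)) X
      -- An old sum equal to `v ⊞ x` is some `t ⊞ y` with `t` in the kernel. Then `ψ` places `y`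
      -- above `v` by the positive amount `ψ-fun x`, against the maximality of `v`.
      new : p ≤ length S₂
      new = #-inj-length (λ x → Pos? (ψ-fun x)) (v ⊞_) X! (⊞-cancelˡ v) λ {x} x∈ pos →
        ∈ₚ.∈-filter⁺ (¬? ∘ old?) (cover (here refl) x∈) λ old → case ∈ₚ.∈-cartesianProductWith⁻ _⊞_ T X old of λ
          (t , y , t∈ , y∈ , eq) → v-max y∈ (subst Pos (begin
            ψ-fun x ≡⟨ sym (⊞-⊟ (ψ-fun v) (ψ-fun x)) ⟩
            ψ-fun v ⊞ ψ-fun x ⊟ ψ-fun v ≡⟨ cong (_⊟ ψ-fun v) (sym (Lin.fun-⊞ ψ v x)) ⟩
            ψ-fun (v ⊞ x) ⊟ ψ-fun v ≡⟨ cong (λ z → ψ-fun z ⊟ ψ-fun v) eq ⟩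
            ψ-fun (t ⊞ y) ⊟ ψ-fun v ≡⟨ cong (_⊟ ψ-fun v) (Lin.fun-⊞ ψ t y) ⟩
            ψ-fun t ⊞ ψ-fun y ⊟ ψ-fun v ≡⟨ cong (λ z → z ⊞ ψ-fun y ⊟ ψ-fun v) (ψ-kernel (T-kernel t∈)) ⟩
            0ᵛ ⊞ ψ-fun y ⊟ ψ-fun v ≡⟨ cong (_⊟ ψ-fun v) (⊞-identityˡ (ψ-fun y)) ⟩
            ψ-fun y ⊟ ψ-fun v ∎) pos)
        where open ≡-Reasoning

    next : Chain (suc h) e
    next = record
      { hs = v ∷ hs
      ; length-hs = cong suc length-hs
      ; π = π⁺
      ; T = v ∷ T
      ; T⊆X = λ { (here refl) → v∈ ; (there i) → T⊆X i }
      ; length-T = s≤s length-T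
      ; T-kernel = λ { (here refl) → kills ; (there i) → kernel⊆kernel⁺ (T-kernel i) }
      ; gain = gain⁺
      ; heavy = chain-step-heavy e G k (zeros π) (inc v) (zeros π⁺) zeros⁺≤ light-π inc≤ }

  step : ∀ {h e} → h + suc e ≡ d → (C : Chain h (suc e)) → G * zeros (Chain.π C) ≤ k → Chain (suc h) e
  step {h} {e} h+e≡d C light-π =
    let v , v∈ , v-max = maximal (λ x y → Lin.fun ψ x ≼ Lin.fun ψ y) ≼-refl ≼-trans (λ x y → ≼-total (Lin.fun ψ x) (Lin.fun ψ y)) 0∈X
    in Step.next C light-π H D v∈ v-max (extend π v (top v-max ∘ π⊆ρ))
    where
    open Chain C
    codim : e + length hs < d
    codim = ≤-reflexive (trans (cong (λ l → suc (e + l)) length-hs)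
      (trans (cong suc (ℕₚ.+-comm e h)) (trans (sym (ℕₚ.+-suc h e)) h+e≡d)))
    H = Lines.hyperplane π X rank e (ℕₚ.m≤n⇒m≤1+n codim)
    open Lines.Hyperplane H
    D = direction π ρ X π⊆ρ (outside-kernel ρ X d rank (subst (_< d) (sym length-ts) codim))
    open Direction D

-- By `heavy`, `e a ≤ e k / G + k`. So the sums outside the fibres number at least
-- `e (1 - 1 / G) k / 2 - k / 2`, and the missing `k / 2` is taken from the full `k` contributed by
-- the first translate.
chain-finish : ∀ g h e k a s₁ s₂ → 2 * (suc g * k) + h * (g * k) ≤ 2 * suc g * s₁ → e * k ≤ 2 * s₂ + e * a →
               suc e * a * suc g ≤ suc e * k + suc g * k → suc (h + e) * (g * k) ≤ 2 * suc g * (s₁ + s₂)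
chain-finish g h e k a s₁ s₂ old new heavy =
  lin≤ _ _ k (+-mono-≤ old (+-mono-≤ (*-monoʳ-≤ (suc g) new) heavy′)) (eq g h e k a s₁ s₂)
  where
  heavy′ : e * a * suc g ≤ e * k + suc g * k
  heavy′ = ℕₚ.*-cancelˡ-≤ (suc e) (lin≤ _ _ (suc g * k) (*-monoʳ-≤ e heavy) (eq′ g e k a))
    where
    eq′ : ∀ g e k a → suc e * (e * a * suc g) + e * (suc e * k + suc g * k) + suc g * k
          ≡ suc e * (e * k + suc g * k) + e * (suc e * a * suc g)
    eq′ = solve-∀
  eq : ∀ g h e k a s₁ s₂ →
       suc (h + e) * (g * k) + (2 * suc g * s₁ + (suc g * (2 * s₂ + e * a) + (e * k + suc g * k))) + k
       ≡ 2 * suc g * (s₁ + s₂) + (2 * (suc g * k) + h * (g * k) + (suc g * (e * k) + e * a * suc g))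
  eq = solve-∀

-- Counting the sums outside the fibres of X by layers: the s-th layer sees the fibres with more than s
-- elements, and the Freiman–Ruzsa inequality applies to their images.
module Fibres {n : ℕ} {hs : List (Vec ℚ n)} (π : Projection hs) (X : List (Vec ℚ n)) (X! : Unique X) (0∈X : 0ᵛ ∈ X)
              (e d : ℕ) (rank : LinearRank≥ d X) (e+h≡d : e + length hs ≡ d)
              (tr : List (Vec ℚ n)) (tr! : Unique (map (Projection.fun π) tr))
              (onto : ∀ {x} → x ∈ X → Projection.fun π x ∈ map (Projection.fun π) tr)
              (tr⊆X : ∀ {t} → t ∈ tr → t ∈ X) (S : List (Vec ℚ n)) (cover : Covers tr X S) where
  open Projection π

  Y = map fun tr
  inY? = λ z → fun z ∈ᵛ? Y
  S₁ = filter inY? S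
  S₂ = filter (¬? ∘ inY?) S

  images = transversal _≟ᵛ_ fun S₂
  Z = map fun (proj₁ images)
  Z! = proj₁ (proj₂ images)

  size : Vec ℚ n → ℕ
  size y = # (λ x → fun x ≟ᵛ y) X

  size′ : Vec ℚ n → ℕ
  size′ z = # (λ s → fun s ≟ᵛ z) S₂

  0∈Y : 0ᵛ ∈ Y
  0∈Y = subst (_∈ Y) fun-0 (onto 0∈X)

  -- The zero coset belongs to every layer. It keeps the set nonempty, as the Freiman-Ruzsa
  -- inequality requires, and accounts for the summand `e` on the right of that inequality.
  large? = λ s y → (y ≟ᵛ 0ᵛ) ⊎-dec (s ℕₚ.<? size y)
  large⁺? = λ s y → ¬? (y ≟ᵛ 0ᵛ) ×-dec (s ℕₚ.<? size y)

  -- Fewer than `e` directions for `Y`, lifted and joined with `hs`, would span `X` with fewer than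
  -- `d` vectors. Since `Y` contains 0, the affine base point does not cost a dimension.
  rankY : AffineRank≥ e Y
  rankY o ts short h = rank (ts ++ hs)
    (≤-trans (s≤s (≤-reflexive (Listₚ.length-++ ts))) (≤-trans (ℕₚ.+-monoˡ-< (length hs) short) (≤-reflexive e+h≡d)))
    λ {x} x∈ → subst (InSpan (ts ++ hs)) (trans (⊞-comm _ _) (⊟-⊞ x (fun x)))
      (InSpan-++ ts hs (subst (InSpan ts) (trans (⊟-flip (fun x) 0ᵛ o) (⊟-0 (fun x))) (InSpan-⊟ ts (h (onto x∈)) (h 0∈Y)))
        (residue x))

  -- If `b ⊞ y` is not in `Y`, a representative of `y` translates the whole fibre over `b` into the
  -- fibre of `S₂` over `b ⊞ y`, which is therefore at least as large.
  layer-cover : ∀ s {b y} → b ∈ Y → b ≡ 0ᵛ ⊎ s < size b → y ∈ Y → b ⊞ y ∈ filter (λ z → s ℕₚ.<? size′ z) Z ++ Y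
  layer-cover s {b} {y} b∈ large y∈ with (b ⊞ y) ∈ᵛ? Y
  ... | yes b+y∈ = ∈ₚ.∈-++⁺ʳ _ b+y∈
  ... | no b+y∉ with large
  ...   | inj₁ refl = ⊥-elim (b+y∉ (subst (_∈ Y) (sym (⊞-identityˡ y)) y∈))
  ...   | inj₂ s< with t , t∈ , refl ← ∈ₚ.∈-map⁻ fun y∈ =
    ∈ₚ.∈-++⁺ˡ (∈ₚ.∈-filter⁺ (λ z → s ℕₚ.<? size′ z) b+y∈Z (<-≤-trans s< size≤size′))
    where
    translate : ∀ {x} → x ∈ X → fun x ≡ b → t ⊞ x ∈ filter (λ s → fun s ≟ᵛ (b ⊞ fun t)) S₂
    translate {x} x∈ refl = ∈ₚ.∈-filter⁺ (λ s → fun s ≟ᵛ _)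
      (∈ₚ.∈-filter⁺ (¬? ∘ inY?) (cover t∈ x∈) (b+y∉ ∘ subst (_∈ Y) eq)) eq
      where
      eq : fun (t ⊞ x) ≡ fun x ⊞ fun t
      eq = trans (fun-⊞ t x) (⊞-comm (fun t) (fun x))
    size≤size′ : size b ≤ size′ (b ⊞ fun t)
    size≤size′ = ≤-trans (#-inj-length (λ x → fun x ≟ᵛ b) (t ⊞_) X! (⊞-cancelˡ t) translate)
      (≤-reflexive (length-filter≡# (λ s → fun s ≟ᵛ (b ⊞ fun t)) S₂))
    b+y∈Z : b ⊞ fun t ∈ Z
    b+y∈Z with x , x∈ , fx≡b ← 0<#⇒∃ (λ x → fun x ≟ᵛ b) X (≤-trans (s≤s z≤n) s<)
          with ∈S₂ , eq ← ∈ₚ.∈-filter⁻ (λ s → fun s ≟ᵛ (b ⊞ fun t)) {xs = S₂} (translate x∈ fx≡b) =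
      subst (_∈ Z) eq (proj₂ (proj₂ (proj₂ images)) ∈S₂)

  -- The sums that fall into `Y` cancel against the term `2 |Y|`, and the zero coset cancels the
  -- summand `e`.
  layer : ∀ s → e * # (large⁺? s) Y ≤ 2 * # (λ z → s ℕₚ.<? size′ z) Z
  layer s = bound e (# (large⁺? s) Y) (# (large? s) Y) (length Y) (# (λ z → s ℕₚ.<? size′ z) Z) _ 1+≤
    (trans (Listₚ.length-++ (filter (λ z → s ℕₚ.<? size′ z) Z))
      (cong (_+ length Y) (length-filter≡# (λ z → s ℕₚ.<? size′ z) Z)))
    (freiman-ruzsa-unique Y tr! e rankY (large? s) (∃⇒0<# (large? s) 0∈Y (inj₁ refl)) _ (layer-cover s))
    where
    1+≤ : 1 + # (large⁺? s) Y ≤ # (large? s) Y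
    1+≤ = ≤-trans (ℕₚ.+-monoˡ-≤ _ (∃⇒0<# (_≟ᵛ 0ᵛ) 0∈Y refl))
      (#-disjoint-≤ (_≟ᵛ 0ᵛ) (large⁺? s) (large? s) Y (λ _ → inj₁) (λ _ (_ , p) → inj₂ p) (λ _ z (nz , _) → nz z))
    bound : ∀ e p q y z l → 1 + p ≤ q → l ≡ z + y → e * q + 2 * y ≤ 2 * l + e → e * p ≤ 2 * z
    bound e p q y z l p<q refl fr = lin≤ _ _ 0 (+-mono-≤ fr (*-monoʳ-≤ e p<q)) (eq e p q y z)
      where
      eq : ∀ e p q y z → e * p + (2 * (z + y) + e + e * q) + 0 ≡ 2 * z + (e * q + 2 * y + e * (1 + p))
      eq = solve-∀

  -- No fibre of `X` exceeds `M`, so these layers see it in full. Fibres of `S₂` may be seen only in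
  -- part, which is harmless because they are bounded from above.
  M = length X
  layers = List.upTo M

  nonzero-size : Vec ℚ n → ℕ
  nonzero-size y = ∑[ s ∈ layers ] [ large⁺? s y ]?

  size≤nonzero-size : ∀ y → y ≢ 0ᵛ → size y ≤ nonzero-size y
  size≤nonzero-size y nz = ≤-trans (#-below-≥ M (size y) (#≤length _ X))
    (∑-mono layers λ {s} _ → []?-mono (s ℕₚ.<? size y) (large⁺? s y) (nz ,_))

  length≤ : length X ≤ ∑ Y nonzero-size + size 0ᵛ
  length≤ = begin
    length X ≡⟨ sym (trans (∑-const X 1) (ℕₚ.*-identityʳ _)) ⟩
    ∑[ x ∈ X ] 1 ≤⟨ ∑-mono X counted ⟩
    ∑[ x ∈ X ] (# (fibre? x) Y + [ fun x ≟ᵛ 0ᵛ ]?) ≡⟨ ∑-+ X _ _ ⟩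
    ∑[ x ∈ X ] # (fibre? x) Y + size 0ᵛ ≡⟨ cong (_+ size 0ᵛ) (∑-swap X Y _) ⟩
    ∑[ y ∈ Y ] # (λ x → fibre? x y) X + size 0ᵛ ≤⟨ ℕₚ.+-monoˡ-≤ (size 0ᵛ) (∑-mono Y λ {y} _ → per-fibre y) ⟩
    ∑ Y nonzero-size + size 0ᵛ ∎
    where
    open ℕₚ.≤-Reasoning
    fibre? = λ x y → ¬? (y ≟ᵛ 0ᵛ) ×-dec (fun x ≟ᵛ y)
    counted : ∀ {x} → x ∈ X → 1 ≤ # (fibre? x) Y + [ fun x ≟ᵛ 0ᵛ ]?
    counted {x} x∈ with fun x ≟ᵛ 0ᵛ
    ... | yes _ = m≤n+m 1 _
    ... | no nz = ≤-trans (∃⇒0<# (fibre? x) (onto x∈) (nz , refl)) (m≤m+n _ 0)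
    per-fibre : ∀ y → # (λ x → fibre? x y) X ≤ nonzero-size y
    per-fibre y = by-cases (y ≟ᵛ 0ᵛ)
      where
      by-cases : Dec (y ≡ 0ᵛ) → # (λ x → fibre? x y) X ≤ nonzero-size y
      by-cases (no nz) = ≤-trans (#-mono (λ x → fibre? x y) (λ x → fun x ≟ᵛ y) X (λ _ → proj₂)) (size≤nonzero-size y nz)
      by-cases (yes z) = ≤-trans (∑-mono X λ {x} _ → ≤-reflexive ([]?-no (fibre? x y) (λ (nz , _) → nz z)))
        (≤-trans (≤-reflexive (trans (∑-const X 0) (ℕₚ.*-zeroʳ (length X)))) z≤n)

  ∑size′≤ : ∑ Z size′ ≤ length S₂
  ∑size′≤ = begin
    ∑ Z size′ ≡⟨ ∑-swap Z S₂ _ ⟩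
    ∑[ s ∈ S₂ ] # (fun s ≟ᵛ_) Z ≤⟨ ∑-mono S₂ (λ {s} _ → unique-#≤1 _≟ᵛ_ (fun s) Z!) ⟩
    ∑[ s ∈ S₂ ] 1 ≡⟨ trans (∑-const S₂ 1) (ℕₚ.*-identityʳ _) ⟩
    length S₂ ∎
    where open ℕₚ.≤-Reasoning

  outside-fibres : e * length X ≤ 2 * length S₂ + e * size 0ᵛ
  outside-fibres = begin
    e * length X ≤⟨ *-monoʳ-≤ e length≤ ⟩
    e * (∑ Y nonzero-size + size 0ᵛ) ≡⟨ ℕₚ.*-distribˡ-+ e (∑ Y nonzero-size) (size 0ᵛ) ⟩
    e * ∑ Y nonzero-size + e * size 0ᵛ ≡⟨ cong (λ s → e * s + e * size 0ᵛ) (∑-swap Y layers _) ⟩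
    e * ∑[ s ∈ layers ] # (large⁺? s) Y + e * size 0ᵛ ≡⟨ cong (_+ e * size 0ᵛ) (sym (∑-*ˡ layers e _)) ⟩
    ∑[ s ∈ layers ] (e * # (large⁺? s) Y) + e * size 0ᵛ ≤⟨ ℕₚ.+-monoˡ-≤ (e * size 0ᵛ) (∑-mono layers λ {s} _ → layer s) ⟩
    ∑[ s ∈ layers ] (2 * # (λ z → s ℕₚ.<? size′ z) Z) + e * size 0ᵛ ≡⟨ cong (_+ e * size 0ᵛ) (∑-*ˡ layers 2 _) ⟩
    2 * ∑[ s ∈ layers ] # (λ z → s ℕₚ.<? size′ z) Z + e * size 0ᵛ ≡⟨ cong (λ s → 2 * s + e * size 0ᵛ) (∑-swap layers Z _) ⟩
    2 * ∑[ z ∈ Z ] # (ℕₚ._<? size′ z) layers + e * size 0ᵛ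
      ≤⟨ ℕₚ.+-monoˡ-≤ (e * size 0ᵛ) (*-monoʳ-≤ 2 (≤-trans (∑-mono Z λ {z} _ → #-below M (size′ z)) ∑size′≤)) ⟩
    2 * length S₂ + e * size 0ᵛ ∎
    where open ℕₚ.≤-Reasoning

length-cartesianProduct : (xs : List A) (ys : List B) → length (List.cartesianProduct xs ys) ≡ length xs * length ys
length-cartesianProduct [] ys = refl
length-cartesianProduct (x ∷ xs) ys =
  trans (Listₚ.length-++ (map (x ,_) ys)) (cong₂ _+_ (Listₚ.length-map (x ,_) ys) (length-cartesianProduct xs ys))

∈-take : (i : ℕ) {xs : List A} {x : A} → x ∈ take i xs → x ∈ xs
∈-take i {xs} {x} x∈ = subst (x ∈_) (Listₚ.take++drop≡id i xs) (∈ₚ.∈-++⁺ˡ x∈)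

chain-end : ∀ g d k s → 2 * (suc g * k) + d * (g * k) ≤ 2 * suc g * s → suc d * (g * k) ≤ 2 * suc g * s
chain-end g d k s gain = lin≤ _ _ (2 * k + g * k) gain (eq g d k s)
  where
  eq : ∀ g d k s → suc d * (g * k) + 2 * suc g * s + (2 * k + g * k) ≡ 2 * suc g * s + (2 * (suc g * k) + d * (g * k))
  eq = solve-∀

-- `(d + 1) G` disjoint translates of at least `k / G` elements each make `(d + 1) k` sums, more
-- than twice what is wanted.
many-fibres : ∀ g d k a s → k ≤ suc g * a → suc d * suc g * a ≤ s → suc d * (g * k) ≤ 2 * suc g * s
many-fibres g d k a s k≤ N≤ =
  lin≤ _ _ (g * s + 2 * s) (+-mono-≤ (*-monoʳ-≤ (suc d * g) k≤) (*-monoʳ-≤ g N≤)) (eq g d k a s)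
  where
  eq : ∀ g d k a s → suc d * (g * k) + (suc d * g * (suc g * a) + g * s) + (g * s + 2 * s)
       ≡ 2 * suc g * s + (suc d * g * k + g * (suc d * suc g * a))
  eq = solve-∀

-- `length-T` adds up to `d + 1` translates from the chain and up to `(d + 1) (g + 1)` coset
-- representatives. `many` speaks of any list `S` containing the sums, so that `S` can be split or
-- transported.
record ManySums {n : ℕ} (X : List (Vec ℚ n)) (d g : ℕ) : Set where
  field
    T : List (Vec ℚ n)
    T⊆X : ∀ {t} → t ∈ T → t ∈ X
    length-T : length T ≤ suc d * suc (suc g)
    many : ∀ S → Covers T X S → suc d * (g * length X) ≤ 2 * suc g * length S

module _ {n : ℕ} (X : List (Vec ℚ n)) (X! : Unique X) (0∈X : 0ᵛ ∈ X)
         (d : ℕ) (rank : LinearRank≥ d X) (g : ℕ) (g<k : suc g ≤ length X) where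
  open Translates X X! 0∈X d rank g g<k

  heavy-kernel : ∀ {h e} → h + e ≡ d → (C : Chain h e) → k ≤ G * zeros (Chain.π C) → ManySums X d g
  heavy-kernel {h} {e} h+e≡d C k≤ with transversal _≟ᵛ_ (Projection.fun (Chain.π C)) X
  ... | tr , tr! , tr⊆X , onto = by-cases (suc d * G ≤? length tr)
    where
    open Chain C
    open Projection π
    by-cases : Dec (suc d * G ≤ length tr) → ManySums X d g
    by-cases (yes N≤) = record
      { T = take N tr
      ; T⊆X = tr⊆X ∘ ∈-take N
      ; length-T = ≤-trans (≤-reflexive length-take) (*-monoʳ-≤ (suc d) (ℕₚ.n≤1+n G))
      ; many = λ S cover → many-fibres g d k (zeros π) (length S) k≤ (≤-trans (≤-reflexive (sym length-pairs))
          (unique-inj-length (λ (t , x) → t ⊞ x)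
            (Uniqueₚ.cartesianProduct⁺ (Uniqueₚ.take⁺ N (Uniqueₚ.map⁻ tr!)) (Uniqueₚ.filter⁺ zero? X!))
            injective λ p∈ → let t∈ , x∈ = ∈ₚ.∈-cartesianProduct⁻ (take N tr) X₀ p∈ in cover t∈ (proj₁ (∈ₚ.∈-filter⁻ zero? {xs = X} x∈)))) }
      where
      N = suc d * G
      zero? = λ x → fun x ≟ᵛ 0ᵛ
      X₀ = filter zero? X
      length-take : length (take N tr) ≡ N
      length-take = trans (Listₚ.length-take N tr) (ℕₚ.m≤n⇒m⊓n≡m N≤)
      length-pairs : length (List.cartesianProduct (take N tr) X₀) ≡ N * zeros π
      length-pairs = trans (length-cartesianProduct (take N tr) X₀) (cong₂ _*_ length-take (length-filter≡# zero? X))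
      image : ∀ {t x} → x ∈ X₀ → fun (t ⊞ x) ≡ fun t
      image {t} {x} x∈ = trans (fun-⊞ t x)
        (trans (cong (fun t ⊞_) (proj₂ (∈ₚ.∈-filter⁻ zero? {xs = X} x∈))) (⊞-identityʳ (fun t)))
      injective : ∀ {p q} → p ∈ List.cartesianProduct (take N tr) X₀ → q ∈ List.cartesianProduct (take N tr) X₀ →
                  proj₁ p ⊞ proj₂ p ≡ proj₁ q ⊞ proj₂ q → p ≡ q
      injective {t , x} {u , y} p∈ q∈ eq
        with t∈ , x∈ ← ∈ₚ.∈-cartesianProduct⁻ (take N tr) X₀ p∈
        with u∈ , y∈ ← ∈ₚ.∈-cartesianProduct⁻ (take N tr) X₀ q∈
        with refl ← unique-map-injective tr! (∈-take N t∈) (∈-take N u∈) (trans (sym (image x∈)) (trans (cong fun eq) (image y∈))) =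
        cong (t ,_) (⊞-cancelˡ t eq)
    -- Since the chain's `T` lies in the kernel, its translates of `X` stay over the cosets met by
    -- `X`. The sums counted by `outside-fibres` avoid these cosets, so the two gains add up.
    by-cases (no N≰) = record
      { T = T ++ tr
      ; T⊆X = λ t∈ → [ T⊆X , tr⊆X ]′ (∈ₚ.∈-++⁻ T t∈)
      ; length-T = ≤-trans (≤-reflexive (Listₚ.length-++ T)) (≤-trans
          (+-mono-≤ (≤-trans length-T (s≤s (≤-trans (m≤m+n h e) (≤-reflexive h+e≡d)))) (ℕₚ.<⇒≤ (≰⇒> N≰)))
          (≤-reflexive (sym (ℕₚ.*-suc (suc d) G))))
      ; many = λ S cover → let module F = Fibres π X X! 0∈X e d rank codim tr tr! onto tr⊆X S (cover ∘ ∈ₚ.∈-++⁺ʳ T) in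
          subst₂ (λ d s → suc d * (g * k) ≤ 2 * G * s) h+e≡d (sym (length-filter-split F.inY? S))
            (chain-finish g h e k (zeros π) (length F.S₁) (length F.S₂)
              (gain F.S₁ λ {t} {x} t∈ x∈ → ∈ₚ.∈-filter⁺ F.inY? (cover (∈ₚ.∈-++⁺ˡ t∈) x∈)
                (subst (_∈ F.Y) (sym (trans (fun-⊞ t x) (trans (cong (_⊞ fun x) (T-kernel t∈)) (⊞-identityˡ (fun x))))) (onto x∈)))
              F.outside-fibres heavy) }
      where
      codim : e + length hs ≡ d
      codim = trans (cong (e +_) length-hs) (trans (ℕₚ.+-comm e h) h+e≡d)

  grow : ∀ e {h} → h + e ≡ d → Chain h e → ManySums X d g
  grow e {h} h+e≡d C with G * zeros (Chain.π C) ≤? k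
  ... | no heavy = heavy-kernel h+e≡d C (ℕₚ.<⇒≤ (≰⇒> heavy))
  grow (suc e) {h} h+e≡d C | yes light = grow e (trans (sym (ℕₚ.+-suc h e)) h+e≡d) (step h+e≡d C light)
  grow zero {h} h+e≡d C | yes light = record
    { T = T
    ; T⊆X = T⊆X
    ; length-T = ≤-trans length-T (≤-trans (s≤s (≤-reflexive h≡d)) (ℕₚ.m≤m*n (suc d) (suc G)))
    ; many = λ S cover → chain-end g d k (length S) (subst (λ h → 2 * (G * k) + h * (g * k) ≤ 2 * G * length S) h≡d (gain S cover)) }
    where
    open Chain C
    h≡d : h ≡ d
    h≡d = trans (sym (ℕₚ.+-identityʳ h)) h+e≡d

  abstract
    many-sums : ManySums X d g
    many-sums = grow d refl start

-- Freiman isomorphisms to ℤ^D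

unique-map : (f : A → B) {xs : List A} → Unique xs → (∀ {x y} → x ∈ xs → y ∈ xs → f x ≡ f y → x ≡ y) → Unique (map f xs)
unique-map f [] _ = []
unique-map f (x∉ ∷ u) inj =
  Allₚ.map⁺ (All.tabulate λ y∈ eq → All.lookup x∉ y∈ (inj (here refl) (there y∈) eq))
  ∷ unique-map f u (λ x∈ y∈ → inj (there x∈) (there y∈))

preimages : (f : A → B) (xs : List A) (ys : List B) → (∀ {y} → y ∈ ys → y ∈ map f xs) →
            ∃ λ zs → map f zs ≡ ys × (∀ {z} → z ∈ zs → z ∈ xs)
preimages f xs [] _ = [] , refl , λ ()
preimages f xs (y ∷ ys) h with x , x∈ , refl ← ∈ₚ.∈-map⁻ f (h (here refl))
                          with zs , refl , sub ← preimages f xs ys (h ∘ there) =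
  x ∷ zs , refl , λ { (here refl) → x∈ ; (there i) → sub i }

-- One representative is kept for each value of `f`; `h` is well defined on these values, so its
-- values are no more numerous. In the application `f` and `h` are addition before and after a
-- Freiman homomorphism.
transport : (_≟_ : (x y : B) → Dec (x ≡ y)) (f : A → B) (h : A → C) (L : List A) →
            (∀ {a b} → a ∈ L → b ∈ L → f a ≡ f b → h a ≡ h b) → (S : List B) → (∀ {a} → a ∈ L → f a ∈ S) →
            ∃ λ S′ → length S′ ≤ length S × (∀ {a} → a ∈ L → h a ∈ S′)
transport _≟_ f h L f⇒h S cover with ts , ts! , sub , onto ← transversal _≟_ f L =
  map h ts
  , ≤-trans (≤-reflexive (trans (Listₚ.length-map h ts) (sym (Listₚ.length-map f ts))))
      (unique-⊆-length ts! λ b∈ → let t , t∈ , eq = ∈ₚ.∈-map⁻ f b∈ in subst (_∈ S) (sym eq) (cover (sub t∈)))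
  , λ a∈ → let t , t∈ , eq = ∈ₚ.∈-map⁻ f (onto a∈) in subst (_∈ map h ts) (sym (f⇒h a∈ (sub t∈) eq)) (∈ₚ.∈-map⁺ h t∈)

ι : ℤ → ℚ
ι i = i ℚ./ 1

ι-injective : ∀ {i j} → ι i ≡ ι j → i ≡ j
ι-injective {i} {j} eq with ℚᵘ.*≡* eq′ ← ℚₚ.fromℚᵘ-injective {mkℚᵘ i 0} {mkℚᵘ j 0} eq =
  trans (sym (ℤₚ.*-identityʳ i)) (trans eq′ (ℤₚ.*-identityʳ j))

ι-+ : ∀ i j → ι (i ℤ.+ j) ≡ ι i ℚ.+ ι j
ι-+ i j = ℚₚ.toℚᵘ-injective (begin
  ℚ.toℚᵘ (ι (i ℤ.+ j)) ≈⟨ ℚₚ.toℚᵘ-fromℚᵘ (mkℚᵘ (i ℤ.+ j) 0) ⟩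
  mkℚᵘ (i ℤ.+ j) 0 ≈⟨ ℚᵘ.*≡* (cong (ℤ._* ℤ.1ℤ) (cong₂ ℤ._+_ (sym (ℤₚ.*-identityʳ i)) (sym (ℤₚ.*-identityʳ j)))) ⟩
  mkℚᵘ i 0 ℚᵘ.+ mkℚᵘ j 0 ≈⟨ ℚᵘₚ.+-cong (ℚₚ.toℚᵘ-fromℚᵘ (mkℚᵘ i 0)) (ℚₚ.toℚᵘ-fromℚᵘ (mkℚᵘ j 0)) ⟨
  ℚ.toℚᵘ (ι i) ℚᵘ.+ ℚ.toℚᵘ (ι j) ≈⟨ ℚₚ.toℚᵘ-homo-+ (ι i) (ι j) ⟨
  ℚ.toℚᵘ (ι i ℚ.+ ι j) ∎)
  where open ℚᵘₚ.≃-Reasoning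

lookup-split : (u v : Vec ℚ n) (c : Fin n) → Vec.lookup u c ≡ Vec.lookup v c ℚ.+ Vec.lookup (u ⊟ v) c
lookup-split (a ∷ u) (b ∷ v) Fin.zero = solve 2 (λ a b → a := b :+ (a :- b)) refl a b where open QS
lookup-split (a ∷ u) (b ∷ v) (Fin.suc c) = lookup-split u v c

InSpan-coefficients : (ts : List (Vec ℚ n)) {x : Vec ℚ n} → InSpan ts x →
                      Σ (Fin (length ts) → ℚ) λ t → ∀ c →
                        Vec.lookup x c ≡ sumℚ (λ j → t j ℚ.* Vec.lookup (List.lookup ts j) c)
InSpan-coefficients [] refl = (λ ()) , λ c → Vecₚ.lookup-replicate c 0ℚ
InSpan-coefficients (s ∷ ts) {x} (q , px) with t , eq ← InSpan-coefficients ts px =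
  (λ { Fin.zero → q ; (Fin.suc j) → t j }) , λ c → trans (lookup-split x (q ⊡ s) c)
    (cong₂ ℚ._+_ (Vecₚ.lookup-map c (q ℚ.*_) s) (eq c))

record ManySumsℤₙ {N : ℕ} (xs : List (Fin N)) (d g : ℕ) : Set where
  field
    T : List (Fin N)
    T⊆xs : ∀ {t} → t ∈ T → t ∈ xs
    length-T : length T ≤ suc d * suc (suc g)
    many : ∀ S → (∀ {t x} → t ∈ T → x ∈ xs → t ⊕ x ∈ S) → suc d * (g * length xs) ≤ 2 * suc g * length S

many-sums-ℤₙ : {N : ℕ} (X : Subset N) (xs : List (Fin N)) → Unique xs → (∀ {x} → x ∈ xs → x Sub.∈ X) →
               (∀ {x} → x Sub.∈ X → x ∈ xs) → (d g : ℕ) → suc g ≤ length xs → DimF≥ X d → ManySumsℤₙ xs d g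
many-sums-ℤₙ {N} X xs@(x₀ ∷ _) xs! toX fromX d g g<k (D , d≤D , φ , (φ-inj , φ-hom , φ-hom⁻) , full) = record
  { T = proj₁ T-pre
  ; T⊆xs = proj₂ (proj₂ T-pre)
  ; length-T = ≤-trans (≤-reflexive (trans (sym (Listₚ.length-map point (proj₁ T-pre))) (cong length (proj₁ (proj₂ T-pre))))) M.length-T
  ; many = many }
  where
  vec : Fin N → Vec ℚ D
  vec x = Vec.tabulate (ι ∘ φ x)

  -- The translation by `vec x₀` puts 0 into the set, which turns full affine rank into linear rank.
  point : Fin N → Vec ℚ D
  point x = vec x ⊟ vec x₀

  vec-sum : ∀ a b c → Vec.lookup (vec a ⊞ vec b) c ≡ ι (φ a c ℤ.+ φ b c)
  vec-sum a b c = trans (Vecₚ.lookup-zipWith ℚ._+_ c (vec a) (vec b))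
    (trans (cong₂ ℚ._+_ (Vecₚ.lookup∘tabulate (ι ∘ φ a) c) (Vecₚ.lookup∘tabulate (ι ∘ φ b) c)) (sym (ι-+ (φ a c) (φ b c))))

  point-injective : ∀ {x y} → x ∈ xs → y ∈ xs → point x ≡ point y → x ≡ y
  point-injective {x} {y} x∈ y∈ eq = φ-inj (toX x∈) (toX y∈) λ c → ι-injective (begin
    ι (φ x c) ≡⟨ sym (Vecₚ.lookup∘tabulate (ι ∘ φ x) c) ⟩
    Vec.lookup (vec x) c ≡⟨ cong (λ v → Vec.lookup v c) vec≡ ⟩
    Vec.lookup (vec y) c ≡⟨ Vecₚ.lookup∘tabulate (ι ∘ φ y) c ⟩
    ι (φ y c) ∎)
    where
    open ≡-Reasoning
    vec≡ : vec x ≡ vec y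
    vec≡ = trans (sym (⊟-⊞ (vec x) (vec x₀))) (trans (cong (_⊞ vec x₀) eq) (⊟-⊞ (vec y) (vec x₀)))

  point-sum : ∀ {a b a′ b′} → a ∈ xs → b ∈ xs → a′ ∈ xs → b′ ∈ xs → a ⊕ b ≡ a′ ⊕ b′ → point a ⊞ point b ≡ point a′ ⊞ point b′
  point-sum {a} {b} {a′} {b′} a∈ b∈ a′∈ b′∈ eq =
    trans (⊟-⊞-⊟ (vec a) (vec b) (vec x₀)) (trans (cong (λ v → v ⊟ vec x₀ ⊟ vec x₀) sum≡) (sym (⊟-⊞-⊟ (vec a′) (vec b′) (vec x₀))))
    where
    sum≡ : vec a ⊞ vec b ≡ vec a′ ⊞ vec b′
    sum≡ = trans (sym (Vecₚ.tabulate∘lookup (vec a ⊞ vec b)))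
      (trans (Vecₚ.tabulate-cong λ c → trans (vec-sum a b c)
          (trans (cong ι (φ-hom (toX a∈) (toX a′∈) (toX b∈) (toX b′∈) eq c)) (sym (vec-sum a′ b′ c))))
        (Vecₚ.tabulate∘lookup (vec a′ ⊞ vec b′)))

  points = map point xs

  0∈points : 0ᵛ ∈ points
  0∈points = here (sym (⊟-self (vec x₀)))

  rank : LinearRank≥ d points
  rank ts short spanned = full (length ts) (<-≤-trans short d≤D)
    ( Vec.lookup (vec x₀) , (λ j → Vec.lookup (List.lookup ts j))
    , λ s (x , x∈ , s≡) → let t , eq = InSpan-coefficients ts (spanned (∈ₚ.∈-map⁺ point (fromX x∈))) in
        t , λ c → trans (s≡ c) (trans (sym (Vecₚ.lookup∘tabulate (ι ∘ φ x) c))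
          (trans (lookup-split (vec x) (vec x₀) c) (cong (Vec.lookup (vec x₀) c ℚ.+_) (eq c)))) )

  M = many-sums points (unique-map point xs! point-injective) 0∈points d rank g
        (≤-trans g<k (≤-reflexive (sym (Listₚ.length-map point xs))))
  module M = ManySums M

  T-pre = preimages point xs M.T M.T⊆X

  many : ∀ S → (∀ {t x} → t ∈ proj₁ T-pre → x ∈ xs → t ⊕ x ∈ S) → suc d * (g * length xs) ≤ 2 * suc g * length S
  many S cover with T , T≡ , T⊆ ← T-pre
    with S′ , S′≤ , cover′ ← transport Fin._≟_ (λ (t , x) → t ⊕ x) (λ (t , x) → point t ⊞ point x) (List.cartesianProduct T xs)
           (λ p∈ q∈ → let t∈ , x∈ = ∈ₚ.∈-cartesianProduct⁻ T xs p∈ ; u∈ , y∈ = ∈ₚ.∈-cartesianProduct⁻ T xs q∈ in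
             point-sum (T⊆ t∈) x∈ (T⊆ u∈) y∈)
           S (λ p∈ → let t∈ , x∈ = ∈ₚ.∈-cartesianProduct⁻ T xs p∈ in cover t∈ x∈) =
    ≤-trans (≤-reflexive (cong (λ k → suc d * (g * k)) (sym (Listₚ.length-map point xs))))
      (≤-trans (M.many S′ covers) (*-monoʳ-≤ (2 * suc g) S′≤))
    where
    covers : Covers M.T points S′
    covers t∈ x∈ with t , t∈T , refl ← ∈ₚ.∈-map⁻ point (subst (_ ∈_) (sym T≡) t∈)
                 with x , x∈xs , refl ← ∈ₚ.∈-map⁻ point x∈ = cover′ (∈ₚ.∈-cartesianProduct⁺ t∈T x∈xs)

-- Hitting sets

average : (xs : List A) (f : A → ℕ) (M : ℕ) → 0 < M → M ≤ ∑ xs f → ∃ λ x → x ∈ xs × M ≤ f x * length xs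
average [] f M 0<M M≤ = ⊥-elim (<-irrefl refl (<-≤-trans 0<M M≤))
average xs@(_ ∷ _) f M _ M≤
  with x , x∈ , max ← maximal (λ x y → f x ≤ f y) ≤-refl ≤-trans (λ x y → ℕₚ.≤-total (f x) (f y)) {xs = xs} (here refl) =
  x , x∈ , ≤-trans M≤ (≤-trans (∑-mono xs max) (≤-reflexive (trans (∑-const xs (f x)) (ℕₚ.*-comm (length xs) (f x)))))

-- Greedily add the element that is useful for most of the sets N z that still have fewer than c elements
-- in L; each step reduces the total deficit by a fixed amount as long as these sets are not rare.
module Greedy (_≟_ : (x y : A) → Dec (x ≡ y)) (xs : List A) (zs : List B)
              {N : B → A → Set} (N? : ∀ z x → Dec (N z x)) (r c w b : ℕ) (0<w : 0 < w) (c+w≤r : c + w ≤ suc r)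
              (N-large : ∀ {z} → z ∈ zs → r ≤ # (N? z) xs) where

  k = length xs

  hit? : ∀ L z x → Dec (x ∈ L × N z x)
  hit? L z x = DecMembership._∈?_ _≟_ x L ×-dec N? z x

  hits : List A → B → ℕ
  hits L z = # (hit? L z) xs

  low? : ∀ L z → Dec (hits L z < c)
  low? L z = hits L z ℕₚ.<? c

  deficit : List A → ℕ
  deficit L = ∑[ z ∈ zs ] (c ∸ hits L z)

  record HittingSet : Set where
    field
      L : List A
      L⊆xs : ∀ {x} → x ∈ L → x ∈ xs
      rare : b * # (low? L) zs ≤ length zs
      short : length L * w ≤ b * k * c

  hits-∷ : ∀ {L x z} → x ∈ xs → x ∉ L → N z x → suc (hits L z) ≤ hits (x ∷ L) z
  hits-∷ {L} {x} {z} x∈ x∉ Nzx = ≤-trans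
    (≤-trans (≤-reflexive (ℕₚ.+-comm 1 (hits L z))) (ℕₚ.+-monoʳ-≤ (hits L z) (∃⇒0<# (λ y → (y ≟ x) ×-dec N? z y) x∈ (refl , Nzx))))
    (#-disjoint-≤ (hit? L z) (λ y → (y ≟ x) ×-dec N? z y) (hit? (x ∷ L) z) xs
      (λ _ (i , p) → there i , p) (λ _ (eq , p) → here eq , p) (λ { _ (i , _) (refl , _) → x∉ i }))

  hits-mono : ∀ {L x z} → hits L z ≤ hits (x ∷ L) z
  hits-mono {L} {x} {z} = #-mono (hit? L z) (hit? (x ∷ L) z) xs λ _ (i , p) → there i , p

  useful? : ∀ L z x → Dec (hits L z < c × (x ∉ L × N z x))
  useful? L z x = low? L z ×-dec (¬? (DecMembership._∈?_ _≟_ x L) ×-dec N? z x)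

  -- A set with fewer than `c` hits has at least `r + 1 - c ≥ w` elements outside `L`. The resulting
  -- pairs are counted by sets and then by elements.
  many-useful : ∀ L → # (low? L) zs * w ≤ ∑[ x ∈ xs ] # (λ z → useful? L z x) zs
  many-useful L = ≤-trans (≤-reflexive (trans (ℕₚ.*-comm (# (low? L) zs) w) (sym (∑-*ˡ zs w _))))
    (≤-trans (∑-mono zs per-set) (≤-reflexive (∑-swap zs xs _)))
    where
    missing? : ∀ z x → Dec (x ∉ L × N z x)
    missing? z x = ¬? (DecMembership._∈?_ _≟_ x L) ×-dec N? z x
    per-set : ∀ {z} → z ∈ zs → w * [ low? L z ]? ≤ # (useful? L z) xs
    per-set {z} z∈ with low? L z
    ... | no _ = ≤-trans (≤-reflexive (ℕₚ.*-zeroʳ w)) z≤n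
    ... | yes low = ≤-trans (lin≤ _ _ 0 (+-mono-≤ c+w≤r (+-mono-≤ (N-large z∈) (+-mono-≤ low split)))
            (eq w c r (hits L z) (# (missing? z) xs) (# (N? z) xs)))
            (#-mono (missing? z) (λ x → yes low ×-dec missing? z x) xs λ _ p → low , p)
      where
      split : # (N? z) xs ≤ hits L z + # (missing? z) xs
      split = #-cover-≤ (hit? L z) (missing? z) (N? z) xs λ {x} _ p → case DecMembership._∈?_ _≟_ x L of λ
        { (yes i) → inj₁ (i , p) ; (no i) → inj₂ (i , p) }
      eq : ∀ w c r h m v → w * 1 + (suc r + (v + (c + (h + m)))) + 0 ≡ m + (c + w + (r + (suc h + v)))
      eq = solve-∀

  deficit-drops : ∀ {L x} → x ∈ xs → x ∉ L → deficit (x ∷ L) + # (λ z → useful? L z x) zs ≤ deficit L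
  deficit-drops {L} {x} x∈ x∉ = ≤-trans (≤-reflexive (sym (∑-+ zs _ _))) (∑-mono zs per-set)
    where
    per-set : ∀ {z} → z ∈ zs → c ∸ hits (x ∷ L) z + [ useful? L z x ]? ≤ c ∸ hits L z
    per-set {z} _ with useful? L z x
    ... | no _ = ≤-trans (≤-reflexive (ℕₚ.+-identityʳ _)) (ℕₚ.∸-monoʳ-≤ c (hits-mono {L} {x} {z}))
    ... | yes (low , _ , Nzx) = ≤-trans (ℕₚ.+-monoˡ-≤ 1 (ℕₚ.∸-monoʳ-≤ c (hits-∷ x∈ x∉ Nzx)))
            (≤-reflexive (trans (ℕₚ.+-comm _ 1) (sym (ℕₚ.+-∸-assoc 1 low))))

  -- While low sets are not rare, the best element lowers `b k` times the deficit by at least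
  -- `|zs| w`. Charging that amount to each chosen element bounds their number by `b k c / w`.
  invariant-step : ∀ bk Z w l Δ Δ′ u lw → bk * Δ + l * Z * w ≤ bk * c * Z → Δ′ + u ≤ Δ → lw ≤ bk * u → Z * w ≤ lw →
                   bk * Δ′ + suc l * Z * w ≤ bk * c * Z
  invariant-step bk Z w l Δ Δ′ u lw inv drop large many = lin≤ _ _ 0
    (+-mono-≤ inv (+-mono-≤ (*-monoʳ-≤ bk drop) (+-mono-≤ large many))) (eq bk Z w l Δ Δ′ u lw (bk * c * Z))
    where
    eq : ∀ bk Z w l Δ Δ′ u lw R → bk * Δ′ + suc l * Z * w + (R + (bk * Δ + (bk * u + lw))) + 0
         ≡ R + (bk * Δ + l * Z * w + (bk * (Δ′ + u) + (lw + Z * w)))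
    eq = solve-∀

  search : ∀ fuel L → (∀ {x} → x ∈ L → x ∈ xs) → deficit L < fuel →
           b * k * deficit L + length L * length zs * w ≤ b * k * c * length zs → 0 < length zs → HittingSet
  search (suc fuel) L L⊆xs (s≤s Δ≤) inv 0<zs with b * # (low? L) zs ≤? length zs
  ... | yes rare = record { L = L ; L⊆xs = L⊆xs ; rare = rare ; short = ℕₚ.*-cancelʳ-≤ _ _ (length zs) {{ℕ.>-nonZero 0<zs}}
          (≤-trans (≤-trans (≤-reflexive (commute (length L) w (length zs))) (m≤n+m _ (b * k * deficit L))) inv) }
    where
    commute : ∀ l w z → l * w * z ≡ l * z * w
    commute = solve-∀
  ... | no often = search fuel (x ∷ L) (λ { (here refl) → x∈ ; (there i) → L⊆xs i })
          (≤-trans (s≤s ≤-refl) (≤-trans (≤-trans (≤-reflexive (ℕₚ.+-comm 1 _)) (ℕₚ.+-monoʳ-≤ (deficit (x ∷ L)) 0<u))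
            (≤-trans drop Δ≤)))
          (invariant-step (b * k) (length zs) w (length L) (deficit L) (deficit (x ∷ L)) u (b * (low * w)) inv drop
            (≤-trans (*-monoʳ-≤ b low*w≤) (≤-reflexive (commute b u k)))
            (≤-trans (*-monoˡ-≤ w (ℕₚ.<⇒≤ (≰⇒> often))) (≤-reflexive (ℕₚ.*-assoc b low w)))) 0<zs
    where
    low = # (low? L) zs
    0<low : 0 < low
    0<low = positive b low (≤-trans 0<zs (ℕₚ.<⇒≤ (≰⇒> often)))
      where
      positive : ∀ b l → 0 < b * l → 0 < l
      positive b zero p = ⊥-elim (<-irrefl refl (≤-trans p (≤-reflexive (ℕₚ.*-zeroʳ b))))
      positive b (suc l) p = s≤s z≤n
    0<low*w : 0 < low * w
    0<low*w = *-mono-≤ 0<low 0<w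
    found = average xs (λ x → # (λ z → useful? L z x) zs) (low * w) 0<low*w (many-useful L)
    x = proj₁ found
    x∈ = proj₁ (proj₂ found)
    u = # (λ z → useful? L z x) zs
    low*w≤ : low * w ≤ u * k
    low*w≤ = proj₂ (proj₂ found)
    0<u : 0 < u
    0<u = positive u k (≤-trans 0<low*w low*w≤)
      where
      positive : ∀ u k → 0 < u * k → 0 < u
      positive (suc u) k p = s≤s z≤n
    x∉ : x ∉ L
    x∉ = proj₁ (proj₂ (proj₂ (proj₂ (0<#⇒∃ (λ z → useful? L z x) zs 0<u))))
    drop : deficit (x ∷ L) + u ≤ deficit L
    drop = deficit-drops x∈ x∉
    commute : ∀ b u k → b * (u * k) ≡ b * k * u
    commute = solve-∀

  abstract
    hitting-set : HittingSet
    hitting-set with 0 ℕₚ.<? length zs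
    ... | yes 0<zs = search (suc (deficit [])) [] (λ ()) ≤-refl
            (≤-trans (≤-reflexive (ℕₚ.+-identityʳ _)) (≤-trans (*-monoʳ-≤ (b * k) deficit≤) (≤-reflexive (commute (b * k) c (length zs))))) 0<zs
      where
      deficit≤ : deficit [] ≤ length zs * c
      deficit≤ = ≤-trans (∑-mono zs λ {z} _ → ℕₚ.m∸n≤m c (hits [] z)) (≤-reflexive (∑-const zs c))
      commute : ∀ bk c z → bk * (z * c) ≡ bk * c * z
      commute = solve-∀
    ... | no 0≮ = record { L = [] ; L⊆xs = λ () ; short = z≤n ; rare =
            ≤-trans (≤-reflexive (trans (cong (b *_) (ℕₚ.n≤0⇒n≡0 (≤-trans (#≤length (low? []) zs) (≮⇒≥ 0≮)))) (ℕₚ.*-zeroʳ b))) z≤n }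

#-filter-≤ : {P Q : A → Set} (P? : Decidable P) (Q? : Decidable Q) (xs : List A) → # P? (filter Q? xs) ≤ # P? xs
#-filter-≤ P? Q? [] = z≤n
#-filter-≤ P? Q? (x ∷ xs) with Q? x
... | yes _ = ℕₚ.+-monoʳ-≤ [ P? x ]? (#-filter-≤ P? Q? xs)
... | no _ = ≤-trans (#-filter-≤ P? Q? xs) (m≤n+m _ _)

-- Every z has c * c representations. A first hitting set contains c elements of most of these, and a
-- second one then completes one of these to a full representation; both have size O (length xs / c).
module SumHitting (_≟_ : (x y : A) → Dec (x ≡ y)) (_≟′_ : (x y : B) → Dec (x ≡ y)) (_∙_ : A → A → B)
                  (comm : ∀ x y → x ∙ y ≡ y ∙ x) (xs : List A) (xs! : Unique xs)
                  (cancel : ∀ {x y y′} → x ∈ xs → y ∈ xs → y′ ∈ xs → x ∙ y ≡ x ∙ y′ → y ≡ y′) where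

  Rep : B → A → A → Set
  Rep z x y = x ≢ y × x ∙ y ≡ z

  rep? : ∀ z x y → Dec (Rep z x y)
  rep? z x y = ¬? (x ≟ y) ×-dec ((x ∙ y) ≟′ z)

  summand? : ∀ (L : List A) z x → Dec (Any (Rep z x) L)
  summand? L z x = Any.any? (rep? z x) L

  Covered : List A → B → Set
  Covered F z = Any (λ x → Any (Rep z x) F) F

  covered? : ∀ F z → Dec (Covered F z)
  covered? F z = Any.any? (summand? F z) F

  module _ (zs : List B) (c₀ b : ℕ) (popular : ∀ {z} → z ∈ zs → suc c₀ * suc c₀ ≤ # (summand? xs z) xs) where
    k = length xs
    c = suc c₀

    record SumHittingSet : Set where
      field
        F : List A
        F⊆xs : ∀ {x} → x ∈ F → x ∈ xs
        short : length F * c ≤ 3 * (b * k)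
        covered : b * length zs ≤ b * # (covered? F) zs + 2 * length zs

    abstract
      square : ∀ c → suc c + suc (c * c + c) ≤ suc (suc c * suc c)
      square c = ≤-reflexive (eq c)
        where
        eq : ∀ c → suc c + suc (c * c + c) ≡ suc (suc c * suc c)
        eq = solve-∀

    -- The value of `w` is `c² - c + 1`, the number of summands certainly left outside the list when
    -- fewer than `c` of the `c²` are inside. As `2 w ≥ c²`, the list has at most `2 b k / c`
    -- elements.
    module G₁ = Greedy _≟_ xs zs (summand? xs) (c * c) c (suc (c₀ * c₀ + c₀)) b (s≤s z≤n) (square c₀) popular
    open G₁.HittingSet G₁.hitting-set renaming (L to L₁; L⊆xs to L₁⊆xs; rare to rare₁; short to short₁)

    high? = λ z → ¬? (G₁.low? L₁ z)
    zs₂ = filter high? zs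

    partner? : ∀ z y → Dec (Any (λ x → Rep z x y) L₁)
    partner? z y = Any.any? (λ x → rep? z x y) L₁

    partners : ∀ {z} → z ∈ zs₂ → c ≤ # (partner? z) xs
    partners {z} z∈ = ≤-trans (≮⇒≥ (proj₂ (∈ₚ.∈-filter⁻ high? {xs = zs} z∈)))
      (subst₂ _≤_ (length-filter≡# (G₁.hit? L₁ z) xs) (length-filter≡# (partner? z) xs)
        (unique-rel-length (λ x y → y ∈ xs × Rep z x y) (Uniqueₚ.filter⁺ (G₁.hit? L₁ z) xs!)
          (λ x∈ x′∈ (y∈ , _ , eq) (_ , _ , eq′) → cancel y∈
            (proj₁ (∈ₚ.∈-filter⁻ (G₁.hit? L₁ z) {xs = xs} x∈)) (proj₁ (∈ₚ.∈-filter⁻ (G₁.hit? L₁ z) {xs = xs} x′∈))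
            (trans (comm _ _) (trans eq (trans (sym eq′) (comm _ _)))))
          λ {x} x∈ → let _ , x∈L₁ , has = ∈ₚ.∈-filter⁻ (G₁.hit? L₁ z) {xs = xs} x∈ ; y , y∈ , rep = find has in
            y , ∈ₚ.∈-filter⁺ (partner? z) y∈ (lose x∈L₁ rep) , y∈ , rep))

    -- Distinct summands in `L₁` have distinct partners, so there are at least `c` partners to
    -- choose from, and hitting a single one completes a representation.
    module G₂ = Greedy _≟_ xs zs₂ partner? c 1 c b (s≤s z≤n) ≤-refl partners
    open G₂.HittingSet G₂.hitting-set renaming (L to L₂; L⊆xs to L₂⊆xs; rare to rare₂; short to short₂)

    F₁₂ = L₁ ++ L₂

    covers : ∀ {z} → z ∈ zs₂ → ¬ (G₂.hits L₂ z < 1) → Covered F₁₂ z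
    covers {z} z∈ high with y , _ , y∈L₂ , has ← 0<#⇒∃ (G₂.hit? L₂ z) xs (≮⇒≥ high) with x , x∈L₁ , rep ← find has =
      lose (∈ₚ.∈-++⁺ˡ x∈L₁) (lose (∈ₚ.∈-++⁺ʳ L₁ y∈L₂) rep)

    length-zs : length zs ≤ # (covered? F₁₂) zs + (# (G₁.low? L₁) zs + # (G₂.low? L₂) zs₂)
    length-zs = begin
      length zs ≡⟨ length-filter-split (G₁.low? L₁) zs ⟩
      length (filter (G₁.low? L₁) zs) + length zs₂ ≡⟨ cong₂ _+_ (length-filter≡# (G₁.low? L₁) zs) (length≡# zs₂) ⟩
      # (G₁.low? L₁) zs + # (λ _ → yes tt) zs₂ ≤⟨ ℕₚ.+-monoʳ-≤ _ (#-cover-≤ (covered? F₁₂) (G₂.low? L₂) (λ _ → yes tt) zs₂ λ {z} z∈ _ →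
          case G₂.low? L₂ z of λ { (yes low) → inj₂ low ; (no high) → inj₁ (covers z∈ high) }) ⟩
      # (G₁.low? L₁) zs + (# (covered? F₁₂) zs₂ + # (G₂.low? L₂) zs₂)
        ≤⟨ ℕₚ.+-monoʳ-≤ (# (G₁.low? L₁) zs) (ℕₚ.+-monoˡ-≤ (# (G₂.low? L₂) zs₂) (#-filter-≤ (covered? F₁₂) high? zs)) ⟩
      # (G₁.low? L₁) zs + (# (covered? F₁₂) zs + # (G₂.low? L₂) zs₂) ≡⟨ eq (# (G₁.low? L₁) zs) (# (covered? F₁₂) zs) _ ⟩
      # (covered? F₁₂) zs + (# (G₁.low? L₁) zs + # (G₂.low? L₂) zs₂) ∎
      where
      open ℕₚ.≤-Reasoning
      length≡# : ∀ ys → length ys ≡ # (λ _ → yes tt) ys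
      length≡# ys = sym (trans (∑-const ys 1) (ℕₚ.*-identityʳ _))
      eq : ∀ a b c → a + (b + c) ≡ b + (a + c)
      eq = solve-∀

    short₁′ : length L₁ * c ≤ 2 * (b * k)
    short₁′ = ℕₚ.*-cancelʳ-≤ _ _ c (lin≤ _ _ (length L₁ * suc (c₀ * c₀)) (*-monoʳ-≤ 2 short₁) (eq (length L₁) c₀ (b * k)))
      where
      eq : ∀ l c bk → l * suc c * suc c + 2 * (bk * suc c) + l * suc (c * c) ≡ 2 * bk * suc c + 2 * (l * suc (c * c + c))
      eq = solve-∀

    sum-hitting-set : SumHittingSet
    sum-hitting-set = record
      { F = F₁₂
      ; F⊆xs = λ x∈ → [ L₁⊆xs , L₂⊆xs ]′ (∈ₚ.∈-++⁻ L₁ x∈)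
      ; short = lin≤ _ _ 0 (+-mono-≤ short₁′ short₂)
          (trans (cong (λ l → l * c + (2 * (b * k) + b * k * 1) + 0) (Listₚ.length-++ L₁)) (eq₁ (length L₁) (length L₂) c (b * k)))
      ; covered = bound b (length zs) (length zs₂) _ _ _ length-zs rare₁ rare₂ (Listₚ.length-filter high? zs) }
      where
      eq₁ : ∀ l₁ l₂ c bk → (l₁ + l₂) * c + (2 * bk + bk * 1) + 0 ≡ 3 * bk + (l₁ * c + l₂ * c)
      eq₁ = solve-∀
      bound : ∀ b z z₂ v p q → z ≤ v + (p + q) → b * p ≤ z → b * q ≤ z₂ → z₂ ≤ z → b * z ≤ b * v + 2 * z
      bound b z z₂ v p q h₁ h₂ h₃ h₄ = lin≤ _ _ 0 (+-mono-≤ (*-monoʳ-≤ b h₁) (+-mono-≤ h₂ (≤-trans h₃ h₄))) (eq b z v p q)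
        where
        eq : ∀ b z v p q → b * z + (b * (v + (p + q)) + (z + z)) + 0 ≡ b * v + 2 * z + (b * z + (b * p + b * q))
        eq = solve-∀

-- Subsets and lists

members : Subset n → List (Fin n)
members [] = []
members (inside ∷ X) = Fin.zero ∷ map Fin.suc (members X)
members (outside ∷ X) = map Fin.suc (members X)

members! : (X : Subset n) → Unique (members X)
members! [] = []
members! (inside ∷ X) = Allₚ.map⁺ (All.tabulate λ _ ()) ∷ Uniqueₚ.map⁺ Finₚ.suc-injective (members! X)
members! (outside ∷ X) = Uniqueₚ.map⁺ Finₚ.suc-injective (members! X)

length-members : (X : Subset n) → length (members X) ≡ ∣ X ∣
length-members [] = refl
length-members (inside ∷ X) = cong suc (trans (Listₚ.length-map Fin.suc (members X)) (length-members X))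
length-members (outside ∷ X) = trans (Listₚ.length-map Fin.suc (members X)) (length-members X)

∈-members⁺ : (X : Subset n) {x : Fin n} → x Sub.∈ X → x ∈ members X
∈-members⁺ (_ ∷ X) Vec.here = here refl
∈-members⁺ (inside ∷ X) (Vec.there x∈) = there (∈ₚ.∈-map⁺ Fin.suc (∈-members⁺ X x∈))
∈-members⁺ (outside ∷ X) (Vec.there x∈) = ∈ₚ.∈-map⁺ Fin.suc (∈-members⁺ X x∈)

∈-members⁻ : (X : Subset n) {x : Fin n} → x ∈ members X → x Sub.∈ X
∈-members⁻ (inside ∷ X) (here refl) = Vec.here
∈-members⁻ (inside ∷ X) (there x∈) with y , y∈ , refl ← ∈ₚ.∈-map⁻ Fin.suc x∈ = Vec.there (∈-members⁻ X y∈)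
∈-members⁻ (outside ∷ X) x∈ with y , y∈ , refl ← ∈ₚ.∈-map⁻ Fin.suc x∈ = Vec.there (∈-members⁻ X y∈)

⟦_⟧ : {P : Fin n → Set} → Decidable P → Subset n
⟦ P? ⟧ = Vec.tabulate λ x → ⌊ P? x ⌋

∈-⟦⟧⁺ : {P : Fin n → Set} (P? : Decidable P) {x : Fin n} → P x → x Sub.∈ ⟦ P? ⟧
∈-⟦⟧⁺ P? {x} p = Vecₚ.lookup⇒[]= x ⟦ P? ⟧ (trans (Vecₚ.lookup∘tabulate (λ x → ⌊ P? x ⌋) x) (Equivalence.to Boolₚ.T-≡ (fromWitness p)))

∈-⟦⟧⁻ : {P : Fin n → Set} (P? : Decidable P) {x : Fin n} → x Sub.∈ ⟦ P? ⟧ → P x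
∈-⟦⟧⁻ P? {x} x∈ = toWitness {a? = P? x} (Equivalence.from Boolₚ.T-≡
  (trans (sym (Vecₚ.lookup∘tabulate (λ x → ⌊ P? x ⌋) x)) (Vecₚ.[]=⇒lookup x∈)))

∈-restrictedSumset : (X : Subset n) {x y : Fin n} → x Sub.∈ X → y Sub.∈ X → x ≢ y → x ⊕ y Sub.∈ restrictedSumset X
∈-restrictedSumset {suc n} X {x} {y} x∈ y∈ x≢y = Vecₚ.lookup⇒[]= (x ⊕ y) (restrictedSumset X)
  (trans (Vecₚ.lookup∘tabulate inSumset (x ⊕ y)) (Equivalence.to Boolₚ.T-≡
    (Anyₚ.any⁺ (λ i → any (pair (x ⊕ y) i) (allFin (suc n)))
      (lose (∈ₚ.∈-allFin x) (Anyₚ.any⁺ (pair (x ⊕ y) x) (lose (∈ₚ.∈-allFin y) holds))))))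
  where
  pair : Fin (suc n) → Fin (suc n) → Fin (suc n) → Bool
  pair z i j = Vec.lookup X i ∧ Vec.lookup X j ∧ not ⌊ i Fin.≟ j ⌋ ∧ ⌊ (i ⊕ j) Fin.≟ z ⌋
  inSumset : Fin (suc n) → Bool
  inSumset z = any (λ i → any (pair z i) (allFin (suc n))) (allFin (suc n))
  conjunction : ∀ {a b c d} → a ≡ true → b ≡ true → c ≡ false → d ≡ true → a ∧ b ∧ not c ∧ d ≡ true
  conjunction refl refl refl refl = refl
  holds : Data.Bool.T (pair (x ⊕ y) x y)
  holds = Equivalence.from Boolₚ.T-≡ (conjunction (Vecₚ.[]=⇒lookup x∈) (Vecₚ.[]=⇒lookup y∈)
    (trans (Dec.isYes≗does (x Fin.≟ y)) (Dec.dec-false (x Fin.≟ y) x≢y))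
    (trans (Dec.isYes≗does ((x ⊕ y) Fin.≟ (x ⊕ y))) (Dec.dec-true ((x ⊕ y) Fin.≟ (x ⊕ y)) refl)))

⊕-comm : (x y : Fin n) → x ⊕ y ≡ y ⊕ x
⊕-comm {suc n} x y = cong (λ i → fromℕ< (m%n<n i (suc n))) (ℕₚ.+-comm (toℕ x) (toℕ y))

module ℤ+ = Algebra.Properties.AbelianGroup ℤₚ.+-0-abelianGroup

-- Cancellation is pulled back from ℤ^D along the isomorphism, without computing with residues.
FreimanIso-cancel : {D : ℕ} {X : Subset n} {φ : Fin n → Fin D → ℤ} → IsFreimanIso X φ → ∀ {x y y′} →
                    x Sub.∈ X → y Sub.∈ X → y′ Sub.∈ X → x ⊕ y ≡ x ⊕ y′ → y ≡ y′
FreimanIso-cancel {φ = φ} (inj , hom , _) {x} x∈ y∈ y′∈ eq =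
  inj y∈ y′∈ λ c → ℤ+.∙-cancelˡ (φ x c) _ _ (hom x∈ x∈ y∈ y′∈ eq c)

-- Popular sums and irregular pairs

[]?≤1 : {P : Set} (p : Dec P) → [ p ]? ≤ 1
[]?≤1 (yes _) = ≤-refl
[]?≤1 (no _) = z≤n

#≤1 : {P : A → Set} (P? : Decidable P) {xs : List A} → Unique xs →
      (∀ {x y} → x ∈ xs → y ∈ xs → P x → P y → x ≡ y) → # P? xs ≤ 1
#≤1 P? {xs} xs! equal = ≤-trans (≤-reflexive (sym (length-filter≡# P? xs)))
  (unique-rel-length {ys = tt ∷ []} (λ _ _ → ⊤) (Uniqueₚ.filter⁺ P? xs!)
    (λ x∈ y∈ _ _ → let x∈′ , p = ∈ₚ.∈-filter⁻ P? {xs = xs} x∈ ; y∈′ , q = ∈ₚ.∈-filter⁻ P? {xs = xs} y∈ in equal x∈′ y∈′ p q)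
    (λ _ → tt , here refl , tt))

#≡0 : {P : A → Set} (P? : Decidable P) (xs : List A) → (∀ {x} → x ∈ xs → ¬ P x) → # P? xs ≡ 0
#≡0 P? xs none = trans (∑-cong xs λ {x} x∈ → []?-no (P? x) (none x∈)) (trans (∑-const xs 0) (ℕₚ.*-zeroʳ (length xs)))

module Popular {N : ℕ} (X : Subset N)
               (cancel : ∀ {x y y′} → x ∈ members X → y ∈ members X → y′ ∈ members X → x ⊕ y ≡ x ⊕ y′ → y ≡ y′)
               (t : ℕ) where

  xs = members X
  R = members (restrictedSumset X)
  open SumHitting Fin._≟_ Fin._≟_ _⊕_ ⊕-comm xs (members! X) cancel public

  popular? : ∀ z → Dec (t ≤ # (summand? xs z) xs)
  popular? z = t ≤? # (summand? xs z) xs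

  regular? : ∀ x y → Dec (x ≢ y × t ≤ # (summand? xs (x ⊕ y)) xs)
  regular? x y = ¬? (x Fin.≟ y) ×-dec popular? (x ⊕ y)

  irregular : Fin N → ℕ
  irregular x = # (λ y → ¬? (regular? x y)) xs

  -- An irregular pair is diagonal, or its sum is one of at most `|R|` unpopular sums. By
  -- cancellation each of these has as many ordered representations as summands, that is, fewer than
  -- `t`.
  ∑-irregular : ∑ xs irregular ≤ length xs + length R * t
  ∑-irregular = begin
    ∑ xs irregular ≤⟨ ∑-mono xs per-x ⟩
    ∑[ x ∈ xs ] (1 + ∑[ z ∈ R ] # (rare? z x) xs) ≡⟨ ∑-+ xs (λ _ → 1) _ ⟩
    ∑[ x ∈ xs ] 1 + ∑[ x ∈ xs ] ∑[ z ∈ R ] # (rare? z x) xs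
      ≡⟨ cong₂ _+_ (trans (∑-const xs 1) (ℕₚ.*-identityʳ _)) (∑-swap xs R _) ⟩
    length xs + ∑[ z ∈ R ] ∑[ x ∈ xs ] # (rare? z x) xs ≤⟨ ℕₚ.+-monoʳ-≤ (length xs) (∑-mono R λ {z} _ → per-z z) ⟩
    length xs + ∑[ z ∈ R ] t ≡⟨ cong (length xs +_) (∑-const R t) ⟩
    length xs + length R * t ∎
    where
    open ℕₚ.≤-Reasoning
    rare? : ∀ z x y → Dec (¬ (t ≤ # (summand? xs z) xs) × Rep z x y)
    rare? z x y = ¬? (popular? z) ×-dec rep? z x y

    per-x : ∀ {x} → x ∈ xs → irregular x ≤ 1 + ∑[ z ∈ R ] # (rare? z x) xs
    per-x {x} x∈ = begin
      irregular x ≤⟨ ∑-mono xs per-y ⟩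
      ∑[ y ∈ xs ] ([ x Fin.≟ y ]? + # (λ z → rare? z x y) R) ≡⟨ ∑-+ xs _ _ ⟩
      # (x Fin.≟_) xs + ∑[ y ∈ xs ] # (λ z → rare? z x y) R
        ≤⟨ +-mono-≤ (unique-#≤1 Fin._≟_ x (members! X)) (≤-reflexive (∑-swap xs R _)) ⟩
      1 + ∑[ z ∈ R ] # (rare? z x) xs ∎
      where
      per-y : ∀ {y} → y ∈ xs → [ ¬? (regular? x y) ]? ≤ [ x Fin.≟ y ]? + # (λ z → rare? z x y) R
      per-y {y} y∈ = by-cases (x Fin.≟ y) (popular? (x ⊕ y))
        where
        by-cases : (d : Dec (x ≡ y)) (e : Dec (t ≤ # (summand? xs (x ⊕ y)) xs)) →
                   [ ¬? (¬? d ×-dec e) ]? ≤ [ d ]? + # (λ z → rare? z x y) R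
        by-cases (yes eq) e = ≤-trans ([]?≤1 (¬? (¬? (yes eq) ×-dec e))) (s≤s z≤n)
        by-cases (no _) (yes _) = z≤n
        by-cases (no x≢y) (no unpopular) = ∃⇒0<# (λ z → rare? z x y)
          (∈-members⁺ (restrictedSumset X) (∈-restrictedSumset X (∈-members⁻ X x∈) (∈-members⁻ X y∈) x≢y))
          (unpopular , x≢y , refl)

    per-z : ∀ z → ∑[ x ∈ xs ] # (rare? z x) xs ≤ t
    per-z z = by-cases (popular? z)
      where
      by-cases : Dec (t ≤ # (summand? xs z) xs) → ∑[ x ∈ xs ] # (rare? z x) xs ≤ t
      by-cases (yes popular) = ≤-trans (≤-reflexive (trans
        (∑-cong xs λ {x} _ → #≡0 (rare? z x) xs λ _ (unpopular , _) → unpopular popular)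
        (trans (∑-const xs 0) (ℕₚ.*-zeroʳ (length xs))))) z≤n
      by-cases (no unpopular) = ≤-trans (∑-mono xs λ {x} x∈ → per-summand x∈ (summand? xs z x)) (ℕₚ.<⇒≤ (≰⇒> unpopular))
        where
        per-summand : ∀ {x} → x ∈ xs → (d : Dec (Any (Rep z x) xs)) → # (rare? z x) xs ≤ [ d ]?
        per-summand {x} x∈ (yes _) = #≤1 (rare? z x) (members! X)
          λ y∈ y′∈ (_ , _ , eq) (_ , _ , eq′) → cancel x∈ y∈ y′∈ (trans eq (sym eq′))
        per-summand {x} x∈ (no none) = ≤-reflexive (#≡0 (rare? z x) xs λ y∈ (_ , rep) → none (lose y∈ rep))

  module _ (q : ℕ) where

    good? : ∀ x → Dec (q * irregular x ≤ length xs)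
    good? x = q * irregular x ≤? length xs

    -- Markov's inequality for `irregular`.
    few-bad : # (λ x → ¬? (good? x)) xs * length xs ≤ q * ∑ xs irregular
    few-bad = ≤-trans (≤-reflexive (trans (ℕₚ.*-comm (# (λ x → ¬? (good? x)) xs) (length xs)) (sym (∑-*ˡ xs (length xs) _))))
      (≤-trans (∑-mono xs per-x) (≤-reflexive (∑-*ˡ xs q irregular)))
      where
      per-x : ∀ {x} → x ∈ xs → length xs * [ ¬? (good? x) ]? ≤ q * irregular x
      per-x {x} _ with good? x
      ... | yes _ = ≤-trans (≤-reflexive (ℕₚ.*-zeroʳ (length xs))) z≤n
      ... | no bad = ≤-trans (≤-reflexive (ℕₚ.*-identityʳ (length xs))) (ℕₚ.<⇒≤ (≰⇒> bad))

    record PopularSums (T ys : List (Fin N)) : Set where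
      field
        zs rest : List (Fin N)
        zs! : Unique zs
        zs-popular : ∀ {z} → z ∈ zs → t ≤ # (summand? xs z) xs
        complete : ∀ {u y} → u ∈ T → y ∈ ys → u ⊕ y ∈ zs ++ rest
        length-rest : q * length rest ≤ length T * length xs

    -- Each element of `T` is good and thus has at most `|xs| / q` irregular partners. Their sums
    -- make up `rest`, and all other sums are popular.
    popular-sums : ∀ T ys → (∀ {u} → u ∈ T → q * irregular u ≤ length xs) → Unique ys → (∀ {y} → y ∈ ys → y ∈ xs) → PopularSums T ys
    popular-sums T ys good ys! ys⊆xs = record
      { zs = zs ; rest = map sum irregulars ; zs! = proj₁ (proj₂ tr) ; zs-popular = zs-popular ; complete = complete
      ; length-rest = ≤-trans (≤-reflexive (cong (q *_) (Listₚ.length-map sum irregulars))) (length-irregulars T good) }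
      where
      sum : Fin N × Fin N → Fin N
      sum (u , y) = u ⊕ y
      regular-pair? : ∀ (p : Fin N × Fin N) → Dec (proj₁ p ≢ proj₂ p × t ≤ # (summand? xs (sum p)) xs)
      regular-pair? (u , y) = regular? u y
      pairs = List.cartesianProduct T ys
      regulars = filter regular-pair? pairs
      irregulars = filter (¬? ∘ regular-pair?) pairs
      tr = transversal Fin._≟_ sum regulars
      zs = map sum (proj₁ tr)
      zs-popular : ∀ {z} → z ∈ zs → t ≤ # (summand? xs z) xs
      zs-popular z∈ with p , p∈ , refl ← ∈ₚ.∈-map⁻ sum z∈ =
        proj₂ (proj₂ (∈ₚ.∈-filter⁻ regular-pair? {xs = pairs} (proj₁ (proj₂ (proj₂ tr)) p∈)))
      complete : ∀ {u y} → u ∈ T → y ∈ ys → u ⊕ y ∈ zs ++ map sum irregulars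
      complete {u} {y} u∈ y∈ = by-cases (regular? u y)
        where
        p∈ = ∈ₚ.∈-cartesianProduct⁺ u∈ y∈
        by-cases : Dec (u ≢ y × t ≤ # (summand? xs (u ⊕ y)) xs) → u ⊕ y ∈ zs ++ map sum irregulars
        by-cases (yes reg) = ∈ₚ.∈-++⁺ˡ (proj₂ (proj₂ (proj₂ tr)) (∈ₚ.∈-filter⁺ regular-pair? p∈ reg))
        by-cases (no irr) = ∈ₚ.∈-++⁺ʳ zs (∈ₚ.∈-map⁺ sum (∈ₚ.∈-filter⁺ (¬? ∘ regular-pair?) p∈ irr))
      length-irregulars : ∀ T → (∀ {u} → u ∈ T → q * irregular u ≤ length xs) →
                          q * length (filter (¬? ∘ regular-pair?) (List.cartesianProduct T ys)) ≤ length T * length xs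
      length-irregulars [] _ = ≤-reflexive (ℕₚ.*-zeroʳ q)
      length-irregulars (u ∷ T) good = begin
        q * length (filter irr? (map (u ,_) ys ++ List.cartesianProduct T ys))
          ≡⟨ cong (λ l → q * length l) (Listₚ.filter-++ irr? (map (u ,_) ys) _) ⟩
        q * length (filter irr? (map (u ,_) ys) ++ filter irr? (List.cartesianProduct T ys))
          ≡⟨ cong (q *_) (Listₚ.length-++ (filter irr? (map (u ,_) ys))) ⟩
        q * (length (filter irr? (map (u ,_) ys)) + length (filter irr? (List.cartesianProduct T ys)))
          ≡⟨ ℕₚ.*-distribˡ-+ q _ (length (filter irr? (List.cartesianProduct T ys))) ⟩
        q * length (filter irr? (map (u ,_) ys)) + q * length (filter irr? (List.cartesianProduct T ys))
          ≤⟨ +-mono-≤ (≤-trans (*-monoʳ-≤ q row) (good (here refl))) (length-irregulars T (good ∘ there)) ⟩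
        length xs + length T * length xs ∎
        where
        open ℕₚ.≤-Reasoning
        irr? = ¬? ∘ regular-pair?
        row : length (filter irr? (map (u ,_) ys)) ≤ irregular u
        row = ≤-trans (≤-reflexive (trans (length-filter≡# irr? (map (u ,_) ys)) (∑-map ys)))
          (≤-trans (#-inj-length (λ y → ¬? (regular? u y)) id ys! id (λ y∈ irr → ∈ₚ.∈-filter⁺ (λ y → ¬? (regular? u y)) (ys⊆xs y∈) irr))
            (≤-reflexive (length-filter≡# (λ y → ¬? (regular? u y)) xs)))
          where
          ∑-map : ∀ ys → ∑ (map (u ,_) ys) (λ p → [ irr? p ]?) ≡ # (λ y → ¬? (regular? u y)) ys
          ∑-map [] = refl
          ∑-map (y ∷ ys) = cong ([ irr? (u , y) ]? +_) (∑-map ys)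

-- Arithmetic of the losses and of the constants

few-bad-arith : ∀ g q k m t B β → 0 < k → β * k ≤ q * (k + m * t) → 16 * g * q * (m * t) ≤ B * B →
                32 * g * q ≤ B → 2 * B ≤ k → 16 * g * β ≤ B
few-bad-arith g q k m t B β 0<k h₁ h₂ h₃ h₄ = ℕₚ.*-cancelʳ-≤ _ _ (2 * k) {{ℕ.>-nonZero (≤-trans 0<k (m≤m+n k _))}}
  (lin≤ _ _ 0 (+-mono-≤ (*-monoʳ-≤ (32 * g) h₁) (+-mono-≤ (*-monoʳ-≤ 2 h₂) (+-mono-≤ (*-monoˡ-≤ k h₃) (*-monoʳ-≤ B h₄))))
    (eq g q k m t B β))
  where
  eq : ∀ g q k m t B β →
       16 * g * β * (2 * k) + (32 * g * (q * (k + m * t)) + (2 * (B * B) + (B * k + B * k))) + 0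
       ≡ B * (2 * k) + (32 * g * (β * k) + (2 * (16 * g * q * (m * t)) + (32 * g * q * k + B * (2 * B))))
  eq = solve-∀

-- The loss is a proportion of at most `1 / (32 (g + 1))` for the bad elements and `1 / (8 (g + 1))`
-- for each of three causes: the translates, the irregular sums and the sums that are not hit.
-- Together they stay below `1 / (g + 1)`.
combine-arith : ∀ g D k k′ β z y v → k ≤ k′ + β → 32 * suc g * β ≤ k →
                D * ((8 * g + 7) * k′) ≤ 2 * suc (8 * g + 7) * (z + y) → 16 * suc g * y ≤ D * k →
                16 * suc g * z ≤ 16 * suc g * v + 2 * z → D * (g * k) ≤ 2 * suc g * v
combine-arith g D k k′ β z y v h₁ h₂ h₃ h₄ h₅ =
  ℕₚ.*-cancelˡ-≤ (2048 * suc g * suc g) {{_}} (lin≤ _ _ (D * k * (1216 * g * g + 2512 * g + 1295))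
    (+-mono-≤ (*-monoʳ-≤ (32 * suc g * D * (8 * g + 7) * (8 * g + 7)) h₁)
    (+-mono-≤ (*-monoʳ-≤ (D * (8 * g + 7) * (8 * g + 7)) h₂)
    (+-mono-≤ (*-monoʳ-≤ (32 * suc g * (8 * g + 7)) h₃)
    (+-mono-≤ (*-monoʳ-≤ (32 * suc g * (8 * g + 7)) h₄)
      (*-monoʳ-≤ (32 * suc g * 8 * suc g) h₅)))))
    (eq g D k k′ β z y v))
  where
  eq : ∀ g D k k′ β z y v →
    2048 * suc g * suc g * (D * (g * k)) + (32 * suc g * D * (8 * g + 7) * (8 * g + 7) * (k′ + β) + (D * (8 * g + 7) * (8 * g + 7) * k
      + (32 * suc g * (8 * g + 7) * (2 * suc (8 * g + 7) * (z + y)) + (32 * suc g * (8 * g + 7) * (D * k) + 32 * suc g * 8 * suc g * (16 * suc g * v + 2 * z)))))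
      + D * k * (1216 * g * g + 2512 * g + 1295)
    ≡ 2048 * suc g * suc g * (2 * suc g * v) + (32 * suc g * D * (8 * g + 7) * (8 * g + 7) * k + (D * (8 * g + 7) * (8 * g + 7) * (32 * suc g * β)
      + (32 * suc g * (8 * g + 7) * (D * ((8 * g + 7) * k′)) + (32 * suc g * (8 * g + 7) * (16 * suc g * y) + 32 * suc g * 8 * suc g * (16 * suc g * z)))))
  eq = solve-∀

-- Passing to restricted sums loses only the doubles of the `τ` translates, and
-- `τ ≤ D (8 g + 9) ≤ D k / (16 (g + 1))`.
small-arith : ∀ g D k r τ → D * ((8 * g + 7) * k) ≤ 2 * suc (8 * g + 7) * (r + τ) → τ ≤ D * suc (suc (8 * g + 7)) →
              16 * suc g * suc (suc (8 * g + 7)) ≤ k → D * (g * k) ≤ 2 * suc g * r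
small-arith g D k r τ h₁ h₂ h₃ = ℕₚ.*-cancelˡ-≤ 8 (lin≤ _ _ (6 * (D * k))
  (+-mono-≤ h₁ (+-mono-≤ (*-monoʳ-≤ (16 * suc g) h₂) (*-monoʳ-≤ D h₃))) (eq g D k r τ))
  where
  eq : ∀ g D k r τ →
       8 * (D * (g * k)) + (2 * suc (8 * g + 7) * (r + τ) + (16 * suc g * (D * suc (suc (8 * g + 7))) + D * k)) + 6 * (D * k)
       ≡ 8 * (2 * suc g * r) + (D * ((8 * g + 7) * k) + (16 * suc g * τ + D * (16 * suc g * suc (suc (8 * g + 7)))))
  eq = solve-∀

enough-good-arith : ∀ g k y β → k ≤ y + β → 32 * suc g * β ≤ k → 16 * suc g ≤ k → suc (8 * g + 7) ≤ y
enough-good-arith g k y β h₁ h₂ h₃ = ℕₚ.*-cancelˡ-≤ 2 (lin≤ _ _ (32 * g * β + 30 * β)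
  (+-mono-≤ (*-monoʳ-≤ 2 h₁) (+-mono-≤ h₂ h₃)) (eq g k y β))
  where
  eq : ∀ g k y β → 2 * suc (8 * g + 7) + (2 * (y + β) + (k + k)) + (32 * g * β + 30 * β)
       ≡ 2 * y + (2 * k + (32 * suc g * β + 16 * suc g))
  eq = solve-∀

-- The rounding of `c` costs `c + 2 ≤ 2 (c + 1)`, so `l² B² ≤ 4 (3 b k)² Q m`. The constant 288 is
-- `8 * 4 * 9`.
size-arith : ∀ l c b k B Q m C → l * suc c ≤ 3 * (b * k) → B * B ≤ suc (suc c) * suc (suc c) * (Q * m) →
             288 * (b * b) * Q ≤ C * C → 8 * (l * l) * (B * B) ≤ C * C * m * (k * k)
size-arith l c b k B Q m C h₁ h₂ h₃ = begin
  8 * (l * l) * (B * B) ≤⟨ *-monoʳ-≤ (8 * (l * l)) (≤-trans h₂ (*-monoˡ-≤ (Q * m) (*-mono-≤ suc≤ suc≤))) ⟩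
  8 * (l * l) * (2 * suc c * (2 * suc c) * (Q * m)) ≡⟨ eq₁ l (suc c) (Q * m) ⟩
  32 * (l * suc c * (l * suc c)) * (Q * m) ≤⟨ *-monoˡ-≤ (Q * m) (*-monoʳ-≤ 32 (*-mono-≤ h₁ h₁)) ⟩
  32 * (3 * (b * k) * (3 * (b * k))) * (Q * m) ≡⟨ eq₂ b k Q m ⟩
  288 * (b * b) * Q * (m * (k * k)) ≤⟨ *-monoˡ-≤ (m * (k * k)) h₃ ⟩
  C * C * (m * (k * k)) ≡⟨ sym (ℕₚ.*-assoc (C * C) m (k * k)) ⟩
  C * C * m * (k * k) ∎
  where
  open ℕₚ.≤-Reasoning
  suc≤ : suc (suc c) ≤ 2 * suc c
  suc≤ = lin≤ _ _ c z≤n (eq c)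
    where
    eq : ∀ c → suc (suc c) + 0 + c ≡ 2 * suc c + 0
    eq = solve-∀
  eq₁ : ∀ l c M → 8 * (l * l) * (2 * c * (2 * c) * M) ≡ 32 * (l * c * (l * c)) * M
  eq₁ = solve-∀
  eq₂ : ∀ b k Q m → 32 * (3 * (b * k) * (3 * (b * k))) * (Q * m) ≡ 288 * (b * b) * Q * (m * (k * k))
  eq₂ = solve-∀

-- The origin of `q`: with at most `D (8 g + 9)` translates losing `k / q` sums each, this value
-- makes the total loss `D k / (16 (g + 1))`.
rest-arith : ∀ g D q r τ k → q ≡ 16 * suc g * suc (suc (8 * g + 7)) → q * r ≤ τ * k → τ ≤ D * suc (suc (8 * g + 7)) →
             16 * suc g * r ≤ D * k
rest-arith g D q r τ k refl h₁ h₂ = ℕₚ.*-cancelˡ-≤ (suc (suc (8 * g + 7)))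
  (lin≤ _ _ 0 (+-mono-≤ h₁ (*-monoʳ-≤ k h₂)) (eq g D r τ k (suc (suc (8 * g + 7)))))
  where
  eq : ∀ g D r τ k G → G * (16 * suc g * r) + (τ * k + k * (D * G)) + 0 ≡ G * (D * k) + (16 * suc g * G * r + k * τ)
  eq = solve-∀

-- The fingerprint of a single set

floor-search : {P : ℕ → Set} → Decidable P → P 0 → ∀ n → ¬ P n → ∃ λ c → P c × ¬ P (suc c)
floor-search P? p0 zero ¬p = ⊥-elim (¬p p0)
floor-search P? p0 (suc n) ¬p with P? n
... | yes p = n , p , ¬p
... | no ¬p′ = floor-search P? p0 n ¬p′

-- `size` says that `|F|` is at most `C k √m / (√8 B)`. In the factor 8, 4 comes from `ε k ≤ 2 B`
-- and 2 from using `1 / 2` as a lower bound for `ln m`.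
record Fingerprint {N : ℕ} (X : Subset N) (d k m B g C : ℕ) : Set where
  field
    F : Subset N
    F⊆X : F ⊆ X
    size : 8 * (∣ F ∣ * ∣ F ∣) * (B * B) ≤ C * C * m * (k * k)
    large : suc d * (g * k) ≤ 2 * suc g * ∣ restrictedSumset F ∣

module _ {N : ℕ} (X : Subset N) (d m B g C q : ℕ) (q-def : q ≡ 16 * suc g * suc (suc (8 * g + 7))) where

  private
    k = length (members X)
    D = suc d
    -- Each of the two hitting rounds misses a proportion of at most `1 / b`, together
    -- `1 / (8 (g + 1))`.
    b = 16 * suc g
    Q = b * q

  whole-set : 8 * (B * B) ≤ C * C * m → q ≤ k → DimF≥ X d → Fingerprint X d k m B g C
  whole-set small q≤k dim = record
    { F = X
    ; F⊆X = id
    ; size = subst (λ f → 8 * (f * f) * (B * B) ≤ C * C * m * (k * k)) (length-members X)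
        (≤-trans (≤-reflexive (eq k (B * B))) (*-monoˡ-≤ (k * k) small))
    ; large = subst (λ r → D * (g * k) ≤ 2 * suc g * r) (length-members (restrictedSumset X))
        (small-arith g D k (length R) (length T)
          (≤-trans (many (R ++ map double T) covers)
            (≤-reflexive (cong (2 * suc (8 * g + 7) *_) (trans (Listₚ.length-++ R) (cong (length R +_) (Listₚ.length-map double T))))))
          length-T q≤k′) }
    where
    q≤k′ = ≤-trans (≤-reflexive (sym q-def)) q≤k
    R = members (restrictedSumset X)
    double : Fin N → Fin N
    double t = t ⊕ t
    open ManySumsℤₙ (many-sums-ℤₙ X (members X) (members! X) (∈-members⁻ X) (∈-members⁺ X) d (8 * g + 7)
      (≤-trans (≤-trans (ℕₚ.n≤1+n _) (ℕₚ.m≤n*m (suc (suc (8 * g + 7))) b)) q≤k′) dim)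
    covers : ∀ {t x} → t ∈ T → x ∈ members X → t ⊕ x ∈ R ++ map double T
    covers {t} {x} t∈ x∈ = by-cases (t Fin.≟ x)
      where
      by-cases : Dec (t ≡ x) → t ⊕ x ∈ R ++ map double T
      by-cases (yes refl) = ∈ₚ.∈-++⁺ʳ R (∈ₚ.∈-map⁺ double t∈)
      by-cases (no t≢x) = ∈ₚ.∈-++⁺ˡ (∈-members⁺ (restrictedSumset X)
        (∈-restrictedSumset X (∈-members⁻ X (T⊆xs t∈)) (∈-members⁻ X x∈) t≢x))
    eq : ∀ k b → 8 * (k * k) * b ≡ 8 * b * (k * k)
    eq = solve-∀

  module Sparse (R≤m : length (members (restrictedSumset X)) ≤ m) (0<k : 0 < k)
                (32gq≤B : 32 * suc g * q ≤ B) (2B≤k : 2 * B ≤ k)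
                (C-large : 288 * (b * b) * Q ≤ C * C)
                (cancel : ∀ {x y y′} → x ∈ members X → y ∈ members X → y′ ∈ members X → x ⊕ y ≡ x ⊕ y′ → y ≡ y′)
                (c₀ : ℕ) (c-low : suc c₀ * suc c₀ * (Q * m) ≤ B * B) (c-high : B * B ≤ suc (suc c₀) * suc (suc c₀) * (Q * m)) where
    -- The threshold is a square because each of the two hitting rounds consumes one of its factors.
    -- It is the largest square not exceeding `B² / (Q m)`.
    t = suc c₀ * suc c₀
    open Popular X cancel t hiding (k; c)

    β = # (λ x → ¬? (good? q x)) xs
    ys = filter (good? q) xs

    -- Markov's inequality gives `β k ≤ q (k + m t)`. Multiplied by `16 (g + 1)`, each of the two
    -- terms is at most `B k / 2`: the first since `32 (g + 1) q ≤ B`, the second by the choice of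
    -- `t` and `2 B ≤ k`.
    16gβ≤B : 16 * suc g * β ≤ B
    16gβ≤B = few-bad-arith (suc g) q k m t B β 0<k
      (≤-trans (few-bad q) (*-monoʳ-≤ q (≤-trans ∑-irregular (ℕₚ.+-monoʳ-≤ k (*-monoˡ-≤ t R≤m)))))
      (≤-trans (≤-reflexive (eq Q m t)) c-low) 32gq≤B 2B≤k
      where
      eq : ∀ Q m t → Q * (m * t) ≡ t * (Q * m)
      eq = solve-∀

    32gβ≤k : 32 * suc g * β ≤ k
    32gβ≤k = ≤-trans (≤-reflexive (eq (suc g) β)) (≤-trans (*-monoʳ-≤ 2 16gβ≤B) 2B≤k)
      where
      eq : ∀ g β → 32 * g * β ≡ 2 * (16 * g * β)
      eq = solve-∀

    k≤ys+β : k ≤ length ys + β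
    k≤ys+β = ≤-reflexive (trans (length-filter-split (good? q) xs) (cong (length ys +_) (length-filter≡# (λ x → ¬? (good? q x)) xs)))

    in-X′? : ∀ x → Dec (x ∈ ys)
    in-X′? x = DecMembership._∈?_ Fin._≟_ x ys

    X′ : Subset N
    X′ = ⟦ in-X′? ⟧

    X′⊆X : X′ ⊆ X
    X′⊆X x∈ = ∈-members⁻ X (proj₁ (∈ₚ.∈-filter⁻ (good? q) {xs = xs} (∈-⟦⟧⁻ in-X′? x∈)))

    X′-large : k ≤ ∣ X′ ∣ + B
    X′-large = ≤-trans k≤ys+β (+-mono-≤
      (≤-trans (unique-⊆-length (Uniqueₚ.filter⁺ (good? q) (members! X)) (∈-members⁺ X′ ∘ ∈-⟦⟧⁺ in-X′?)) (≤-reflexive (length-members X′)))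
      (≤-trans (ℕₚ.m≤n*m β (16 * suc g)) 16gβ≤B))

    16g≤k : 16 * suc g ≤ k
    16g≤k = ≤-trans (≤-trans (ℕₚ.m≤m*n b (suc (suc (8 * g + 7)))) (≤-reflexive (sym q-def)))
      (≤-trans (≤-trans (ℕₚ.m≤n*m q (32 * suc g)) 32gq≤B) (≤-trans (m≤m+n B _) 2B≤k))

    module _ (M : ManySumsℤₙ ys d (8 * g + 7)) where
      open ManySumsℤₙ M

      good-T : ∀ {u} → u ∈ T → q * irregular u ≤ k
      good-T u∈ = proj₂ (∈ₚ.∈-filter⁻ (good? q) {xs = xs} (T⊆xs u∈))

      from-popular-sums : PopularSums q T ys → Fingerprint X d k m B g C
      from-popular-sums P = from-hitting-set (sum-hitting-set zs c₀ b zs-popular)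
        where
        open PopularSums P
        from-hitting-set : SumHittingSet zs c₀ b zs-popular → Fingerprint X d k m B g C
        from-hitting-set H = record
          { F = F′
          ; F⊆X = λ x∈ → ∈-members⁻ X (F⊆xs (∈-⟦⟧⁻ in-F? x∈))
          ; size = ≤-trans (*-monoˡ-≤ (B * B) (*-monoʳ-≤ 8 (*-mono-≤ ∣F′∣≤ ∣F′∣≤))) (size-arith (length F) c₀ b k B Q m C short c-high C-large)
          ; large = ≤-trans (combine-arith g D k (length ys) β (length zs) (length rest) (# (covered? F) zs) k≤ys+β 32gβ≤k
              (≤-trans (many (zs ++ rest) complete) (≤-reflexive (cong (2 * suc (8 * g + 7) *_) (Listₚ.length-++ zs))))
              (rest-arith g D q (length rest) (length T) k q-def length-rest length-T) covered)
              (*-monoʳ-≤ (2 * suc g) (≤-trans (#-inj-length (covered? F) id zs! id covered-in) (≤-reflexive (length-members (restrictedSumset F′))))) }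
          where
          open SumHittingSet H
          in-F? : ∀ x → Dec (x ∈ F)
          in-F? x = DecMembership._∈?_ Fin._≟_ x F
          F′ = ⟦ in-F? ⟧
          ∣F′∣≤ : ∣ F′ ∣ ≤ length F
          ∣F′∣≤ = ≤-trans (≤-reflexive (sym (length-members F′)))
            (unique-⊆-length (members! F′) (∈-⟦⟧⁻ in-F? ∘ ∈-members⁻ F′))
          covered-in : ∀ {z} → z ∈ zs → Covered F z → z ∈ members (restrictedSumset F′)
          covered-in _ cov with x , x∈ , cov′ ← find cov with y , y∈ , x≢y , refl ← find cov′ =
            ∈-members⁺ (restrictedSumset F′) (∈-restrictedSumset F′ (∈-⟦⟧⁺ in-F? x∈) (∈-⟦⟧⁺ in-F? y∈) x≢y)

      fingerprint : Fingerprint X d k m B g C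
      fingerprint = from-popular-sums (popular-sums q T ys good-T (Uniqueₚ.filter⁺ (good? q) (members! X))
        (λ y∈ → proj₁ (∈ₚ.∈-filter⁻ (good? q) {xs = xs} y∈)))

    -- At most `B` elements are bad, so robustness applies to the good ones. It only refutes that
    -- their dimension is too small, hence the double negation.
    sparse : (∀ X′ → X′ ⊆ X → k ≤ ∣ X′ ∣ + B → ¬ ¬ DimF≥ X′ d) → ¬ ¬ Fingerprint X d k m B g C
    sparse robust none = robust X′ X′⊆X X′-large λ dim → none (fingerprint
      (many-sums-ℤₙ X′ ys (Uniqueₚ.filter⁺ (good? q) (members! X)) (∈-⟦⟧⁺ in-X′?) (∈-⟦⟧⁻ in-X′?) d (8 * g + 7)
        (enough-good-arith g k (length ys) β k≤ys+β 32gβ≤k 16g≤k) dim))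

  exists-fingerprint : length (members (restrictedSumset X)) ≤ m → 0 < m → 32 * suc g * q ≤ B → 2 * B ≤ k →
                       288 * (b * b) * Q ≤ C * C → DimF≥ X d →
                       (∀ X′ → X′ ⊆ X → k ≤ ∣ X′ ∣ + B → ¬ ¬ DimF≥ X′ d) → ¬ ¬ Fingerprint X d k m B g C
  exists-fingerprint R≤m 0<m 32gq≤B 2B≤k C-large dim@(_ , _ , φ , iso , _) robust = by-cases (8 * (B * B) ≤? C * C * m)
    where
    B≤k : B ≤ k
    B≤k = ≤-trans (m≤m+n B _) 2B≤k
    0<q : 0 < q
    0<q = ≤-trans (s≤s z≤n) (≤-reflexive (sym q-def))
    q≤k : q ≤ k
    q≤k = ≤-trans (≤-trans (ℕₚ.m≤n*m q (32 * suc g)) 32gq≤B) B≤k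
    0<Qm : 0 < Q * m
    0<Qm = *-mono-≤ (*-mono-≤ {1} {b} (s≤s z≤n) 0<q) 0<m
    c : ∃ λ c → c * c * (Q * m) ≤ B * B × ¬ (suc c * suc c * (Q * m) ≤ B * B)
    c = floor-search (λ c → c * c * (Q * m) ≤? B * B) z≤n (suc B) λ h →
      ℕₚ.<⇒≱ (≤-trans (s≤s (m≤m+n (B * B) (B + B))) (≤-trans (≤-reflexive (eq B)) (*-monoʳ-≤ (suc B * suc B) 0<Qm))) h
      where
      eq : ∀ B → suc (B * B + (B + B)) ≡ suc B * suc B * 1
      eq = solve-∀
    by-cases : Dec (8 * (B * B) ≤ C * C * m) → ¬ ¬ Fingerprint X d k m B g C
    by-cases (yes small) none = none (whole-set small q≤k dim)
    by-cases (no big) with c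
    ... | suc c₀ , low , high = Sparse.sparse R≤m (≤-trans 0<q q≤k) 32gq≤B 2B≤k C-large
            (λ x∈ y∈ y′∈ → FreimanIso-cancel iso (∈-members⁻ X x∈) (∈-members⁻ X y∈) (∈-members⁻ X y′∈)) c₀ low (ℕₚ.<⇒≤ (≰⇒> high)) robust
    -- `c = 0` would mean `B² < Q m`. As `8 Q ≤ C²`, the whole set would then be an admissible
    -- fingerprint.
    ... | zero , _ , high = ⊥-elim (big (≤-trans (*-monoʳ-≤ 8 (ℕₚ.<⇒≤ (≰⇒> high)))
            (≤-trans (≤-reflexive (eq Q m)) (*-monoˡ-≤ m (≤-trans (*-monoˡ-≤ Q 8≤) C-large)))))
      where
      eq : ∀ Q m → 8 * (1 * 1 * (Q * m)) ≡ 8 * Q * m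
      eq = solve-∀
      8≤ : 8 ≤ 288 * (b * b)
      8≤ = ≤-trans (ℕₚ.m≤m+n 8 280) (ℕₚ.m≤m*n 288 (b * b))

-- Rational estimates

ι-* : ∀ i j → ι (i ℤ.* j) ≡ ι i ℚ.* ι j
ι-* i j = ℚₚ.toℚᵘ-injective (begin
  ℚ.toℚᵘ (ι (i ℤ.* j)) ≈⟨ ℚₚ.toℚᵘ-fromℚᵘ (mkℚᵘ (i ℤ.* j) 0) ⟩
  mkℚᵘ i 0 ℚᵘ.* mkℚᵘ j 0 ≈⟨ ℚᵘₚ.*-cong (ℚₚ.toℚᵘ-fromℚᵘ (mkℚᵘ i 0)) (ℚₚ.toℚᵘ-fromℚᵘ (mkℚᵘ j 0)) ⟨
  ℚ.toℚᵘ (ι i) ℚᵘ.* ℚ.toℚᵘ (ι j) ≈⟨ ℚₚ.toℚᵘ-homo-* (ι i) (ι j) ⟨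
  ℚ.toℚᵘ (ι i ℚ.* ι j) ∎)
  where open ℚᵘₚ.≃-Reasoning

ι-mono-≤ : ∀ {i j} → i ℤ.≤ j → ι i ℚ.≤ ι j
ι-mono-≤ {i} {j} i≤j = ℚₚ.toℚᵘ-cancel-≤ (begin
  ℚ.toℚᵘ (ι i) ≃⟨ ℚₚ.toℚᵘ-fromℚᵘ (mkℚᵘ i 0) ⟩
  mkℚᵘ i 0 ≤⟨ ℚᵘ.*≤* (ℤₚ.*-monoʳ-≤-nonNeg ℤ.1ℤ i≤j) ⟩
  mkℚᵘ j 0 ≃⟨ ℚₚ.toℚᵘ-fromℚᵘ (mkℚᵘ j 0) ⟨
  ℚ.toℚᵘ (ι j) ∎)
  where open ℚᵘₚ.≤-Reasoning

ι-cancel-≤ : ∀ {i j} → ι i ℚ.≤ ι j → i ℤ.≤ j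
ι-cancel-≤ {i} {j} ιi≤ιj with ℚᵘ.*≤* h ← ℚᵘₚ.≤-respˡ-≃ (ℚₚ.toℚᵘ-fromℚᵘ (mkℚᵘ i 0))
                             (ℚᵘₚ.≤-respʳ-≃ (ℚₚ.toℚᵘ-fromℚᵘ (mkℚᵘ j 0)) (ℚₚ.toℚᵘ-mono-≤ ιi≤ιj)) =
  ℤₚ.*-cancelʳ-≤-pos i j ℤ.1ℤ h

half-as-product : ∀ i → i ℚ./ 2 ≡ ½ ℚ.* ι i
half-as-product i = ℚₚ.toℚᵘ-injective (begin
  ℚ.toℚᵘ (i ℚ./ 2) ≈⟨ ℚₚ.toℚᵘ-fromℚᵘ (mkℚᵘ i 1) ⟩
  mkℚᵘ i 1 ≈⟨ ℚᵘ.*≡* (cong (ℤ._* ℤ.+ 2) (sym (ℤₚ.*-identityˡ i))) ⟩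
  ℚ.toℚᵘ ½ ℚᵘ.* mkℚᵘ i 0 ≈⟨ ℚᵘₚ.*-congˡ {ℚ.toℚᵘ ½} (ℚₚ.toℚᵘ-fromℚᵘ (mkℚᵘ i 0)) ⟨
  ℚ.toℚᵘ ½ ℚᵘ.* ℚ.toℚᵘ (ι i) ≈⟨ ℚₚ.toℚᵘ-homo-* ½ (ι i) ⟨
  ℚ.toℚᵘ (½ ℚ.* ι i) ∎)
  where open ℚᵘₚ.≃-Reasoning

numerator-as-product : ∀ p → ι (ℚ.↥ p) ≡ p ℚ.* ι (ℚ.↧ p)
numerator-as-product p@(ℚ.mkℚ n d _) = ℚₚ.toℚᵘ-injective (begin
  ℚ.toℚᵘ (ι n) ≈⟨ ℚₚ.toℚᵘ-fromℚᵘ (mkℚᵘ n 0) ⟩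
  mkℚᵘ n 0 ≈⟨ ℚᵘ.*≡* (trans (cong (n ℤ.*_) (ℤₚ.*-identityʳ (ℤ.+ suc d))) (sym (ℤₚ.*-identityʳ (n ℤ.* ℤ.+ suc d)))) ⟩
  ℚ.toℚᵘ p ℚᵘ.* mkℚᵘ (ℤ.+ suc d) 0 ≈⟨ ℚᵘₚ.*-congˡ {ℚ.toℚᵘ p} (ℚₚ.toℚᵘ-fromℚᵘ (mkℚᵘ (ℤ.+ suc d) 0)) ⟨
  ℚ.toℚᵘ p ℚᵘ.* ℚ.toℚᵘ (ι (ℤ.+ suc d)) ≈⟨ ℚₚ.toℚᵘ-homo-* p (ι (ℤ.+ suc d)) ⟨
  ℚ.toℚᵘ (p ℚ.* ι (ℤ.+ suc d)) ∎)
  where open ℚᵘₚ.≃-Reasoning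

⟨_⟩ : ℕ → ℚ
⟨ a ⟩ = ι (ℤ.+ a)

⟨⟩-mono-≤ : ∀ {a b} → a ≤ b → ⟨ a ⟩ ℚ.≤ ⟨ b ⟩
⟨⟩-mono-≤ {a} {b} a≤b = ι-mono-≤ {ℤ.+ a} {ℤ.+ b} (ℤ.+≤+ a≤b)

⟨⟩-cancel-≤ : ∀ {a b} → ⟨ a ⟩ ℚ.≤ ⟨ b ⟩ → a ≤ b
⟨⟩-cancel-≤ {a} {b} h = ℤₚ.drop‿+≤+ (ι-cancel-≤ {ℤ.+ a} {ℤ.+ b} h)

⟨⟩-* : ∀ a b → ⟨ a * b ⟩ ≡ ⟨ a ⟩ ℚ.* ⟨ b ⟩
⟨⟩-* a b = trans (cong ι (ℤₚ.pos-* a b)) (ι-* (ℤ.+ a) (ℤ.+ b))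

⟨⟩-+ : ∀ a b → ⟨ a + b ⟩ ≡ ⟨ a ⟩ ℚ.+ ⟨ b ⟩
⟨⟩-+ a b = trans (cong ι (ℤₚ.pos-+ a b)) (ι-+ (ℤ.+ a) (ℤ.+ b))

0≤⟨⟩ : ∀ a → 0ℚ ℚ.≤ ⟨ a ⟩
0≤⟨⟩ a = ⟨⟩-mono-≤ {0} {a} z≤n

0<⟨⟩ : ∀ {a} → 0 < a → 0ℚ ℚ.< ⟨ a ⟩
0<⟨⟩ {a} 0<a = ℚₚ.≰⇒> λ h → ℕₚ.<⇒≱ 0<a (⟨⟩-cancel-≤ {a} {0} h)

*-mono-≤ˡ : ∀ {p q r} → 0ℚ ℚ.≤ r → p ℚ.≤ q → r ℚ.* p ℚ.≤ r ℚ.* q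
*-mono-≤ˡ {r = r} 0≤r = ℚₚ.*-monoˡ-≤-nonNeg r {{ℚ.nonNegative 0≤r}}

*-mono-≤ʳ : ∀ {p q r} → 0ℚ ℚ.≤ r → p ℚ.≤ q → p ℚ.* r ℚ.≤ q ℚ.* r
*-mono-≤ʳ {r = r} 0≤r = ℚₚ.*-monoʳ-≤-nonNeg r {{ℚ.nonNegative 0≤r}}

*-mono-≤² : ∀ {p q r s} → 0ℚ ℚ.≤ r → 0ℚ ℚ.≤ q → p ℚ.≤ q → r ℚ.≤ s → p ℚ.* r ℚ.≤ q ℚ.* s
*-mono-≤² 0≤r 0≤q p≤q r≤s = ℚₚ.≤-trans (*-mono-≤ʳ 0≤r p≤q) (*-mono-≤ˡ 0≤q r≤s)

0≤* : ∀ {p q} → 0ℚ ℚ.≤ p → 0ℚ ℚ.≤ q → 0ℚ ℚ.≤ p ℚ.* q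
0≤* {p} {q} 0≤p 0≤q = subst (ℚ._≤ p ℚ.* q) (ℚₚ.*-zeroʳ p) (*-mono-≤ˡ 0≤p 0≤q)

0<* : ∀ {p q} → 0ℚ ℚ.< p → 0ℚ ℚ.< q → 0ℚ ℚ.< p ℚ.* q
0<* {p} {q} 0<p 0<q = subst (ℚ._< p ℚ.* q) (ℚₚ.*-zeroʳ p) (ℚₚ.*-monoʳ-<-pos p {{ℚ.positive 0<p}} 0<q)

*-cancel-≤ʳ : ∀ {p q} r → 0ℚ ℚ.< r → p ℚ.* r ℚ.≤ q ℚ.* r → p ℚ.≤ q
*-cancel-≤ʳ r 0<r = ℚₚ.*-cancelʳ-≤-pos r {{ℚ.positive 0<r}}

-- The exponential series is dominated by the geometric series with ratio 1/2.
module _ {x : ℚ} (0≤x : 0ℚ ℚ.≤ x) (x≤½ : x ℚ.≤ ½) where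

  halves : ℕ → ℚ
  halves zero = 1ℚ
  halves (suc i) = halves i ℚ.* ½

  0≤½ : 0ℚ ℚ.≤ ½
  0≤½ = ℚₚ.≤-trans 0≤x x≤½

  0≤halves : ∀ i → 0ℚ ℚ.≤ halves i
  0≤halves zero = 0≤⟨⟩ 1
  0≤halves (suc i) = 0≤* (0≤halves i) 0≤½

  1/suc : ℕ → ℚ
  1/suc i = ℤ.+ 1 ℚ./ suc i

  0≤1/suc : ∀ i → 0ℚ ℚ.≤ 1/suc i
  0≤1/suc i = ℚₚ.nonNegative⁻¹ (1/suc i) {{ℚₚ.normalize-nonNeg 1 (suc i)}}

  1/suc≤1 : ∀ i → 1/suc i ℚ.≤ 1ℚ
  1/suc≤1 i = ℚₚ.toℚᵘ-cancel-≤ (ℚᵘₚ.≤-respˡ-≃ (ℚᵘₚ.≃-sym (ℚₚ.toℚᵘ-fromℚᵘ (mkℚᵘ (ℤ.+ 1) i))) (ℚᵘ.*≤* (ℤ.+≤+ (s≤s z≤n))))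

  expTerm≤halves : ∀ i → expTerm x i ℚ.≤ halves i
  expTerm≤halves zero = ℚₚ.≤-refl
  expTerm≤halves (suc i) = subst (expTerm x (suc i) ℚ.≤_) (ℚₚ.*-identityʳ (halves (suc i)))
    (*-mono-≤² (0≤1/suc i) (0≤halves (suc i)) (*-mono-≤² 0≤x (0≤halves i) (expTerm≤halves i) x≤½) (1/suc≤1 i))

  -- `halves N ℚ.+ halves N` is the tail of the geometric series from the term `N` on, and including
  -- it makes the induction telescope.
  expPartial+halves≤2 : ∀ N → expPartial x N ℚ.+ (halves N ℚ.+ halves N) ℚ.≤ ⟨ 2 ⟩
  expPartial+halves≤2 zero = ℚₚ.≤-reflexive refl
  expPartial+halves≤2 (suc N) = begin
    expPartial x N ℚ.+ expTerm x N ℚ.+ (halves N ℚ.* ½ ℚ.+ halves N ℚ.* ½)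
      ≤⟨ ℚₚ.+-monoˡ-≤ _ (ℚₚ.+-monoʳ-≤ (expPartial x N) (expTerm≤halves N)) ⟩
    expPartial x N ℚ.+ halves N ℚ.+ (halves N ℚ.* ½ ℚ.+ halves N ℚ.* ½)
      ≡⟨ solve 2 (λ e h → e :+ h :+ (h :* con ½ :+ h :* con ½) := e :+ (h :+ h)) refl (expPartial x N) (halves N) ⟩
    expPartial x N ℚ.+ (halves N ℚ.+ halves N) ≤⟨ expPartial+halves≤2 N ⟩
    ⟨ 2 ⟩ ∎
    where
    open ℚₚ.≤-Reasoning
    open QS

  expPartial≤2 : ∀ N → expPartial x N ℚ.≤ ⟨ 2 ⟩
  expPartial≤2 N = ℚₚ.≤-trans
    (subst (ℚ._≤ expPartial x N ℚ.+ (halves N ℚ.+ halves N)) (ℚₚ.+-identityʳ (expPartial x N))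
      (ℚₚ.+-monoʳ-≤ (expPartial x N) (ℚₚ.+-mono-≤ (0≤halves N) (0≤halves N))))
    (expPartial+halves≤2 N)

½≤ln : ∀ {x m} → 2 ≤ m → x ℚ.≤ ½ → x ≤ln m
½≤ln {x} {m} 2≤m x≤½ with x ℚₚ.≤? 0ℚ
... | yes x≤0 = inj₁ x≤0
... | no x≰0 = inj₂ λ N → ℚₚ.≤-trans (expPartial≤2 (ℚₚ.<⇒≤ (ℚₚ.≰⇒> x≰0)) x≤½ N) (⟨⟩-mono-≤ {2} {m} 2≤m)

-- The fingerprints are smaller than required by the factor √(log m): m ≥ 2 and x ≤ 1/2 suffice for x ≤ ln m.
boundedBy : ∀ s C B k m ε → 0 < C → 0 < k → 2 ≤ m → 0ℚ ℚ.≤ ε → ε ℚ.* ⟨ k ⟩ ℚ.≤ ⟨ 2 * B ⟩ →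
            8 * (s * s) * (B * B) ≤ C * C * m * (k * k) → BoundedBy s ⟨ C ⟩ ε m
boundedBy s C B k m ε 0<C 0<k 2≤m 0≤ε εk≤2B size x x≤ = ½≤ln 2≤m (*-cancel-≤ʳ W 0<W (begin
  x ℚ.* W ≡⟨ solve 4 (λ x c m k → x :* (c :* c :* m :* (k :* k)) := x :* (c :* c :* m) :* (k :* k)) refl x ⟨ C ⟩ ⟨ m ⟩ ⟨ k ⟩ ⟩
  x ℚ.* (⟨ C ⟩ ℚ.* ⟨ C ⟩ ℚ.* ⟨ m ⟩) ℚ.* (⟨ k ⟩ ℚ.* ⟨ k ⟩) ≤⟨ *-mono-≤ʳ (0≤* (0≤⟨⟩ k) (0≤⟨⟩ k)) x≤ ⟩
  ⟨ s ⟩ ℚ.* ⟨ s ⟩ ℚ.* ε ℚ.* ε ℚ.* (⟨ k ⟩ ℚ.* ⟨ k ⟩)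
    ≡⟨ solve 3 (λ s e k → s :* s :* e :* e :* (k :* k) := s :* s :* (e :* k :* (e :* k))) refl ⟨ s ⟩ ε ⟨ k ⟩ ⟩
  ⟨ s ⟩ ℚ.* ⟨ s ⟩ ℚ.* (ε ℚ.* ⟨ k ⟩ ℚ.* (ε ℚ.* ⟨ k ⟩))
    ≤⟨ *-mono-≤ˡ (0≤* (0≤⟨⟩ s) (0≤⟨⟩ s)) (*-mono-≤² (0≤* 0≤ε (0≤⟨⟩ k)) (0≤⟨⟩ (2 * B)) εk≤2B εk≤2B) ⟩
  ⟨ s ⟩ ℚ.* ⟨ s ⟩ ℚ.* (⟨ 2 * B ⟩ ℚ.* ⟨ 2 * B ⟩) ≡⟨ integral ⟩
  ½ ℚ.* ⟨ 8 * (s * s) * (B * B) ⟩ ≤⟨ *-mono-≤ˡ 0≤½′ (⟨⟩-mono-≤ {8 * (s * s) * (B * B)} {C * C * m * (k * k)} size) ⟩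
  ½ ℚ.* ⟨ C * C * m * (k * k) ⟩ ≡⟨ cong (½ ℚ.*_) (sym W≡) ⟩
  ½ ℚ.* W ∎))
  where
  open ℚₚ.≤-Reasoning
  open QS
  W = ⟨ C ⟩ ℚ.* ⟨ C ⟩ ℚ.* ⟨ m ⟩ ℚ.* (⟨ k ⟩ ℚ.* ⟨ k ⟩)
  0≤½′ : 0ℚ ℚ.≤ ½
  0≤½′ = ℚₚ.nonNegative⁻¹ ½
  0<W : 0ℚ ℚ.< W
  0<W = 0<* (0<* (0<* (0<⟨⟩ {C} 0<C) (0<⟨⟩ {C} 0<C)) (0<⟨⟩ {m} (≤-trans (s≤s z≤n) 2≤m))) (0<* (0<⟨⟩ {k} 0<k) (0<⟨⟩ {k} 0<k))
  W≡ : W ≡ ⟨ C * C * m * (k * k) ⟩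
  W≡ = sym (trans (⟨⟩-* (C * C * m) (k * k)) (cong₂ ℚ._*_ (trans (⟨⟩-* (C * C) m) (cong (ℚ._* ⟨ m ⟩) (⟨⟩-* C C))) (⟨⟩-* k k)))
  integral : ⟨ s ⟩ ℚ.* ⟨ s ⟩ ℚ.* (⟨ 2 * B ⟩ ℚ.* ⟨ 2 * B ⟩) ≡ ½ ℚ.* ⟨ 8 * (s * s) * (B * B) ⟩
  integral = trans (cong (λ b → ⟨ s ⟩ ℚ.* ⟨ s ⟩ ℚ.* (b ℚ.* b)) (⟨⟩-* 2 B))
    (trans (solve 2 (λ s b → s :* s :* (con ⟨ 2 ⟩ :* b :* (con ⟨ 2 ⟩ :* b)) := con ½ :* (con ⟨ 8 ⟩ :* (s :* s) :* (b :* b))) refl ⟨ s ⟩ ⟨ B ⟩)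
      (cong (½ ℚ.*_) (sym (trans (⟨⟩-* (8 * (s * s)) (B * B))
        (cong₂ ℚ._*_ (trans (⟨⟩-* 8 (s * s)) (cong (⟨ 8 ⟩ ℚ.*_) (⟨⟩-* s s))) (⟨⟩-* B B))))))

-- `1 ≤ γ (g + 1)` amounts to `1 - γ ≤ g / (g + 1)`, the proportion that was obtained over ℕ.
large-sumset : ∀ γ g D k r → 1ℚ ℚ.≤ γ ℚ.* ⟨ suc g ⟩ → D * (g * k) ≤ 2 * suc g * r →
               (1ℚ ℚ.- γ) ℚ.* (ℤ.+ (D * k) ℚ./ 2) ℚ.≤ ⟨ r ⟩
large-sumset γ g D k r 1≤ large = *-cancel-≤ʳ (⟨ 2 ⟩ ℚ.* ⟨ suc g ⟩) (0<* (0<⟨⟩ {2} (s≤s z≤n)) (0<⟨⟩ {suc g} (s≤s z≤n))) (begin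
  (1ℚ ℚ.- γ) ℚ.* (ℤ.+ (D * k) ℚ./ 2) ℚ.* (⟨ 2 ⟩ ℚ.* ⟨ suc g ⟩)
    ≡⟨ cong (λ h → (1ℚ ℚ.- γ) ℚ.* h ℚ.* (⟨ 2 ⟩ ℚ.* ⟨ suc g ⟩)) (half-as-product (ℤ.+ (D * k))) ⟩
  (1ℚ ℚ.- γ) ℚ.* (½ ℚ.* ⟨ D * k ⟩) ℚ.* (⟨ 2 ⟩ ℚ.* ⟨ suc g ⟩)
    ≡⟨ solve 3 (λ c n s → (con 1ℚ :- c) :* (con ½ :* n) :* (con ⟨ 2 ⟩ :* s) := (s :- c :* s) :* n) refl γ ⟨ D * k ⟩ ⟨ suc g ⟩ ⟩
  (⟨ suc g ⟩ ℚ.- γ ℚ.* ⟨ suc g ⟩) ℚ.* ⟨ D * k ⟩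
    ≤⟨ *-mono-≤ʳ (0≤⟨⟩ (D * k)) (ℚₚ.+-monoʳ-≤ ⟨ suc g ⟩ (ℚₚ.neg-antimono-≤ 1≤)) ⟩
  (⟨ suc g ⟩ ℚ.- 1ℚ) ℚ.* ⟨ D * k ⟩ ≡⟨ cong (λ s → (s ℚ.- 1ℚ) ℚ.* ⟨ D * k ⟩) (⟨⟩-+ 1 g) ⟩
  (1ℚ ℚ.+ ⟨ g ⟩ ℚ.- 1ℚ) ℚ.* ⟨ D * k ⟩
    ≡⟨ solve 2 (λ g n → (con 1ℚ :+ g :- con 1ℚ) :* n := g :* n) refl ⟨ g ⟩ ⟨ D * k ⟩ ⟩
  ⟨ g ⟩ ℚ.* ⟨ D * k ⟩ ≡⟨ trans (sym (⟨⟩-* g (D * k))) (cong ⟨_⟩ (commute g D k)) ⟩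
  ⟨ D * (g * k) ⟩ ≤⟨ ⟨⟩-mono-≤ {D * (g * k)} {2 * suc g * r} large ⟩
  ⟨ 2 * suc g * r ⟩ ≡⟨ trans (⟨⟩-* (2 * suc g) r) (cong (ℚ._* ⟨ r ⟩) (⟨⟩-* 2 (suc g))) ⟩
  ⟨ 2 ⟩ ℚ.* ⟨ suc g ⟩ ℚ.* ⟨ r ⟩ ≡⟨ ℚₚ.*-comm _ ⟨ r ⟩ ⟩
  ⟨ r ⟩ ℚ.* (⟨ 2 ⟩ ℚ.* ⟨ suc g ⟩) ∎)
  where
  open ℚₚ.≤-Reasoning
  open QS
  commute : ∀ g D k → g * (D * k) ≡ D * (g * k)
  commute = solve-∀

-- Each of the intermediate steps loses at most a proportion of 1 / (8 (g + 1)), where 1 / (g + 1) ≤ γ.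
record Constants (g : ℕ) : Set where
  field
    c q : ℕ
    q-def : q ≡ 16 * suc g * suc (suc (8 * g + 7))
    32gq≤c : 32 * suc g * q ≤ c
    c-large : 288 * (16 * suc g * (16 * suc g)) * (16 * suc g * q) ≤ c * c
    2≤c : 2 ≤ c

twice≤ : ∀ b r → 1 ≤ b → 2 * r ≤ 288 * (b * b) * r
twice≤ b r 1≤b = *-monoˡ-≤ r (*-mono-≤ {2} {288} {1} {b * b} (m≤m+n 2 286) (*-mono-≤ 1≤b 1≤b))

≤-square : ∀ c → 2 ≤ c → c ≤ c * c
≤-square c 2≤c = ℕₚ.m≤m*n c c {{ℕ.>-nonZero (≤-trans (s≤s z≤n) 2≤c)}}

abstract
  constants : ∀ g → Constants g
  constants g = record
    -- Only a lower bound on `c²` is required; this number is itself that bound, and being at least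
    -- 2 it does not exceed its square.
    { c = 288 * (b * b) * (b * q)
    ; q = q
    ; q-def = refl
    ; 32gq≤c = ≤-trans (≤-reflexive (eq (suc g) q)) (twice≤ b (b * q) 1≤b)
    ; c-large = ≤-square (288 * (b * b) * (b * q)) 2≤c
    ; 2≤c = 2≤c }
    where
    b q : ℕ
    b = 16 * suc g
    q = 16 * suc g * suc (suc (8 * g + 7))
    1≤b : 1 ≤ b
    1≤b = s≤s z≤n
    2≤c : 2 ≤ 288 * (b * b) * (b * q)
    2≤c = ≤-trans (*-monoʳ-≤ 2 (*-mono-≤ {1} {b} {1} {q} 1≤b (s≤s z≤n))) (twice≤ b (b * q) 1≤b)
    eq : ∀ g q → 32 * g * q ≡ 2 * (16 * g * q)
    eq = solve-∀

-- The family

<ℚ⇒≱ : ∀ {p q} → p ℚ.< q → ¬ (q ℚ.≤ p)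
<ℚ⇒≱ p<q q≤p = ℚₚ.<-irrefl refl (ℚₚ.<-≤-trans p<q q≤p)

-- The denominator of γ serves: its product with γ is the numerator, a positive integer.
reciprocal : ∀ γ → 0ℚ ℚ.< γ → ∃ λ g → 1ℚ ℚ.≤ γ ℚ.* ⟨ suc g ⟩
reciprocal γ@(ℚ.mkℚ num den _) 0<γ =
  den , subst (1ℚ ℚ.≤_) (numerator-as-product γ) (ι-mono-≤ (ℤₚ.i<j⇒suc[i]≤j (ℤₚ.≰⇒> numerator≰0)))
  where
  numerator≰0 : ¬ (num ℤ.≤ ℤ.0ℤ)
  numerator≰0 h = <ℚ⇒≱ (subst (0ℚ ℚ.<_) (sym (numerator-as-product γ)) (0<* 0<γ (0<⟨⟩ {suc den} (s≤s z≤n)))) (ι-mono-≤ h)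

subsets : ∀ n → List (Subset n)
subsets zero = [] ∷ []
subsets (suc n) = map (inside ∷_) (subsets n) ++ map (outside ∷_) (subsets n)

∈-subsets : (X : Subset n) → X ∈ subsets n
∈-subsets [] = here refl
∈-subsets (inside ∷ X) = ∈ₚ.∈-++⁺ˡ (∈ₚ.∈-map⁺ (inside ∷_) (∈-subsets X))
∈-subsets (outside ∷ X) = ∈ₚ.∈-++⁺ʳ _ (∈ₚ.∈-map⁺ (outside ∷_) (∈-subsets X))

module Family {γ ε : ℚ} (γ<½ : γ ℚ.< ½) (ε<γ : ε ℚ.< γ) {g : ℕ} (1≤γg : 1ℚ ℚ.≤ γ ℚ.* ⟨ suc g ⟩) (K : Constants g)
              {n : ℕ} (k d m : ℕ) (dk≤2m : (d + 1) * k ≤ 2 * m) (c<εk : ⟨ Constants.c K ⟩ ℚ.< ε ℚ.* ⟨ k ⟩) (P : Subset n) where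
  open Constants K

  ½≤1 : ½ ℚ.≤ 1ℚ
  ½≤1 = toWitness {a? = ½ ℚₚ.≤? 1ℚ} tt

  ε≤½ : ε ℚ.≤ ½
  ε≤½ = ℚₚ.<⇒≤ (ℚₚ.<-trans ε<γ γ<½)

  0<ε : 0ℚ ℚ.< ε
  0<ε = ℚₚ.≰⇒> λ ε≤0 → <ℚ⇒≱ (ℚₚ.≤-<-trans (0≤⟨⟩ c) c<εk)
    (subst (ε ℚ.* ⟨ k ⟩ ℚ.≤_) (ℚₚ.*-zeroˡ ⟨ k ⟩) (*-mono-≤ʳ {ε} {0ℚ} {⟨ k ⟩} (0≤⟨⟩ k) ε≤0))

  abstract
    floor : ∃ λ b → ⟨ b ⟩ ℚ.≤ ε ℚ.* ⟨ k ⟩ × ¬ (⟨ suc b ⟩ ℚ.≤ ε ℚ.* ⟨ k ⟩)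
    floor = floor-search (λ b → ⟨ b ⟩ ℚₚ.≤? (ε ℚ.* ⟨ k ⟩)) (ℚₚ.≤-trans (0≤⟨⟩ c) (ℚₚ.<⇒≤ c<εk)) (suc k) λ h →
      ℕₚ.1+n≰n (⟨⟩-cancel-≤ {suc k} {k} (ℚₚ.≤-trans h (subst (ε ℚ.* ⟨ k ⟩ ℚ.≤_) (ℚₚ.*-identityˡ ⟨ k ⟩)
        (*-mono-≤ʳ {ε} {1ℚ} {⟨ k ⟩} (0≤⟨⟩ k) (ℚₚ.≤-trans ε≤½ ½≤1)))))

  ⌊εk⌋ : ℕ
  ⌊εk⌋ = proj₁ floor

  ⌊εk⌋≤εk : ⟨ ⌊εk⌋ ⟩ ℚ.≤ ε ℚ.* ⟨ k ⟩
  ⌊εk⌋≤εk = proj₁ (proj₂ floor)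

  εk<⌊εk⌋+1 : ε ℚ.* ⟨ k ⟩ ℚ.< ⟨ suc ⌊εk⌋ ⟩
  εk<⌊εk⌋+1 = ℚₚ.≰⇒> (proj₂ (proj₂ floor))

  c≤⌊εk⌋ : c ≤ ⌊εk⌋
  c≤⌊εk⌋ = ≮⇒≥ λ ⌊εk⌋<c → proj₂ (proj₂ floor) (ℚₚ.≤-trans (⟨⟩-mono-≤ {suc ⌊εk⌋} {c} ⌊εk⌋<c) (ℚₚ.<⇒≤ c<εk))

  2⌊εk⌋≤k : 2 * ⌊εk⌋ ≤ k
  2⌊εk⌋≤k = ⟨⟩-cancel-≤ {2 * ⌊εk⌋} {k} (begin
    ⟨ 2 * ⌊εk⌋ ⟩ ≡⟨ ⟨⟩-* 2 ⌊εk⌋ ⟩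
    ⟨ 2 ⟩ ℚ.* ⟨ ⌊εk⌋ ⟩ ≤⟨ *-mono-≤ˡ {⟨ ⌊εk⌋ ⟩} {½ ℚ.* ⟨ k ⟩} {⟨ 2 ⟩} (0≤⟨⟩ 2) (ℚₚ.≤-trans ⌊εk⌋≤εk (*-mono-≤ʳ {ε} {½} {⟨ k ⟩} (0≤⟨⟩ k) ε≤½)) ⟩
    ⟨ 2 ⟩ ℚ.* (½ ℚ.* ⟨ k ⟩) ≡⟨ trans (sym (ℚₚ.*-assoc ⟨ 2 ⟩ ½ ⟨ k ⟩)) (ℚₚ.*-identityˡ ⟨ k ⟩) ⟩
    ⟨ k ⟩ ∎)
    where open ℚₚ.≤-Reasoning

  2≤⌊εk⌋ : 2 ≤ ⌊εk⌋
  2≤⌊εk⌋ = ≤-trans 2≤c c≤⌊εk⌋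

  εk≤2⌊εk⌋ : ε ℚ.* ⟨ k ⟩ ℚ.≤ ⟨ 2 * ⌊εk⌋ ⟩
  εk≤2⌊εk⌋ = ℚₚ.≤-trans (ℚₚ.<⇒≤ εk<⌊εk⌋+1) (⟨⟩-mono-≤ {suc ⌊εk⌋} {2 * ⌊εk⌋}
    (≤-trans (ℕₚ.+-monoˡ-≤ ⌊εk⌋ (≤-trans (s≤s z≤n) 2≤⌊εk⌋)) (≤-reflexive (cong (⌊εk⌋ +_) (sym (ℕₚ.+-identityʳ ⌊εk⌋))))))

  -- The chain is `4 ≤ 2 ⌊εk⌋ ≤ k ≤ (d + 1) k ≤ 2 m`. From `m = 2` on, `ln m` exceeds `1 / 2`.
  2≤m : 2 ≤ m
  2≤m = ℕₚ.*-cancelˡ-≤ 2 (≤-trans (≤-trans (*-monoʳ-≤ 2 2≤⌊εk⌋) 2⌊εk⌋≤k) (≤-trans (≤-trans (ℕₚ.m≤n+m k (d * k)) (≤-reflexive (eq d k))) dk≤2m))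
    where
    eq : ∀ d k → d * k + k ≡ (d + 1) * k
    eq = solve-∀

  0<k : 0 < k
  0<k = ≤-trans (≤-trans (s≤s z≤n) 2≤⌊εk⌋) (≤-trans (m≤m+n ⌊εk⌋ _) 2⌊εk⌋≤k)

  -- Logarithms and rationals are absent, which makes the condition decidable: 𝓕 can be filtered out
  -- of all subsets, and a double negation can be removed.
  Good : Subset n → Set
  Good F = F ⊆ P × 8 * (∣ F ∣ * ∣ F ∣) * (⌊εk⌋ * ⌊εk⌋) ≤ c * c * m * (k * k) × suc d * (g * k) ≤ 2 * suc g * ∣ restrictedSumset F ∣

  good? : Decidable Good
  good? F = (F Subₚ.⊆? P) ×-dec ((_ ≤? _) ×-dec (_ ≤? _))

  𝓕 : List (Subset n)
  𝓕 = filter good? (subsets n)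

  𝓕-good : ∀ F → F ∈ 𝓕 → F ⊆ P × BoundedBy ∣ F ∣ ⟨ c ⟩ ε m ×
           (1ℚ ℚ.- γ) ℚ.* (ℤ.+ ((d + 1) * k) ℚ./ 2) ℚ.≤ ⟨ ∣ restrictedSumset F ∣ ⟩
  𝓕-good F F∈ with _ , F⊆P , size , large ← ∈ₚ.∈-filter⁻ good? {xs = subsets n} F∈ =
    F⊆P
    , boundedBy (∣ F ∣) c ⌊εk⌋ k m ε (≤-trans (s≤s z≤n) 2≤c) 0<k 2≤m (ℚₚ.<⇒≤ 0<ε) εk≤2⌊εk⌋ size
    , large-sumset γ g (d + 1) k (∣ restrictedSumset F ∣) 1≤γg
        (subst (λ D → D * (g * k) ≤ 2 * suc g * ∣ restrictedSumset F ∣) (sym (ℕₚ.+-comm d 1)) large)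

  few-removed : ∀ {a} → k ≤ a + ⌊εk⌋ → (1ℚ ℚ.- ε) ℚ.* ⟨ k ⟩ ℚ.≤ ⟨ a ⟩
  few-removed {a} k≤ = begin
    (1ℚ ℚ.- ε) ℚ.* ⟨ k ⟩ ≡⟨ solve 2 (λ e k → (con 1ℚ :- e) :* k := k :- e :* k) refl ε ⟨ k ⟩ ⟩
    ⟨ k ⟩ ℚ.- ε ℚ.* ⟨ k ⟩ ≤⟨ ℚₚ.+-mono-≤ (⟨⟩-mono-≤ {k} {a + ⌊εk⌋} k≤) (ℚₚ.neg-antimono-≤ ⌊εk⌋≤εk) ⟩
    ⟨ a + ⌊εk⌋ ⟩ ℚ.- ⟨ ⌊εk⌋ ⟩ ≡⟨ cong (ℚ._- ⟨ ⌊εk⌋ ⟩) (⟨⟩-+ a ⌊εk⌋) ⟩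
    ⟨ a ⟩ ℚ.+ ⟨ ⌊εk⌋ ⟩ ℚ.- ⟨ ⌊εk⌋ ⟩ ≡⟨ solve 2 (λ a b → a :+ b :- b := a) refl ⟨ a ⟩ ⟨ ⌊εk⌋ ⟩ ⟩
    ⟨ a ⟩ ∎
    where
    open ℚₚ.≤-Reasoning
    open QS

  𝓕-fingerprints : ∀ X → X ⊆ P → ∣ X ∣ ≡ k → ∣ restrictedSumset X ∣ ≤ m → RobustFreimanDim ε X d →
                   Σ (Subset n) λ F → F ∈ 𝓕 × F ⊆ X
  𝓕-fingerprints X X⊆P ∣X∣≡k sumset≤m (dim , robust) =
    -- There are finitely many candidates and each can be tested, so the doubly negated existence
    -- becomes a witness.
    let F , good , F⊆X = decidable-stable (Subₚ.anySubset? λ F → good? F ×-dec (F Subₚ.⊆? X)) ¬¬found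
    in F , ∈ₚ.∈-filter⁺ good? (∈-subsets F) good , F⊆X
    where
    length≡k : length (members X) ≡ k
    length≡k = trans (length-members X) ∣X∣≡k

    fingerprint : ¬ ¬ Fingerprint X d k m ⌊εk⌋ g c
    fingerprint = subst (λ k → ¬ ¬ Fingerprint X d k m ⌊εk⌋ g c) length≡k
      (exists-fingerprint X d m ⌊εk⌋ g c q q-def (≤-trans (≤-reflexive (length-members (restrictedSumset X))) sumset≤m)
        (≤-trans (s≤s z≤n) 2≤m) (≤-trans 32gq≤c c≤⌊εk⌋) (≤-trans 2⌊εk⌋≤k (≤-reflexive (sym length≡k))) c-large dim
        λ X′ X′⊆X k≤ ¬dim → robust (X′ , X′⊆X
          , subst (λ a → (1ℚ ℚ.- ε) ℚ.* ⟨ a ⟩ ℚ.≤ ⟨ ∣ X′ ∣ ⟩) (sym ∣X∣≡k) (few-removed (≤-trans (≤-reflexive (sym length≡k)) k≤)) , ¬dim))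

    ¬¬found : ¬ ¬ ∃ λ F → Good F × F ⊆ X
    ¬¬found none = fingerprint λ f → let open Fingerprint f in none (F , ((λ x∈ → X⊆P (F⊆X x∈)) , size , large) , F⊆X)

theorem2p1 : Σ ℕ λ n₀ →
    (γ : ℚ) → 0ℚ ℚ.< γ → γ ℚ.< ½ →
    Σ ℚ λ C → 0ℚ ℚ.< C ×
    ((n : ℕ) → Prime n → n₀ ≤ n →
    (k d m : ℕ) → (d ℕ.+ 1) ℕ.* k ≤ 2 ℕ.* m →
    (ε : ℚ) → C ℚ.< ε ℚ.* (ℤ.+ k ℚ./ 1) → ε ℚ.< γ →
    (P : Subset n) → IsGAP d P →
    Σ (List (Subset n)) λ 𝓕 →
    ((F : Subset n) → F ∈ 𝓕 →
    F ⊆ P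
    × BoundedBy ∣ F ∣ C ε m
    × (1ℚ ℚ.- γ) ℚ.* (ℤ.+ ((d ℕ.+ 1) ℕ.* k) ℚ./ 2)
    ℚ.≤ (ℤ.+ ∣ restrictedSumset F ∣ ℚ./ 1))
    × ((X : Subset n) → X ⊆ P → ∣ X ∣ ≡ k →
    ∣ restrictedSumset X ∣ ≤ m → RobustFreimanDim ε X d →
    Σ (Subset n) λ F → F ∈ 𝓕 × F ⊆ X))
theorem2p1 = 0 , λ γ 0<γ γ<½ →
  let g , 1≤γg = reciprocal γ 0<γ
      K = constants g
  in ⟨ Constants.c K ⟩ , 0<⟨⟩ {Constants.c K} (≤-trans (s≤s z≤n) (Constants.2≤c K)) ,
     λ n _ _ k d m dk≤2m ε C<εk ε<γ P _ →
       let module 𝔽 = Family γ<½ ε<γ 1≤γg K k d m dk≤2m C<εk P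
       in 𝔽.𝓕 , 𝔽.𝓕-good , 𝔽.𝓕-fingerprints
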